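{- Let $d\ge1$ and let $p$ be an integer. For every partition $\lambda$ of $d$, $$\frac1{d!}\sum_{\mu\in\mathbf P(d)}S_p(\mu)\,z_\mu\,\chi^\lambda(\mu)^2\;=\;T_p(\lambda).$$
   Context: $\mathbf P(d)$ is the set of partitions of $d$. For $\mu=(\mu_1,\dots,\mu_k)$ with positive parts, $S_p(\mu)=\sum_{j=1}^k\mu_j^p$. $z_\mu$ denotes the number of elements of the conjugacy class of $S_d$ with cycle type $\mu$ (the size of the class, not of the centralizer), and $\chi^\lambda(\mu)$ is the value on this class of the irreducible character of $S_d$ associated with $\lambda$. $T_p(\lambda)=\sum_{\xi\in Y_\lambda}h(\xi)^{p-1}$, where $Y_\lambda$ is the Young diagram of $\lambda$ and $h(\xi)$ is the hook-length of the cell $\xi$. -}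

module Defs where

open import Data.Bool.Base using (if_then_else_)
open import Data.Fin.Base using (Fin; zero; suc; toℕ)
import Data.Fin.Base as Fin
import Data.Fin.Properties as Fin
open import Data.Fin.Permutation
  using (Permutation′; _⟨$⟩ʳ_; _∘ₚ_; flip; insert)
  renaming (_≈_ to _≈ₚ_; id to idₚ)
open import Data.Integer.Base using (ℤ; +_; -[1+_]; 1ℤ)
import Data.Integer.Base as ℤ
open import Data.List.Base
  using (List; []; _∷_; [_]; allFin; cartesianProduct; concatMap; filter;
         foldr; length; lookup; map; mapMaybe)
open import Data.List.Properties using (filter-≐; ≡-dec)
open import Data.List.Relation.Unary.All using (All; all?)
open import Data.List.Relation.Unary.Linked using (Linked; linked?)
open import Data.Nat.Base
  using (ℕ; zero; suc; _≤_; _<_; _≥_; _^_; _!)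
open import Data.Nat.GeneralisedArithmetic using (fold; iterate)
open import Data.Nat.ListAction using (sum)
open import Data.Nat.Properties
  using (_≟_; _≤?_; _<?_; _≥?_; m^n≢0; _!≢0; ≤-decTotalOrder)
open import Data.Product.Base using (∃-syntax; _×_; _,_)
open import Data.Rational.Base
  using (ℚ; 0ℚ; 1ℚ; _/_; _+_; _*_; -_)
import Data.Maybe.Base as Maybe
open import Data.Sum.Base using (_⊎_)
open import Function.Base using (_∘_)
open import Function.Bundles using (Inverse; _↔_; mk⇔)
open import Relation.Binary.PropositionalEquality
  using (_≡_; refl; sym; trans; cong; cong₂; subst₂)
import Relation.Binary.Properties.DecTotalOrder as DecTotalOrder
open import Relation.Nullary.Decidable
  using (Dec; does; dec⇒maybe; does-⇔; _×-dec_; _⊎-dec_; _→-dec_)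
open import Data.List.Sort.InsertionSort (DecTotalOrder.≥-decTotalOrder ≤-decTotalOrder)
  using (sort)

fromℕ : ℕ → ℚ
fromℕ n = + n / 1

∑ : {X : Set} → List X → (X → ℚ) → ℚ
∑ xs f = foldr (λ x acc → f x + acc) 0ℚ xs

infix 5 ∑
syntax ∑ xs (λ x → e) = ∑[ x ∈ xs ] e

-- Only positive bases are ever used; 0 to a negative power is a junk value.
infixr 8 _^ℤ_

_^ℤ_ : ℕ → ℤ → ℚ
n     ^ℤ (+ k)    = fromℕ (n ^ k)
zero  ^ℤ -[1+ k ] = 0ℚ
suc n ^ℤ -[1+ k ] = (+ 1 / (suc n ^ suc k)) {{m^n≢0 (suc n) (suc k)}}

1/_! : ℕ → ℚ
1/ d ! = (+ 1 / (d !)) {{d !≢0}}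

IsPartition : ℕ → List ℕ → Set
IsPartition d xs = All (0 <_) xs × Linked _≥_ xs × sum xs ≡ d

isPartition? : ∀ d xs → Dec (IsPartition d xs)
isPartition? d xs = all? (0 <?_) xs ×-dec linked? _≥?_ xs ×-dec (sum xs ≟ d)

record Partition (d : ℕ) : Set where
  constructor mkPartition
  field
    parts       : List ℕ
    isPartition : IsPartition d parts

open Partition public

-- Each composition of d + 1 with d ≥ 1 arises exactly once from a composition
-- of d, by either prepending a part 1 or incrementing the first part.
compositions : ℕ → List (List ℕ)
compositions zero          = [ [] ]
compositions (suc zero)    = [ [ 1 ] ]
compositions (suc (suc d)) =
  concatMap (λ c → (1 ∷ c) ∷ incrementHead c ∷ []) (compositions (suc d))
  where
  incrementHead : List ℕ → List ℕ
  incrementHead []       = []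
  incrementHead (x ∷ xs) = suc x ∷ xs

𝐏 : ∀ d → List (Partition d)
𝐏 d = mapMaybe
  (λ xs → Maybe.map (mkPartition xs) (dec⇒maybe (isPartition? d xs)))
  (compositions d)

S : ∀ {d} → ℤ → Partition d → ℚ
S p μ = ∑[ m ∈ parts μ ] (m ^ℤ p)

-- cell i j is in row i (counted from the top, longest row first) and
-- column j (counted from the left).
record Cell {d} (μ : Partition d) : Set where
  constructor cell
  field
    rowIndex    : Fin (length (parts μ))
    columnIndex : Fin (lookup (parts μ) rowIndex)

module _ {d} {μ : Partition d} where

  row : Cell μ → ℕ
  row (cell i _) = toℕ i

  column : Cell μ → ℕ
  column (cell _ j) = toℕ j

  _InHookOf_ : Cell μ → Cell μ → Set
  η InHookOf ξ = (row η ≡ row ξ × column ξ ≤ column η)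
               ⊎ (column η ≡ column ξ × row ξ < row η)

  _inHookOf?_ : ∀ η ξ → Dec (η InHookOf ξ)
  η inHookOf? ξ = ((row η ≟ row ξ) ×-dec (column ξ ≤? column η))
           ⊎-dec ((column η ≟ column ξ) ×-dec (row ξ <? row η))

cells : ∀ {d} (μ : Partition d) → List (Cell μ)
cells μ = concatMap (λ i → map (cell i) (allFin (lookup (parts μ) i)))
                    (allFin (length (parts μ)))

hookLength : ∀ {d} (μ : Partition d) → Cell μ → ℕ
hookLength μ ξ = length (filter (_inHookOf? ξ) (cells μ))

T : ∀ {d} → ℤ → Partition d → ℚ
T p μ = ∑[ ξ ∈ cells μ ] (hookLength μ ξ ^ℤ (p ℤ.- 1ℤ))

permutations : ∀ d → List (Permutation′ d)
permutations zero    = [ idₚ ]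
permutations (suc d) =
  concatMap (λ j → map (insert zero j) (permutations d)) (allFin (suc d))

-- The library composes permutations from left to right; this is the usual
-- composition (σ · τ)(i) = σ(τ(i)).
infixr 9 _·_

_·_ : ∀ {d} → Permutation′ d → Permutation′ d → Permutation′ d
σ · τ = τ ∘ₚ σ

module _ {d} (σ : Permutation′ d) where

  IsInversion : Fin d × Fin d → Set
  IsInversion (i , j) = i Fin.< j × (σ ⟨$⟩ʳ j) Fin.< (σ ⟨$⟩ʳ i)

  isInversion? : ∀ ij → Dec (IsInversion ij)
  isInversion? (i , j) = (i Fin.<? j) ×-dec ((σ ⟨$⟩ʳ j) Fin.<? (σ ⟨$⟩ʳ i))

  inversions : ℕ
  inversions = length (filter isInversion? (cartesianProduct (allFin d) (allFin d)))

  sign : ℚ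
  sign = fold 1ℚ -_ inversions

  -- Powers below d suffice, since a cycle of σ has at most d elements.
  InCycleOf : Fin d → Fin d → Set
  InCycleOf i j = ∃[ k ] iterate (σ ⟨$⟩ʳ_) i (toℕ {d} k) ≡ j

  inCycleOf? : ∀ i j → Dec (InCycleOf i j)
  inCycleOf? i j = Fin.any? λ k → iterate (σ ⟨$⟩ʳ_) i (toℕ k) Fin.≟ j

  cycleLength : Fin d → ℕ
  cycleLength i = length (filter (inCycleOf? i) (allFin d))

  IsLeastInCycle : Fin d → Set
  IsLeastInCycle i = ∀ j → InCycleOf i j → i Fin.≤ j

  isLeastInCycle? : ∀ i → Dec (IsLeastInCycle i)
  isLeastInCycle? i = Fin.all? λ j → inCycleOf? i j →-dec (i Fin.≤? j)

  -- One entry for each cycle (fixed points included), in decreasing order.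
  cycleType : List ℕ
  cycleType = sort (map cycleLength (filter isLeastInCycle? (allFin d)))

HasCycleType : ∀ {d} → Permutation′ d → Partition d → Set
HasCycleType σ μ = cycleType σ ≡ parts μ

hasCycleType? : ∀ {d} (σ : Permutation′ d) (μ : Partition d) → Dec (HasCycleType σ μ)
hasCycleType? σ μ = ≡-dec _≟_ (cycleType σ) (parts μ)

z : ∀ {d} → Partition d → ℕ
z {d} μ = length (filter (λ σ → hasCycleType? σ μ) (permutations d))

-- The group algebra: coeff x σ is the coefficient of σ in x. Permutations are
-- compared pointwise, so coefficient functions must respect _≈ₚ_.
record ℚ[S_] (d : ℕ) : Set where
  field
    coeff      : Permutation′ d → ℚ
    coeff-cong : ∀ σ τ → σ ≈ₚ τ → coeff σ ≡ coeff τ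

open ℚ[S_] public

infix 4 _≈ᴬ_

_≈ᴬ_ : ∀ {d} → ℚ[S d ] → ℚ[S d ] → Set
x ≈ᴬ y = ∀ σ → coeff x σ ≡ coeff y σ

0ᴬ : ∀ {d} → ℚ[S d ]
0ᴬ = record { coeff = λ _ → 0ℚ ; coeff-cong = λ _ _ _ → refl }

∑-cong : ∀ {X : Set} (xs : List X) {f g : X → ℚ} →
         (∀ x → f x ≡ g x) → ∑ xs f ≡ ∑ xs g
∑-cong []       f≗g = refl
∑-cong (x ∷ xs) f≗g = cong₂ _+_ (f≗g x) (∑-cong xs f≗g)

infixl 7 _*ᴬ_

_*ᴬ_ : ∀ {d} → ℚ[S d ] → ℚ[S d ] → ℚ[S d ]
_*ᴬ_ {d} x y = record
  { coeff      = λ σ → ∑[ τ ∈ permutations d ] (coeff x τ * coeff y (flip τ · σ))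
  ; coeff-cong = λ σ σ′ σ≈σ′ → ∑-cong (permutations d) λ τ →
      cong (coeff x τ *_) (coeff-cong y (flip τ · σ) (flip τ · σ′) λ i → cong (flip τ ⟨$⟩ʳ_) (σ≈σ′ i))
  }

-- The product of the basis element σ with x: σ · ∑ x(τ) τ = ∑ x(σ⁻¹ τ) τ.
infixr 7 _•_

_•_ : ∀ {d} → Permutation′ d → ℚ[S d ] → ℚ[S d ]
σ • x = record
  { coeff      = λ τ → coeff x (flip σ · τ)
  ; coeff-cong = λ τ τ′ τ≈τ′ → coeff-cong x (flip σ · τ) (flip σ · τ′) λ i → cong (flip σ ⟨$⟩ʳ_) (τ≈τ′ i)
  }

linearCombination : ∀ {d n} → (Fin n → ℚ) → (Fin n → ℚ[S d ]) → ℚ[S d ]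
linearCombination {n = n} a b = record
  { coeff      = λ σ → ∑[ k ∈ allFin n ] (a k * coeff (b k) σ)
  ; coeff-cong = λ σ τ σ≈τ → ∑-cong (allFin n) λ k →
      cong (a k *_) (coeff-cong (b k) σ τ σ≈τ)
  }

sign-cong : ∀ {d} (σ τ : Permutation′ d) → σ ≈ₚ τ → sign σ ≡ sign τ
sign-cong {d} σ τ σ≈τ = cong (fold 1ℚ -_ ∘ length)
  (filter-≐ (isInversion? σ) (isInversion? τ)
    ( (λ { {i , j} (i<j , p) → i<j , subst₂ Fin._<_ (σ≈τ j) (σ≈τ i) p })
    , (λ { {i , j} (i<j , p) → i<j , subst₂ Fin._<_ (sym (σ≈τ j)) (sym (σ≈τ i)) p }))
    (cartesianProduct (allFin d) (allFin d)))

Tableau : ∀ {d} → Partition d → Set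
Tableau {d} μ = Fin d ↔ Cell μ

module _ {d} {μ : Partition d} (t : Tableau μ) where

  -- For f = row or f = column: the permutations of the labels that leave each
  -- row, respectively each column, of t invariant.
  Preserves : (Cell μ → ℕ) → Permutation′ d → Set
  Preserves f σ = ∀ i → f (Inverse.to t (σ ⟨$⟩ʳ i)) ≡ f (Inverse.to t i)

  preserves? : ∀ f σ → Dec (Preserves f σ)
  preserves? f σ = Fin.all? λ i → f (Inverse.to t (σ ⟨$⟩ʳ i)) ≟ f (Inverse.to t i)

  preserves-cong : ∀ f σ τ → σ ≈ₚ τ → does (preserves? f σ) ≡ does (preserves? f τ)
  preserves-cong f σ τ σ≈τ = does-⇔
    (mk⇔ (λ p i → trans (cong (f ∘ Inverse.to t) (sym (σ≈τ i))) (p i))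
         (λ p i → trans (cong (f ∘ Inverse.to t) (σ≈τ i)) (p i)))
    (preserves? f σ) (preserves? f τ)

  rowSymmetrizer : ℚ[S d ]
  rowSymmetrizer = record
    { coeff      = λ σ → if does (preserves? row σ) then 1ℚ else 0ℚ
    ; coeff-cong = λ σ τ σ≈τ → cong (if_then 1ℚ else 0ℚ) (preserves-cong row σ τ σ≈τ)
    }

  columnAntisymmetrizer : ℚ[S d ]
  columnAntisymmetrizer = record
    { coeff      = λ σ → if does (preserves? column σ) then sign σ else 0ℚ
    ; coeff-cong = λ σ τ σ≈τ → cong₂ (if_then_else 0ℚ)
        (preserves-cong column σ τ σ≈τ) (sign-cong σ τ σ≈τ)
    }

  youngSymmetrizer : ℚ[S d ]
  youngSymmetrizer = rowSymmetrizer *ᴬ columnAntisymmetrizer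

  InSpechtModule : ℚ[S d ] → Set
  InSpechtModule x = ∃[ a ] x ≈ᴬ a *ᴬ youngSymmetrizer

-- The irreducible S_d-module associated with μ is the left ideal ℚ[S_d] c_t
-- generated by the Young symmetrizer of a tableau t of shape μ (up to
-- isomorphism independent of t, and absolutely irreducible, so ℚ may replace ℂ).
-- χ is its character if χ(ν) is the trace, in a basis of this ideal, of the
-- left multiplication by any permutation of cycle type ν.
record IsIrreducibleCharacter {d} (μ : Partition d) (χ : Partition d → ℚ) : Set where
  field
    tableau     : Tableau μ
    dimension   : ℕ
    basis       : Fin dimension → ℚ[S d ]
    contained   : ∀ k → InSpechtModule tableau (basis k)
    independent : ∀ a → linearCombination a basis ≈ᴬ 0ᴬ → ∀ k → a k ≡ 0ℚ
    spanning    : ∀ x → InSpechtModule tableau x →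
                  ∃[ a ] x ≈ᴬ linearCombination a basis
    matrix      : Permutation′ d → Fin dimension → Fin dimension → ℚ
    action      : ∀ σ k → σ • basis k ≈ᴬ linearCombination (λ l → matrix σ l k) basis
    trace       : ∀ σ ν → HasCycleType σ ν →
                  χ ν ≡ ∑[ k ∈ allFin dimension ] matrix σ k k

{-# OPTIONS --safe #-}
-- Let F m = m ^ (p - 1). A cycle of length m contributes m ^ p = m F m to S_p, so
-- the left side is the mean over the permutations σ of χ(σ)² Σ_y F(ℓ_σ(y)), where
-- ℓ_σ(y) is the length of the cycle of y.
--
-- Put x_i = λ_i + δ_i for the n rows i, with δ = (n-1, …, 1, 0), and let s(σ) be
-- the coefficient with exponents (x_i) in Δ ∏ p_m, where Δ is the Vandermonde
-- product and m ranges over the cycle lengths of σ; in terms of colourings fixed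
-- by σ, this is an alternating sum of permutation characters. Young symmetrizers
-- and von Neumann's lemma give ⟨χ , χ⟩ = 1 and ⟨χ , s⟩ = 1: only the colouring of
-- the points by their rows, up to column permutations, contributes to the latter.
-- As also ⟨s , s⟩ = 1, the norm of χ - s vanishes and χ = s.
--
-- Removing the cycle of a marked point, of length m, lowers one exponent in each
-- of the two factors s by m. So the mean is a sum of F m times inner products of
-- alternants with lowered exponents, and these are the coefficients of the Cauchy
-- determinant. Its Euler identity gives, by induction, the norm of s; evaluated
-- directly, the terms that survive are the pairs (i , m) for which x_i - m is
-- nonnegative and not among the x_j, and such m are the hook lengths of row i.
module Submission where

open import Defs
open import Algebra.Bundles using (CommutativeRing)
open import Algebra.Structures using (IsCommutativeRing)
import Algebra.Properties.Ring
open import Data.Bool.Base using (true; false; if_then_else_)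
open import Data.Fin.Base using (Fin; zero; suc; toℕ; punchIn; punchOut; opposite)
import Data.Fin.Base as Fin
import Data.Fin.Properties as Fin
open import Data.Fin.Permutation
  using (Permutation′; _⟨$⟩ʳ_; _⟨$⟩ˡ_; flip; insert; remove; lift₀; transpose; reverse; inverseˡ; inverseʳ; permutation;
         insert-punchIn; punchIn-permute)
  renaming (_≈_ to _≈ₚ_; id to idₚ)
open import Data.Integer.Base using (ℤ; -[1+_]; 0ℤ; 1ℤ)
import Data.Integer.Base as ℤ
import Data.Integer.Properties as ℤ
open import Data.Integer.Tactic.RingSolver using () renaming (solve-∀ to ℤ-solve)
open import Data.List.Base
  using (List; []; _∷_; allFin; cartesianProduct; concatMap; filter; length; lookup; map; mapMaybe; _++_)
import Data.List.Properties as List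
open import Data.List.Relation.Binary.Permutation.Propositional
  using (_↭_; prep; ↭-sym) renaming (refl to ↭-refl; swap to ↭-swap; trans to ↭-trans)
open import Data.List.Relation.Binary.Permutation.Propositional.Properties using (All-resp-↭)
open import Data.List.Relation.Unary.All using (All; []; _∷_; universal)
import Data.List.Relation.Unary.All.Properties as All
open import Data.List.Relation.Unary.Linked using (Linked; []; [-]; _∷_)
import Data.List.Sort.Base
import Data.List.Sort.InsertionSort as InsertionSort
import Data.Maybe.Base as Maybe
open import Data.Nat.Base using (ℕ; zero; suc; _!)
import Data.Nat.Base as ℕ
import Data.Nat.DivMod as ℕ
open import Data.Nat.GeneralisedArithmetic using (fold; iterate)
open import Data.Nat.ListAction using (sum)
import Data.Nat.Properties as ℕ
open import Data.Nat.Solver using (module +-*-Solver)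
open import Data.Product.Base using (∃-syntax; _×_; _,_; proj₁; proj₂; Σ-syntax)
open import Data.Rational.Base using (ℚ; 0ℚ; 1ℚ; _/_)
import Data.Rational.Base as ℚ
import Data.Rational.Properties as ℚ
import Data.Rational.Unnormalised.Base as ℚᵘ
import Data.Rational.Unnormalised.Properties as ℚᵘ
open import Data.Sum.Base using (_⊎_; inj₁; inj₂)
open import Function.Base using (_∘_; id)
open import Function.Bundles using (Inverse; mk⇔)
open import Level using (0ℓ)
open import Relation.Binary.Definitions using (tri<; tri≈; tri>)
import Relation.Binary.Properties.DecTotalOrder as DecTotalOrder
open import Relation.Binary.PropositionalEquality
  using (_≡_; _≢_; _≗_; refl; sym; trans; cong; cong₂; subst; subst₂; module ≡-Reasoning)
open import Relation.Nullary.Decidable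
  using (Dec; yes; no; does; _×-dec_; ¬?; dec⇒maybe; does-⇔; dec-true; dec-false; toSum)
open import Relation.Nullary.Negation using (¬_; contradiction)
open import Tactic.RingSolver using (solve-∀)
open import Tactic.RingSolver.Core.AlmostCommutativeRing using (fromCommutativeRing; AlmostCommutativeRing)

open ≡-Reasoning

-- The Cauchy determinant is `Δ(x) Δ(y) ∏ (1 - x_i y_j)^-1`, and the degree operator in x multiplies
-- the last product by `∑ p_m(x) p_m(y)`. So summing coefficients over all ways to lower one
-- exponent of each vector by the same m multiplies a coefficient by its degree less the degree
-- `total δ` of Δ. Removing a marked cycle yields the same recursion; hence one computation, with
-- weight 1 and with weight F, gives both the norm of s and the weighted mean. The obstacle is that
-- lowering leaves the vectors λ + δ: entries may become negative or repeated. The recursion is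
-- therefore stated for arbitrary integer vectors, and the coefficient `G` carries a test for
-- nonnegativity, which in the final evaluation limits m to at most x_i. The character is given only
-- as a trace in an arbitrary basis of the ideal. As right multiplication by the Young symmetrizer
-- is a scalar κ on the ideal, κ χ(σ) becomes a sum of coefficients of the symmetrizer over the
-- conjugates of σ⁻¹, in which no basis occurs. All values are rational, so a vanishing sum of
-- squares identifies two functions.

private variable
  d n : ℕ
  X Y P Q : Set

-- Arithmetic of ℚ

infixl 6 _+_
infixl 7 _*_
infix 8 -_

-- Opaque copies of the operations of ℚ and of ∑: these reduce on their
-- arguments, so that Agda could not infer the arguments from an equation.
opaque

  _+_ _*_ : ℚ → ℚ → ℚ
  _+_ = ℚ._+_
  _*_ = ℚ._*_

  -_ : ℚ → ℚ
  -_ = ℚ.-_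

opaque
  unfolding _+_

  ℚ-isCommutativeRing : IsCommutativeRing _≡_ _+_ _*_ -_ 0ℚ 1ℚ
  ℚ-isCommutativeRing = ℚ.+-*-isCommutativeRing

ℚ-commutativeRing : CommutativeRing 0ℓ 0ℓ
ℚ-commutativeRing = record { isCommutativeRing = ℚ-isCommutativeRing }

open CommutativeRing ℚ-commutativeRing public
  using (+-comm; +-assoc; +-identityˡ; +-identityʳ; *-comm; *-assoc; *-identityˡ; *-identityʳ; zeroˡ; zeroʳ; distribˡ; distribʳ; -‿inverseʳ)
open Algebra.Properties.Ring (CommutativeRing.ring ℚ-commutativeRing) public
  using (-‿distribˡ-*)

-- The ring solver applies only where _+_ is unfolded, since it computes with
-- coefficients in ℚ.
ℚ-ring : AlmostCommutativeRing 0ℓ 0ℓ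
ℚ-ring = fromCommutativeRing ℚ-commutativeRing (λ x → dec⇒maybe (0ℚ ℚ.≟ x))

fromℤ : ℤ → ℚ
fromℤ i = i / 1

opaque
  unfolding _+_

  -- `i / 1` is normalised by a gcd, so the identity is verified on unnormalised fractions with
  -- denominator 1 and carried back by the injectivity of `toℚᵘ`.
  fromℤ-+ : ∀ i j → fromℤ (i ℤ.+ j) ≡ fromℤ i + fromℤ j
  fromℤ-+ i j = ℚ.toℚᵘ-injective (ℚᵘ.≃-trans (ℚ.toℚᵘ-cong (ℚ.fromℚᵘ-cong {ℚᵘ.mkℚᵘ (i ℤ.+ j) 0} {ℚᵘ.mkℚᵘ i 0 ℚᵘ.+ ℚᵘ.mkℚᵘ j 0}
      (ℚᵘ.*≡* (cong₂ (λ a b → (a ℤ.+ b) ℤ.* 1ℤ) (sym (ℤ.*-identityʳ i)) (sym (ℤ.*-identityʳ j))))))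
    (ℚᵘ.≃-trans (ℚ.toℚᵘ-fromℚᵘ (ℚᵘ.mkℚᵘ i 0 ℚᵘ.+ ℚᵘ.mkℚᵘ j 0)) (ℚᵘ.≃-sym (ℚᵘ.≃-trans (ℚ.toℚᵘ-homo-+ (fromℤ i) (fromℤ j))
      (ℚᵘ.+-cong (ℚ.toℚᵘ-fromℚᵘ (ℚᵘ.mkℚᵘ i 0)) (ℚ.toℚᵘ-fromℚᵘ (ℚᵘ.mkℚᵘ j 0)))))))

  fromℤ-* : ∀ i j → fromℤ (i ℤ.* j) ≡ fromℤ i * fromℤ j
  fromℤ-* i j = ℚ.toℚᵘ-injective (ℚᵘ.≃-trans (ℚ.toℚᵘ-cong (ℚ.fromℚᵘ-cong {ℚᵘ.mkℚᵘ (i ℤ.* j) 0} {ℚᵘ.mkℚᵘ i 0 ℚᵘ.* ℚᵘ.mkℚᵘ j 0}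
      ℚᵘ.≃-refl))
    (ℚᵘ.≃-trans (ℚ.toℚᵘ-fromℚᵘ (ℚᵘ.mkℚᵘ i 0 ℚᵘ.* ℚᵘ.mkℚᵘ j 0)) (ℚᵘ.≃-sym (ℚᵘ.≃-trans (ℚ.toℚᵘ-homo-* (fromℤ i) (fromℤ j))
      (ℚᵘ.*-cong (ℚ.toℚᵘ-fromℚᵘ (ℚᵘ.mkℚᵘ i 0)) (ℚ.toℚᵘ-fromℚᵘ (ℚᵘ.mkℚᵘ j 0)))))))

  *-cancelˡ-≢0 : ∀ p {q r} → p ≢ 0ℚ → p * q ≡ p * r → q ≡ r
  *-cancelˡ-≢0 p {q} {r} p≢0 eq = begin
    q                 ≡⟨ *-identityˡ q ⟨
    1ℚ * q            ≡⟨ cong (_* q) (ℚ.*-inverseˡ p) ⟨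
    ℚ.1/ p * p * q    ≡⟨ *-assoc (ℚ.1/ p) p q ⟩
    ℚ.1/ p * (p * q)  ≡⟨ cong (ℚ.1/ p *_) eq ⟩
    ℚ.1/ p * (p * r)  ≡⟨ *-assoc (ℚ.1/ p) p r ⟨
    ℚ.1/ p * p * r    ≡⟨ cong (_* r) (ℚ.*-inverseˡ p) ⟩
    1ℚ * r            ≡⟨ *-identityˡ r ⟩
    r                 ∎
    where
    instance
      p-nonZero : ℚ.NonZero p
      p-nonZero = ℚ.≢-nonZero p≢0

  +-mono-≤ : ∀ {p q r s} → p ℚ.≤ q → r ℚ.≤ s → p + r ℚ.≤ q + s
  +-mono-≤ = ℚ.+-mono-≤

  exchange : ∀ p q r → p * (q * r) ≡ q * (p * r)
  exchange = solve-∀ ℚ-ring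

  neg-distrib-+ : ∀ p q → - (p + q) ≡ - p + - q
  neg-distrib-+ = solve-∀ ℚ-ring

  p≡-p⇒p≡0 : ∀ {p} → p ≡ - p → p ≡ 0ℚ
  p≡-p⇒p≡0 {p} eq = *-cancelˡ-≢0 (1ℚ + 1ℚ) (λ ()) (trans (lemma p) (trans (cong (p +_) eq)
    (trans (-‿inverseʳ p) (sym (zeroʳ (1ℚ + 1ℚ))))))
    where
    lemma : ∀ p → (1ℚ + 1ℚ) * p ≡ p + p
    lemma = solve-∀ ℚ-ring

  2*-cancel : ∀ {p q} → p + p ≡ q + q → p ≡ q
  2*-cancel {p} {q} eq = *-cancelˡ-≢0 (1ℚ + 1ℚ) (λ ()) (trans (lemma p) (trans eq (sym (lemma q))))
    where
    lemma : ∀ p → (1ℚ + 1ℚ) * p ≡ p + p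
    lemma = solve-∀ ℚ-ring

  p*p≥0 : ∀ p → 0ℚ ℚ.≤ p * p
  p*p≥0 p with ℚ.≤-total 0ℚ p
  ... | inj₁ 0≤p = subst (ℚ._≤ p * p) (zeroʳ p) (ℚ.*-monoˡ-≤-nonNeg p {{ℚ.nonNegative 0≤p}} 0≤p)
  ... | inj₂ p≤0 = subst (ℚ._≤ p * p) (zeroʳ p) (ℚ.*-monoˡ-≤-nonPos p {{ℚ.nonPositive p≤0}} p≤0)

fromℤ-injective : ∀ {i j} → fromℤ i ≡ fromℤ j → i ≡ j
fromℤ-injective {i} {j} eq = ℤ.*-cancelʳ-≡ i j 1ℤ (ℚᵘ.drop-*≡* (ℚᵘ.≃-trans (ℚᵘ.≃-sym (ℚ.toℚᵘ-fromℚᵘ (ℚᵘ.mkℚᵘ i 0)))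
  (ℚᵘ.≃-trans (ℚ.toℚᵘ-cong eq) (ℚ.toℚᵘ-fromℚᵘ (ℚᵘ.mkℚᵘ j 0)))))

fromℤ-mono-≤ : ∀ {i j} → i ℤ.≤ j → fromℤ i ℚ.≤ fromℤ j
fromℤ-mono-≤ {i} {j} i≤j = ℚ.toℚᵘ-cancel-≤ (ℚᵘ.≤-respˡ-≃ (ℚᵘ.≃-sym (ℚ.toℚᵘ-fromℚᵘ (ℚᵘ.mkℚᵘ i 0)))
  (ℚᵘ.≤-respʳ-≃ (ℚᵘ.≃-sym (ℚ.toℚᵘ-fromℚᵘ (ℚᵘ.mkℚᵘ j 0))) (ℚᵘ.*≤* (ℤ.*-monoʳ-≤-nonNeg 1ℤ i≤j))))

fromℕ-+ : ∀ m n → fromℕ (m ℕ.+ n) ≡ fromℕ m + fromℕ n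
fromℕ-+ m n = fromℤ-+ (ℤ.+ m) (ℤ.+ n)

fromℕ-suc : ∀ n → fromℕ (suc n) ≡ 1ℚ + fromℕ n
fromℕ-suc n = fromℕ-+ 1 n

fromℕ-* : ∀ m n → fromℕ (m ℕ.* n) ≡ fromℕ m * fromℕ n
fromℕ-* m n = trans (cong fromℤ (ℤ.pos-* m n)) (fromℤ-* (ℤ.+ m) (ℤ.+ n))

fromℕ-injective : ∀ {m n} → fromℕ m ≡ fromℕ n → m ≡ n
fromℕ-injective = ℤ.+-injective ∘ fromℤ-injective

fromℕ-mono-≤ : ∀ {m n} → m ℕ.≤ n → fromℕ m ℚ.≤ fromℕ n
fromℕ-mono-≤ m≤n = fromℤ-mono-≤ (ℤ.+≤+ m≤n)

p*p≡0⇒p≡0 : ∀ p → p * p ≡ 0ℚ → p ≡ 0ℚ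
p*p≡0⇒p≡0 p eq with p ℚ.≟ 0ℚ
... | yes p≡0 = p≡0
... | no  p≢0 = *-cancelˡ-≢0 p p≢0 (trans eq (sym (zeroʳ p)))

-- Finite sums

opaque
  unfolding _+_

  ⨁ : List X → (X → ℚ) → ℚ
  ⨁ = ∑

  ⨁≡∑ : ∀ (xs : List X) f → ⨁ xs f ≡ ∑ xs f
  ⨁≡∑ xs f = refl

  ⨁-[] : ∀ {f : X → ℚ} → ⨁ [] f ≡ 0ℚ
  ⨁-[] = refl

  ⨁-∷ : ∀ {x} {xs : List X} {f} → ⨁ (x ∷ xs) f ≡ f x + ⨁ xs f
  ⨁-∷ = refl

  ⨁-cong : ∀ {xs : List X} {f g : X → ℚ} → (∀ x → f x ≡ g x) → ⨁ xs f ≡ ⨁ xs g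
  ⨁-cong {xs = xs} = ∑-cong xs

  ⨁-zero : ∀ {xs : List X} {f : X → ℚ} → (∀ x → f x ≡ 0ℚ) → ⨁ xs f ≡ 0ℚ
  ⨁-zero {xs = []}     f≡0 = refl
  ⨁-zero {xs = x ∷ xs} {f} f≡0 = cong₂ _+_ (f≡0 x) (⨁-zero {xs = xs} {f} f≡0)

  ⨁-+ : ∀ {xs : List X} {f g} → ⨁ xs (λ x → f x + g x) ≡ ⨁ xs f + ⨁ xs g
  ⨁-+ {xs = []}             = refl
  ⨁-+ {xs = x ∷ xs} {f} {g} = trans (cong (f x + g x +_) (⨁-+ {xs = xs} {f} {g})) (lemma (f x) (g x) (⨁ xs f) (⨁ xs g))
    where
    lemma : ∀ a b c d → (a + b) + (c + d) ≡ (a + c) + (b + d)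
    lemma = solve-∀ ℚ-ring

  ⨁-*ˡ : ∀ {xs : List X} {c f} → ⨁ xs (λ x → c * f x) ≡ c * ⨁ xs f
  ⨁-*ˡ {xs = []}     {c}     = sym (zeroʳ c)
  ⨁-*ˡ {xs = x ∷ xs} {c} {f} = trans (cong (c * f x +_) (⨁-*ˡ {xs = xs} {c} {f})) (sym (distribˡ c (f x) (⨁ xs f)))

  ⨁-neg : ∀ {xs : List X} {f} → ⨁ xs (λ x → - f x) ≡ - ⨁ xs f
  ⨁-neg {xs = []}         = refl
  ⨁-neg {xs = x ∷ xs} {f} = trans (cong (- f x +_) (⨁-neg {xs = xs} {f})) (sym (neg-distrib-+ (f x) (⨁ xs f)))

  ⨁-swap : ∀ {xs : List X} {ys : List Y} {f : X → Y → ℚ} →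
           ⨁ xs (λ x → ⨁ ys (f x)) ≡ ⨁ ys (λ y → ⨁ xs (λ x → f x y))
  ⨁-swap {xs = []}     {ys}     = sym (⨁-zero {xs = ys} {λ _ → 0ℚ} (λ _ → refl))
  ⨁-swap {xs = x ∷ xs} {ys} {f} = trans (cong (⨁ ys (f x) +_) (⨁-swap {xs = xs} {ys} {f}))
                                        (sym (⨁-+ {xs = ys} {f x} {λ y → ⨁ xs (λ x → f x y)}))

  ⨁-++ : ∀ (xs ys : List X) f → ⨁ (xs ++ ys) f ≡ ⨁ xs f + ⨁ ys f
  ⨁-++ []       ys f = sym (+-identityˡ (⨁ ys f))
  ⨁-++ (x ∷ xs) ys f = trans (cong (f x +_) (⨁-++ xs ys f)) (sym (+-assoc (f x) (⨁ xs f) (⨁ ys f)))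

  ⨁-map : ∀ (h : Y → X) ys f → ⨁ (map h ys) f ≡ ⨁ ys (f ∘ h)
  ⨁-map h []       f = refl
  ⨁-map h (y ∷ ys) f = cong (f (h y) +_) (⨁-map h ys f)

  ⨁-concatMap : ∀ {h : Y → List X} {ys f} → ⨁ (concatMap h ys) f ≡ ⨁ ys (λ y → ⨁ (h y) f)
  ⨁-concatMap {ys = []}             = refl
  ⨁-concatMap {h = h} {y ∷ ys} {f} = trans (⨁-++ (h y) (concatMap h ys) f) (cong (⨁ (h y) f +_) (⨁-concatMap {h = h} {ys} {f}))

  ⨁-mono-≤ : ∀ {xs : List X} {f g : X → ℚ} → (∀ x → f x ℚ.≤ g x) → ⨁ xs f ℚ.≤ ⨁ xs g
  ⨁-mono-≤ {xs = []}     f≤g = ℚ.≤-refl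
  ⨁-mono-≤ {xs = x ∷ xs} {f} {g} f≤g = +-mono-≤ (f≤g x) (⨁-mono-≤ {xs = xs} {f} {g} f≤g)

  ⨁-const : ∀ (xs : List X) c → ⨁ xs (λ _ → c) ≡ fromℕ (length xs) * c
  ⨁-const []       c = sym (zeroˡ c)
  ⨁-const (x ∷ xs) c = trans (cong (c +_) (⨁-const xs c))
    (sym (trans (cong (_* c) (fromℕ-suc (length xs)))
         (trans (distribʳ c 1ℚ (fromℕ (length xs))) (cong (_+ fromℕ (length xs) * c) (*-identityˡ c)))))

  ⨁-allFin-suc : ∀ {n f} → ⨁ (allFin (suc n)) f ≡ f zero + ⨁ (allFin n) (f ∘ suc)
  ⨁-allFin-suc {n} {f} = cong (f zero +_) (trans (cong (λ xs → ⨁ xs f) (sym (List.map-tabulate {n = n} id suc))) (⨁-map suc (allFin n) f))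

  -- Cardinalities are handled as sums of rational indicators: counting becomes exchange of sums and
  -- ring identities, and relations between natural numbers are recovered through `fromℕ`.
  𝟙 : Dec P → ℚ
  𝟙 P? = if does P? then 1ℚ else 0ℚ

  𝟙-yes : ∀ (P? : Dec P) → P → 𝟙 P? ≡ 1ℚ
  𝟙-yes P? p = cong (if_then 1ℚ else 0ℚ) (dec-true P? p)

  𝟙-no : ∀ (P? : Dec P) → ¬ P → 𝟙 P? ≡ 0ℚ
  𝟙-no P? ¬p = cong (if_then 1ℚ else 0ℚ) (dec-false P? ¬p)

  0≤𝟙 : ∀ (P? : Dec P) → 0ℚ ℚ.≤ 𝟙 P?
  0≤𝟙 (yes _) = fromℕ-mono-≤ {0} {1} ℕ.z≤n
  0≤𝟙 (no  _) = ℚ.≤-refl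

  𝟙-⇔ : ∀ (P? : Dec P) (Q? : Dec Q) → (P → Q) → (Q → P) → 𝟙 P? ≡ 𝟙 Q?
  𝟙-⇔ P? Q? P→Q Q→P = cong (if_then 1ℚ else 0ℚ) (does-⇔ (mk⇔ P→Q Q→P) P? Q?)

  𝟙-× : ∀ (P? : Dec P) (Q? : Dec Q) → 𝟙 (P? ×-dec Q?) ≡ 𝟙 P? * 𝟙 Q?
  𝟙-× (yes _) Q? = sym (*-identityˡ (𝟙 Q?))
  𝟙-× (no  _) Q? = sym (zeroˡ (𝟙 Q?))

  𝟙-cong : ∀ (P? : Dec P) {x y} → (P → x ≡ y) → 𝟙 P? * x ≡ 𝟙 P? * y
  𝟙-cong (yes p) x≡y = cong (1ℚ *_) (x≡y p)
  𝟙-cong (no  _) {x} {y} _ = trans (zeroˡ x) (sym (zeroˡ y))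

  𝟙-*-≤ : ∀ (P? : Dec P) {x} → 0ℚ ℚ.≤ x → 𝟙 P? * x ℚ.≤ x
  𝟙-*-≤ (yes _) {x} 0≤x = ℚ.≤-reflexive (*-identityˡ x)
  𝟙-*-≤ (no  _) {x} 0≤x = subst (ℚ._≤ x) (sym (zeroˡ x)) 0≤x

  ⨁-𝟙 : ∀ {X : Set} {P : X → Set} (P? : ∀ x → Dec (P x)) xs →
        fromℕ (length (filter P? xs)) ≡ ⨁ xs (λ x → 𝟙 (P? x))
  ⨁-𝟙 P? [] = refl
  ⨁-𝟙 P? (x ∷ xs) with does (P? x)
  ... | true  = trans (fromℕ-suc (length (filter P? xs))) (cong (1ℚ +_) (⨁-𝟙 P? xs))
  ... | false = trans (⨁-𝟙 P? xs) (sym (+-identityˡ _))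

  ⨁-filter : ∀ {X : Set} {P : X → Set} (P? : ∀ x → Dec (P x)) xs f →
             ⨁ (filter P? xs) f ≡ ⨁ xs (λ x → 𝟙 (P? x) * f x)
  ⨁-filter P? [] f = refl
  ⨁-filter P? (x ∷ xs) f with does (P? x)
  ... | true  = cong₂ _+_ (sym (*-identityˡ (f x))) (⨁-filter P? xs f)
  ... | false = trans (⨁-filter P? xs f) (sym (trans (cong (_+ _) (zeroˡ (f x))) (+-identityˡ _)))

⨁-*ʳ : ∀ {xs : List X} {f c} → ⨁ xs (λ x → f x * c) ≡ ⨁ xs f * c
⨁-*ʳ {f = f} {c} = trans (⨁-cong (λ x → *-comm (f x) c)) (trans ⨁-*ˡ (*-comm c _))

⨁-nonneg : ∀ {xs : List X} {f : X → ℚ} → (∀ x → 0ℚ ℚ.≤ f x) → 0ℚ ℚ.≤ ⨁ xs f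
⨁-nonneg {xs = xs} {f} 0≤f = subst (ℚ._≤ ⨁ xs f) (⨁-zero (λ _ → refl)) (⨁-mono-≤ 0≤f)

⨁-*-⨁ : ∀ {xs : List X} {ys : List Y} {f g} →
        ⨁ xs f * ⨁ ys g ≡ ⨁ xs (λ x → ⨁ ys (λ y → f x * g y))
⨁-*-⨁ = trans (sym ⨁-*ʳ) (⨁-cong (λ x → sym ⨁-*ˡ))

⨁-allFin-const : ∀ {n c} → ⨁ (allFin n) (λ _ → c) ≡ fromℕ n * c
⨁-allFin-const {n} {c} = trans (⨁-const (allFin n) c) (cong (λ k → fromℕ k * c) (List.length-tabulate {n = n} id))

-- Permutations and colourings are functions, compared only pointwise, so a list of them is complete
-- only up to an equivalence. The condition `once` expresses completeness and absence of repetitions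
-- in one equation that can be used under sums.
record Enumeration (X : Set) : Set₁ where
  field
    elements : List X
    _~_      : X → X → Set
    _~?_     : ∀ x y → Dec (x ~ y)
    ~-sym    : ∀ {x y} → x ~ y → y ~ x
    once     : ∀ y → ⨁ elements (λ x → 𝟙 (x ~? y)) ≡ 1ℚ

  Respects : (X → ℚ) → Set
  Respects f = ∀ {x y} → x ~ y → f x ≡ f y

  ⨁-pick : ∀ {f} → Respects f → ∀ y → ⨁ elements (λ x → 𝟙 (x ~? y) * f x) ≡ f y
  ⨁-pick {f} f-resp y = begin
    ⨁ elements (λ x → 𝟙 (x ~? y) * f x)  ≡⟨ ⨁-cong (λ x → 𝟙-cong (x ~? y) f-resp) ⟩
    ⨁ elements (λ x → 𝟙 (x ~? y) * f y)  ≡⟨ ⨁-*ʳ ⟩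
    ⨁ elements (λ x → 𝟙 (x ~? y)) * f y  ≡⟨ cong (_* f y) (once y) ⟩
    1ℚ * f y                             ≡⟨ *-identityˡ (f y) ⟩
    f y                                  ∎

  term≤⨁ : ∀ {f} → Respects f → (∀ x → 0ℚ ℚ.≤ f x) → ∀ y → f y ℚ.≤ ⨁ elements f
  term≤⨁ {f} f-resp 0≤f y = subst (ℚ._≤ ⨁ elements f) (⨁-pick f-resp y) (⨁-mono-≤ (λ x → 𝟙-*-≤ (x ~? y) (0≤f x)))

  ⨁≡0⇒≡0 : ∀ {f} → Respects f → (∀ x → 0ℚ ℚ.≤ f x) → ⨁ elements f ≡ 0ℚ → ∀ y → f y ≡ 0ℚ
  ⨁≡0⇒≡0 {f} f-resp 0≤f ⨁≡0 y = ℚ.≤-antisym (subst (f y ℚ.≤_) ⨁≡0 (term≤⨁ f-resp 0≤f y)) (0≤f y)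

-- Double counting of the pairs with `h x` equivalent to y. The two hypotheses say that g is inverse
-- to h in just the form that turns this relation into `x ~ g y`, which holds for one entry x of the
-- list.
⨁-reindex : ∀ {X Y : Set} (E : Enumeration X) (E′ : Enumeration Y) →
            let module E = Enumeration E ; module E′ = Enumeration E′ in
            (h : X → Y) (g : Y → X) →
            (∀ x y → h x E′.~ y → x E.~ g y) → (∀ x y → x E.~ g y → h x E′.~ y) →
            ∀ {f} → E′.Respects f → ⨁ E.elements (f ∘ h) ≡ ⨁ E′.elements f
⨁-reindex E E′ h g to from {f} f-resp = begin
  ⨁ xs (f ∘ h)                                          ≡⟨ ⨁-cong (λ x → E′.⨁-pick f-resp (h x)) ⟨
  ⨁ xs (λ x → ⨁ ys (λ y → 𝟙 (y E′.~? h x) * f y))       ≡⟨ ⨁-swap ⟩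
  ⨁ ys (λ y → ⨁ xs (λ x → 𝟙 (y E′.~? h x) * f y))       ≡⟨ ⨁-cong (λ y → ⨁-cong (λ x → cong (_* f y)
                                                             (𝟙-⇔ (y E′.~? h x) (x E.~? g y) (to x y ∘ E′.~-sym) (E′.~-sym ∘ from x y)))) ⟩
  ⨁ ys (λ y → ⨁ xs (λ x → 𝟙 (x E.~? g y) * f y))        ≡⟨ ⨁-cong (λ y → trans ⨁-*ʳ
                                                             (trans (cong (_* f y) (E.once (g y))) (*-identityˡ (f y)))) ⟩
  ⨁ ys f                                                ∎
  where
  module E = Enumeration E
  module E′ = Enumeration E′
  xs = E.elements
  ys = E′.elements

Fin-enumeration : ∀ n → Enumeration (Fin n)
Fin-enumeration n = record
  { elements = allFin n ; _~_ = _≡_ ; _~?_ = Fin._≟_ ; ~-sym = sym ; once = once }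
  where
  once : ∀ {n} (j : Fin n) → ⨁ (allFin n) (λ i → 𝟙 (i Fin.≟ j)) ≡ 1ℚ
  once {suc n} zero    = trans ⨁-allFin-suc (trans
    (cong₂ _+_ (𝟙-yes (zero {n} Fin.≟ zero) refl) (⨁-zero (λ i → 𝟙-no (suc i Fin.≟ zero) (λ ())))) (+-identityʳ 1ℚ))
  once {suc n} (suc j) = trans ⨁-allFin-suc (trans
    (cong₂ _+_ (𝟙-no (zero Fin.≟ suc j) (λ ())) (⨁-cong (λ i → 𝟙-⇔ (suc i Fin.≟ suc j) (i Fin.≟ j) Fin.suc-injective (cong suc))))
    (trans (+-identityˡ _) (once j)))

module FinE {n} = Enumeration (Fin-enumeration n)

⨁-pick-Fin : ∀ {n} (f : Fin n → ℚ) j → ⨁ (allFin n) (λ i → 𝟙 (i Fin.≟ j) * f i) ≡ f j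
⨁-pick-Fin f = FinE.⨁-pick (cong f)

-- Permutations and transpositions

infix 4 _≈ₚ?_

_≈ₚ?_ : ∀ {d} (σ τ : Permutation′ d) → Dec (σ ≈ₚ τ)
σ ≈ₚ? τ = Fin.all? λ i → (σ ⟨$⟩ʳ i) Fin.≟ (τ ⟨$⟩ʳ i)

insert-zero-≈⇒ : ∀ {d} j (π : Permutation′ d) τ → insert zero j π ≈ₚ τ → j ≡ τ ⟨$⟩ʳ zero × π ≈ₚ remove zero τ
insert-zero-≈⇒ j π τ eq with refl ← eq zero = refl , λ i → Fin.punchIn-injective j _ _
  (trans (sym (insert-punchIn zero j π i)) (trans (eq (suc i)) (punchIn-permute τ zero i)))

insert-zero-≈⇐ : ∀ {d} j (π : Permutation′ d) τ → j ≡ τ ⟨$⟩ʳ zero → π ≈ₚ remove zero τ → insert zero j π ≈ₚ τ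
insert-zero-≈⇐ j π τ refl eq zero    = refl
insert-zero-≈⇐ j π τ refl eq (suc i) =
  trans (insert-punchIn zero j π i) (trans (cong (punchIn j) (eq i)) (sym (punchIn-permute τ zero i)))

permutations-once : ∀ {d} (τ : Permutation′ d) → ⨁ (permutations d) (λ σ → 𝟙 (σ ≈ₚ? τ)) ≡ 1ℚ
permutations-once {zero}  τ = trans ⨁-∷ (trans (cong₂ _+_ (𝟙-yes (idₚ ≈ₚ? τ) (λ ())) ⨁-[]) (+-identityʳ 1ℚ))
permutations-once {suc d} τ = begin
  ⨁ (permutations (suc d)) (λ σ → 𝟙 (σ ≈ₚ? τ))
    ≡⟨ ⨁-concatMap ⟩
  ⨁ (allFin (suc d)) (λ j → ⨁ (map (insert zero j) (permutations d)) (λ σ → 𝟙 (σ ≈ₚ? τ)))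
    ≡⟨ ⨁-cong (λ j → trans (⨁-map (insert zero j) (permutations d) _) (trans
         (⨁-cong (λ π → trans
           (𝟙-⇔ (insert zero j π ≈ₚ? τ) ((j Fin.≟ τ ⟨$⟩ʳ zero) ×-dec (π ≈ₚ? remove zero τ))
             (insert-zero-≈⇒ j π τ) (λ (p , q) → insert-zero-≈⇐ j π τ p q))
           (𝟙-× (j Fin.≟ τ ⟨$⟩ʳ zero) (π ≈ₚ? remove zero τ))))
         (trans ⨁-*ˡ
           (trans (cong (𝟙 (j Fin.≟ τ ⟨$⟩ʳ zero) *_) (permutations-once (remove zero τ))) (*-identityʳ _))))) ⟩
  ⨁ (allFin (suc d)) (λ j → 𝟙 (j Fin.≟ τ ⟨$⟩ʳ zero))
    ≡⟨ FinE.once (τ ⟨$⟩ʳ zero) ⟩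
  1ℚ ∎

Permutation-enumeration : ∀ d → Enumeration (Permutation′ d)
Permutation-enumeration d = record
  { elements = permutations d ; _~_ = _≈ₚ_ ; _~?_ = _≈ₚ?_
  ; ~-sym = λ eq i → sym (eq i) ; once = permutations-once }

module PermE {d} = Enumeration (Permutation-enumeration d)

⟨$⟩ʳ-injective : ∀ {d} (σ : Permutation′ d) {i j} → σ ⟨$⟩ʳ i ≡ σ ⟨$⟩ʳ j → i ≡ j
⟨$⟩ʳ-injective σ eq = trans (sym (inverseˡ σ)) (trans (cong (σ ⟨$⟩ˡ_) eq) (inverseˡ σ))

flip-cong : ∀ {d} {σ τ : Permutation′ d} → σ ≈ₚ τ → flip σ ≈ₚ flip τ
flip-cong {σ = σ} {τ} eq i = ⟨$⟩ʳ-injective σ (trans (inverseʳ σ) (trans (sym (inverseʳ τ)) (sym (eq (τ ⟨$⟩ˡ i)))))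

⨁-left : ∀ {d} (τ : Permutation′ d) {f} → PermE.Respects f →
         ⨁ (permutations d) (λ σ → f (τ · σ)) ≡ ⨁ (permutations d) f
⨁-left {d} τ = ⨁-reindex (Permutation-enumeration d) (Permutation-enumeration d) (τ ·_) (flip τ ·_)
  (λ σ ρ eq i → trans (sym (inverseˡ τ)) (cong (τ ⟨$⟩ˡ_) (eq i)))
  (λ σ ρ eq i → trans (cong (τ ⟨$⟩ʳ_) (eq i)) (inverseʳ τ))

⨁-right : ∀ {d} (τ : Permutation′ d) {f} → PermE.Respects f →
          ⨁ (permutations d) (λ σ → f (σ · τ)) ≡ ⨁ (permutations d) f
⨁-right {d} τ = ⨁-reindex (Permutation-enumeration d) (Permutation-enumeration d) (_· τ) (_· flip τ)
  (λ σ ρ eq i → trans (cong (σ ⟨$⟩ʳ_) (sym (inverseʳ τ))) (eq (τ ⟨$⟩ˡ i)))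
  (λ σ ρ eq i → trans (eq (τ ⟨$⟩ʳ i)) (cong (ρ ⟨$⟩ʳ_) (inverseˡ τ)))

⨁-flip : ∀ {d} {f} → PermE.Respects f → ⨁ (permutations d) (λ σ → f (flip σ)) ≡ ⨁ (permutations d) f
⨁-flip {d} = ⨁-reindex (Permutation-enumeration d) (Permutation-enumeration d) flip flip
  (λ σ ρ eq → flip-cong {σ = flip σ} {ρ} eq) (λ σ ρ eq → flip-cong {σ = σ} {flip ρ} eq)

⨁-conj : ∀ {d} (τ : Permutation′ d) {f} → PermE.Respects f →
         ⨁ (permutations d) (λ σ → f (τ · σ · flip τ)) ≡ ⨁ (permutations d) f
⨁-conj {d} τ {f} f-resp = trans
  (⨁-right (flip τ) {λ σ → f (τ · σ)} (λ eq → f-resp (λ i → cong (τ ⟨$⟩ʳ_) (eq i))))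
  (⨁-left τ {f} f-resp)

⨁-permute : ∀ {n} (σ : Permutation′ n) (f : Fin n → ℚ) → ⨁ (allFin n) (λ i → f (σ ⟨$⟩ʳ i)) ≡ ⨁ (allFin n) f
⨁-permute {n} σ f = ⨁-reindex (Fin-enumeration n) (Fin-enumeration n) (σ ⟨$⟩ʳ_) (σ ⟨$⟩ˡ_)
  (λ i j eq → trans (sym (inverseˡ σ)) (cong (σ ⟨$⟩ˡ_) eq))
  (λ i j eq → trans (cong (σ ⟨$⟩ʳ_) eq) (inverseʳ σ)) {f} (cong f)

opaque

  swap : ∀ {n} → Fin n → Fin n → Permutation′ n
  swap = transpose

  swap-fst : ∀ {n} (i j : Fin n) → swap i j ⟨$⟩ʳ i ≡ j
  swap-fst i j rewrite dec-true (i Fin.≟ i) refl = refl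

  swap-snd : ∀ {n} (i j : Fin n) → swap i j ⟨$⟩ʳ j ≡ i
  swap-snd i j with j Fin.≟ i
  ... | yes j≡i = j≡i
  ... | no  _ rewrite dec-true (j Fin.≟ j) refl = refl

  swap-other : ∀ {n} (i j : Fin n) {k} → k ≢ i → k ≢ j → swap i j ⟨$⟩ʳ k ≡ k
  swap-other i j {k} k≢i k≢j rewrite dec-false (k Fin.≟ i) k≢i | dec-false (k Fin.≟ j) k≢j = refl

module _ {n} (i j : Fin n) where

  which : ∀ k → k ≡ i ⊎ k ≡ j ⊎ (k ≢ i × k ≢ j)
  which k with k Fin.≟ i | k Fin.≟ j
  ... | yes k≡i | _       = inj₁ k≡i
  ... | no _    | yes k≡j = inj₂ (inj₁ k≡j)
  ... | no k≢i  | no k≢j  = inj₂ (inj₂ (k≢i , k≢j))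

  swap-elim : ∀ {A : Set} (f : Fin n → A) → f i ≡ f j → ∀ k → f (swap i j ⟨$⟩ʳ k) ≡ f k
  swap-elim f eq k with which k
  ... | inj₁ refl                = trans (cong f (swap-fst i j)) (sym eq)
  ... | inj₂ (inj₁ refl)         = trans (cong f (swap-snd i j)) eq
  ... | inj₂ (inj₂ (k≢i , k≢j))  = cong f (swap-other i j k≢i k≢j)

  swap-involutive : ∀ k → swap i j ⟨$⟩ʳ (swap i j ⟨$⟩ʳ k) ≡ k
  swap-involutive k with which k
  ... | inj₁ refl                = trans (cong (swap i j ⟨$⟩ʳ_) (swap-fst i j)) (swap-snd i j)
  ... | inj₂ (inj₁ refl)         = trans (cong (swap i j ⟨$⟩ʳ_) (swap-snd i j)) (swap-fst i j)
  ... | inj₂ (inj₂ (k≢i , k≢j))  = trans (cong (swap i j ⟨$⟩ʳ_) (swap-other i j k≢i k≢j)) (swap-other i j k≢i k≢j)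

  flip-swap : flip (swap i j) ≈ₚ swap i j
  flip-swap k = ⟨$⟩ʳ-injective (swap i j) (trans (inverseʳ (swap i j)) (sym (swap-involutive k)))

-- The sign

parity : ℕ → ℚ
parity = fold 1ℚ -_

parity-+ : ∀ m n → parity (m ℕ.+ n) ≡ parity m * parity n
parity-+ zero    n = sym (*-identityˡ (parity n))
parity-+ (suc m) n = trans (cong -_ (parity-+ m n)) (-‿distribˡ-* (parity m) (parity n))

parity² : ∀ n → parity n * parity n ≡ 1ℚ
parity² zero    = *-identityʳ 1ℚ
parity² (suc n) = trans (lemma (parity n)) (parity² n)
  where
  opaque
    unfolding _+_
    lemma : ∀ p → - p * - p ≡ p * p
    lemma = solve-∀ ℚ-ring

parity-even : ∀ n → parity (n ℕ.+ n) ≡ 1ℚ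
parity-even n = trans (parity-+ n n) (parity² n)

opaque
  unfolding _+_

  sgn : ∀ {d} → Permutation′ d → ℚ
  sgn = sign

  sgn-cong : ∀ {d} {σ τ : Permutation′ d} → σ ≈ₚ τ → sgn σ ≡ sgn τ
  sgn-cong {σ = σ} {τ} = sign-cong σ τ

  sgn-parity : ∀ {d} (σ : Permutation′ d) → sgn σ ≡ parity (inversions σ)
  sgn-parity σ = refl

⨁² : ∀ n → (Fin n → Fin n → ℚ) → ℚ
⨁² n f = ⨁ (allFin n) (λ i → ⨁ (allFin n) (f i))

⨁²-cong : ∀ {n} {f g : Fin n → Fin n → ℚ} → (∀ i j → f i j ≡ g i j) → ⨁² n f ≡ ⨁² n g
⨁²-cong {n} eq = ⨁-cong (λ i → ⨁-cong (eq i))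

⨁²-+ : ∀ {n} {f g : Fin n → Fin n → ℚ} → ⨁² n (λ i j → f i j + g i j) ≡ ⨁² n f + ⨁² n g
⨁²-+ = trans (⨁-cong (λ i → ⨁-+)) ⨁-+

⨁²-swap : ∀ {n} {f : Fin n → Fin n → ℚ} → ⨁² n f ≡ ⨁² n (λ i j → f j i)
⨁²-swap = ⨁-swap

⨁²-permute : ∀ {n} (σ : Permutation′ n) (f : Fin n → Fin n → ℚ) →
             ⨁² n (λ i j → f (σ ⟨$⟩ʳ i) (σ ⟨$⟩ʳ j)) ≡ ⨁² n f
⨁²-permute {n} σ f = trans (⨁-cong (λ i → ⨁-permute σ (f (σ ⟨$⟩ʳ i))))
                           (⨁-permute σ (λ i → ⨁ (allFin n) (f i)))

opaque
  unfolding ⨁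

  ⨁-cartesianProduct : ∀ (xs : List X) (ys : List Y) f →
                       ⨁ (cartesianProduct xs ys) f ≡ ⨁ xs (λ x → ⨁ ys (λ y → f (x , y)))
  ⨁-cartesianProduct []       ys f = refl
  ⨁-cartesianProduct (x ∷ xs) ys f = trans (⨁-++ (map (x ,_) ys) (cartesianProduct xs ys) f)
    (cong₂ _+_ (⨁-map (x ,_) ys f) (⨁-cartesianProduct xs ys f))

⨁²-count : ∀ {n} {P : Fin n × Fin n → Set} (P? : ∀ ij → Dec (P ij)) →
           fromℕ (length (filter P? (cartesianProduct (allFin n) (allFin n)))) ≡ ⨁² n (λ i j → 𝟙 (P? (i , j)))
⨁²-count {n} P? = trans (⨁-𝟙 P? (cartesianProduct (allFin n) (allFin n))) (⨁-cartesianProduct (allFin n) (allFin n) _)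

infix 8 _<𝟙_

opaque

  _<𝟙_ : ∀ {n} → Fin n → Fin n → ℚ
  i <𝟙 j = 𝟙 (i Fin.<? j)

  <𝟙-def : ∀ {n} (i j : Fin n) → i <𝟙 j ≡ 𝟙 (i Fin.<? j)
  <𝟙-def i j = refl

  <𝟙-yes : ∀ {n} {i j : Fin n} → i Fin.< j → i <𝟙 j ≡ 1ℚ
  <𝟙-yes {i = i} {j} = 𝟙-yes (i Fin.<? j)

  <𝟙-no : ∀ {n} {i j : Fin n} → ¬ i Fin.< j → i <𝟙 j ≡ 0ℚ
  <𝟙-no {i = i} {j} = 𝟙-no (i Fin.<? j)

<𝟙-total : ∀ {n} (i j : Fin n) → i ≢ j → i <𝟙 j + j <𝟙 i ≡ 1ℚ
<𝟙-total i j i≢j with Fin.<-cmp i j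
... | tri< i<j _ j≮i = trans (cong₂ _+_ (<𝟙-yes i<j) (<𝟙-no j≮i)) (+-identityʳ 1ℚ)
... | tri≈ _ i≡j _   = contradiction i≡j i≢j
... | tri> i≮j _ j<i = trans (cong₂ _+_ (<𝟙-no i≮j) (<𝟙-yes j<i)) (+-identityˡ 1ℚ)

-- Twice a sum over the pairs i < j is a sum over all pairs i ≢ j, and these are
-- permuted by σ.
⨁-pairs-permute : ∀ {n} (σ : Permutation′ n) (e : Fin n → Fin n → ℚ) → (∀ i j → e i j ≡ e j i) →
  ⨁² n (λ i j → i <𝟙 j * e (σ ⟨$⟩ʳ i) (σ ⟨$⟩ʳ j)) ≡ ⨁² n (λ i j → i <𝟙 j * e i j)
⨁-pairs-permute {n} σ e e-sym = 2*-cancel (begin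
  ⨁² n (λ i j → i <𝟙 j * eσ i j) + ⨁² n (λ i j → i <𝟙 j * eσ i j)  ≡⟨ double eσ (λ i j → e-sym (σ ⟨$⟩ʳ i) (σ ⟨$⟩ʳ j)) ⟩
  ⨁² n (λ i j → i ≢𝟙 j * eσ i j)              ≡⟨ ⨁²-cong (λ i j → cong (_* eσ i j) (≢𝟙-permute i j)) ⟩
  ⨁² n (λ i j → (σ ⟨$⟩ʳ i) ≢𝟙 (σ ⟨$⟩ʳ j) * eσ i j)
                                              ≡⟨ ⨁²-permute σ (λ i j → i ≢𝟙 j * e i j) ⟩
  ⨁² n (λ i j → i ≢𝟙 j * e i j)               ≡⟨ double e e-sym ⟨
  ⨁² n (λ i j → i <𝟙 j * e i j) + ⨁² n (λ i j → i <𝟙 j * e i j)   ∎)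
  where
  eσ : Fin n → Fin n → ℚ
  eσ i j = e (σ ⟨$⟩ʳ i) (σ ⟨$⟩ʳ j)
  infix 8 _≢𝟙_
  _≢𝟙_ : Fin n → Fin n → ℚ
  i ≢𝟙 j = i <𝟙 j + j <𝟙 i
  ≢𝟙-permute : ∀ i j → i ≢𝟙 j ≡ (σ ⟨$⟩ʳ i) ≢𝟙 (σ ⟨$⟩ʳ j)
  ≢𝟙-permute i j with i Fin.≟ j
  ... | yes refl = cong₂ _+_ (trans (<𝟙-no {i = i} (Fin.<-irrefl refl)) (sym (<𝟙-no {i = σ ⟨$⟩ʳ i} (Fin.<-irrefl refl))))
                             (trans (<𝟙-no {i = i} (Fin.<-irrefl refl)) (sym (<𝟙-no {i = σ ⟨$⟩ʳ i} (Fin.<-irrefl refl))))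
  ... | no i≢j = trans (<𝟙-total i j i≢j) (sym (<𝟙-total (σ ⟨$⟩ʳ i) (σ ⟨$⟩ʳ j) (i≢j ∘ ⟨$⟩ʳ-injective σ)))
  double : ∀ (e : Fin n → Fin n → ℚ) → (∀ i j → e i j ≡ e j i) →
           ⨁² n (λ i j → i <𝟙 j * e i j) + ⨁² n (λ i j → i <𝟙 j * e i j) ≡ ⨁² n (λ i j → i ≢𝟙 j * e i j)
  double e e-sym = begin
    ⨁² n (λ i j → i <𝟙 j * e i j) + ⨁² n (λ i j → i <𝟙 j * e i j)
      ≡⟨ cong (_+_ _) ⨁²-swap ⟩
    ⨁² n (λ i j → i <𝟙 j * e i j) + ⨁² n (λ i j → j <𝟙 i * e j i)
      ≡⟨ ⨁²-+ ⟨
    ⨁² n (λ i j → i <𝟙 j * e i j + j <𝟙 i * e j i)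
      ≡⟨ ⨁²-cong (λ i j → trans (cong (λ x → i <𝟙 j * e i j + j <𝟙 i * x) (e-sym j i)) (sym (distribʳ (e i j) (i <𝟙 j) (j <𝟙 i)))) ⟩
    ⨁² n (λ i j → i ≢𝟙 j * e i j) ∎

inv𝟙 : ∀ {d} → Permutation′ d → Fin d → Fin d → ℚ
inv𝟙 σ i j = i <𝟙 j * (σ ⟨$⟩ʳ j) <𝟙 (σ ⟨$⟩ʳ i)

inversion-𝟙 : ∀ {d} (σ : Permutation′ d) i j → 𝟙 (isInversion? σ (i , j)) ≡ inv𝟙 σ i j
inversion-𝟙 σ i j = trans (𝟙-× (i Fin.<? j) ((σ ⟨$⟩ʳ j) Fin.<? (σ ⟨$⟩ʳ i)))
  (sym (cong₂ _*_ (<𝟙-def i j) (<𝟙-def (σ ⟨$⟩ʳ j) (σ ⟨$⟩ʳ i))))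

inversions-⨁ : ∀ {d} (σ : Permutation′ d) → fromℕ (inversions σ) ≡ ⨁² d (inv𝟙 σ)
inversions-⨁ σ = trans (⨁²-count (isInversion? σ)) (⨁²-cong (inversion-𝟙 σ))

-- A pair inverted by τ whose order σ restores is counted among the inversions of both factors but
-- not among those of the product. With K such pairs, the inversions of the product and 2K together
-- make up those of the factors, and 2K does not affect the parity.
sgn-· : ∀ {d} (σ τ : Permutation′ d) → sgn (σ · τ) ≡ sgn σ * sgn τ
sgn-· {d} σ τ = begin
  sgn (σ · τ)                              ≡⟨ sgn-parity (σ · τ) ⟩
  parity N                                  ≡⟨ *-identityʳ (parity N) ⟨
  parity N * 1ℚ                             ≡⟨ cong (parity N *_) (parity-even K) ⟨
  parity N * parity (K ℕ.+ K)               ≡⟨ parity-+ N (K ℕ.+ K) ⟨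
  parity (N ℕ.+ (K ℕ.+ K))                  ≡⟨ cong parity N+2K ⟩
  parity (inversions σ ℕ.+ inversions τ)    ≡⟨ parity-+ (inversions σ) (inversions τ) ⟩
  parity (inversions σ) * parity (inversions τ)
                                            ≡⟨ cong₂ _*_ (sgn-parity σ) (sgn-parity τ) ⟨
  sgn σ * sgn τ                           ∎
  where
  N = inversions (σ · τ)
  restored? : ∀ ij → Dec _
  restored? (i , j) = isInversion? τ (i , j) ×-dec ((σ ⟨$⟩ʳ (τ ⟨$⟩ʳ i)) Fin.<? (σ ⟨$⟩ʳ (τ ⟨$⟩ʳ j)))
  K = length (filter restored? (cartesianProduct (allFin d) (allFin d)))
  k : Fin d → Fin d → ℚ
  k i j = inv𝟙 τ i j * (σ ⟨$⟩ʳ (τ ⟨$⟩ʳ i)) <𝟙 (σ ⟨$⟩ʳ (τ ⟨$⟩ʳ j))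
  K-⨁ : fromℕ K ≡ ⨁² d k
  K-⨁ = trans (⨁²-count restored?) (⨁²-cong λ i j → trans (𝟙-× (isInversion? τ (i , j)) _)
          (cong₂ _*_ (inversion-𝟙 τ i j) (sym (<𝟙-def _ _))))
  -- Symmetrised, since τ may exchange the order of a pair and `⨁-pairs-permute` speaks of functions
  -- of unordered pairs.
  e : Fin d → Fin d → ℚ
  e x y = inv𝟙 σ x y + inv𝟙 σ y x
  <*inv : ∀ x y → x <𝟙 y * e x y ≡ inv𝟙 σ x y
  <*inv x y with Fin.<-cmp x y
  ... | tri< x<y _ y≮x rewrite <𝟙-yes x<y | <𝟙-no y≮x = lemma _ _
    where
    opaque
      unfolding _+_
      lemma : ∀ a b → 1ℚ * (1ℚ * a + 0ℚ * b) ≡ 1ℚ * a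
      lemma = solve-∀ ℚ-ring
  ... | tri≈ x≮y _ _ rewrite <𝟙-no x≮y = trans (zeroˡ _) (sym (zeroˡ _))
  ... | tri> x≮y _ _ rewrite <𝟙-no x≮y = trans (zeroˡ _) (sym (zeroˡ _))
  inner : ∀ i j → i ≢ j → let x = τ ⟨$⟩ʳ i ; y = τ ⟨$⟩ʳ j in
    (σ ⟨$⟩ʳ y) <𝟙 (σ ⟨$⟩ʳ x) + (y <𝟙 x * (σ ⟨$⟩ʳ x) <𝟙 (σ ⟨$⟩ʳ y) + y <𝟙 x * (σ ⟨$⟩ʳ x) <𝟙 (σ ⟨$⟩ʳ y))
    ≡ e x y + y <𝟙 x
  inner i j i≢j with Fin.<-cmp (τ ⟨$⟩ʳ i) (τ ⟨$⟩ʳ j)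
  ... | tri< x<y _ y≮x rewrite <𝟙-yes x<y | <𝟙-no y≮x = lemma _ _
    where
    opaque
      unfolding _+_
      lemma : ∀ a b → a + (0ℚ * b + 0ℚ * b) ≡ (1ℚ * a + 0ℚ * b) + 0ℚ
      lemma = solve-∀ ℚ-ring
  ... | tri≈ _ x≡y _ = contradiction (⟨$⟩ʳ-injective τ x≡y) i≢j
  ... | tri> x≮y _ y<x rewrite <𝟙-yes y<x | <𝟙-no x≮y = trans (lemma _ _)
    (trans (cong (_+ (σ ⟨$⟩ʳ (τ ⟨$⟩ʳ i)) <𝟙 (σ ⟨$⟩ʳ (τ ⟨$⟩ʳ j))) (<𝟙-total (σ ⟨$⟩ʳ (τ ⟨$⟩ʳ j)) (σ ⟨$⟩ʳ (τ ⟨$⟩ʳ i)) (i≢j ∘ sym ∘ ⟨$⟩ʳ-injective τ ∘ ⟨$⟩ʳ-injective σ))) (lemma′ _ _))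
    where
    opaque
      unfolding _+_
      lemma : ∀ a b → a + (1ℚ * b + 1ℚ * b) ≡ (a + b) + b
      lemma = solve-∀ ℚ-ring
    opaque
      unfolding _+_
      lemma′ : ∀ a b → 1ℚ + b ≡ (0ℚ * a + 1ℚ * b) + 1ℚ
      lemma′ = solve-∀ ℚ-ring
  pointwise : ∀ i j → inv𝟙 (σ · τ) i j + (k i j + k i j) ≡ i <𝟙 j * e (τ ⟨$⟩ʳ i) (τ ⟨$⟩ʳ j) + inv𝟙 τ i j
  pointwise i j with toSum (i Fin.<? j)
  ... | inj₁ i<j rewrite <𝟙-yes i<j = trans (lemma _ _ _) (trans (inner i j (Fin.<⇒≢ i<j)) (lemma′ _ _))
    where
    opaque
      unfolding _+_
      lemma : ∀ a b c → 1ℚ * a + ((1ℚ * b) * c + (1ℚ * b) * c) ≡ a + (b * c + b * c)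
      lemma = solve-∀ ℚ-ring
    opaque
      unfolding _+_
      lemma′ : ∀ a b → a + b ≡ 1ℚ * a + 1ℚ * b
      lemma′ = solve-∀ ℚ-ring
  ... | inj₂ i≮j rewrite <𝟙-no i≮j = lemma _ _ _ _
    where
    opaque
      unfolding _+_
      lemma : ∀ a b c d → 0ℚ * a + ((0ℚ * b) * c + (0ℚ * b) * c) ≡ 0ℚ * d + 0ℚ * b
      lemma = solve-∀ ℚ-ring
  N+2K : N ℕ.+ (K ℕ.+ K) ≡ inversions σ ℕ.+ inversions τ
  N+2K = fromℕ-injective (begin
    fromℕ (N ℕ.+ (K ℕ.+ K))          ≡⟨ trans (fromℕ-+ N (K ℕ.+ K)) (cong (fromℕ N +_) (fromℕ-+ K K)) ⟩
    fromℕ N + (fromℕ K + fromℕ K)    ≡⟨ cong₂ _+_ (inversions-⨁ (σ · τ)) (trans (cong₂ _+_ K-⨁ K-⨁) (sym ⨁²-+)) ⟩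
    ⨁² d (inv𝟙 (σ · τ)) + ⨁² d (λ i j → k i j + k i j)
                                     ≡⟨ ⨁²-+ ⟨
    ⨁² d (λ i j → inv𝟙 (σ · τ) i j + (k i j + k i j))
                                     ≡⟨ ⨁²-cong pointwise ⟩
    ⨁² d (λ i j → i <𝟙 j * e (τ ⟨$⟩ʳ i) (τ ⟨$⟩ʳ j) + inv𝟙 τ i j)
                                     ≡⟨ ⨁²-+ ⟩
    ⨁² d (λ i j → i <𝟙 j * e (τ ⟨$⟩ʳ i) (τ ⟨$⟩ʳ j)) + ⨁² d (inv𝟙 τ)
                                     ≡⟨ cong (_+ ⨁² d (inv𝟙 τ)) (trans (⨁-pairs-permute τ e (λ x y → +-comm _ _)) (⨁²-cong <*inv)) ⟩
    ⨁² d (inv𝟙 σ) + ⨁² d (inv𝟙 τ)    ≡⟨ cong₂ _+_ (inversions-⨁ σ) (inversions-⨁ τ) ⟨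
    fromℕ (inversions σ) + fromℕ (inversions τ)
                                     ≡⟨ fromℕ-+ (inversions σ) (inversions τ) ⟨
    fromℕ (inversions σ ℕ.+ inversions τ) ∎)

sgn² : ∀ {d} (σ : Permutation′ d) → sgn σ * sgn σ ≡ 1ℚ
sgn² σ = trans (cong₂ _*_ (sgn-parity σ) (sgn-parity σ)) (parity² (inversions σ))

sgn-id : ∀ {d} → sgn (idₚ {d}) ≡ 1ℚ
sgn-id {d} = begin
  sgn e                  ≡⟨ *-identityˡ (sgn e) ⟨
  1ℚ * sgn e             ≡⟨ cong (_* sgn e) (sgn² e) ⟨
  sgn e * sgn e * sgn e  ≡⟨ cong (_* sgn e) (sgn-· e e) ⟨
  sgn (e · e) * sgn e    ≡⟨ cong (_* sgn e) (sgn-cong {σ = e · e} (λ _ → refl)) ⟩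
  sgn e * sgn e          ≡⟨ sgn² e ⟩
  1ℚ                     ∎
  where
  e = idₚ {d}

sgn-flip : ∀ {d} (σ : Permutation′ d) → sgn (flip σ) ≡ sgn σ
sgn-flip {d} σ = begin
  sgn (flip σ)                      ≡⟨ *-identityˡ _ ⟨
  1ℚ * sgn (flip σ)                 ≡⟨ cong (_* sgn (flip σ)) (sgn² σ) ⟨
  sgn σ * sgn σ * sgn (flip σ)    ≡⟨ *-assoc (sgn σ) (sgn σ) _ ⟩
  sgn σ * (sgn σ * sgn (flip σ))  ≡⟨ cong (sgn σ *_) (trans (sym (sgn-· σ (flip σ))) (trans (sgn-cong {σ = σ · flip σ} {idₚ} (λ i → inverseʳ σ)) sgn-id)) ⟩
  sgn σ * 1ℚ                        ≡⟨ *-identityʳ _ ⟩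
  sgn σ                             ∎

-- (x , y) ↦ (τ y , τ x) is an involution of the inversions of a transposition τ
-- with a single fixed point.
sgn-swap : ∀ {d} {i j : Fin d} → i ≢ j → sgn (swap i j) ≡ - 1ℚ
sgn-swap {d} {i} {j} i≢j = trans (sgn-parity τ) (trans (cong parity N≡1+2K) (cong -_ (parity-even K)))
  where
  τ = swap i j
  t : Fin d → Fin d
  t = τ ⟨$⟩ʳ_
  below? : ∀ xy → Dec _
  below? (x , y) = isInversion? τ (x , y) ×-dec (t y Fin.<? x)
  K = length (filter below? (cartesianProduct (allFin d) (allFin d)))
  k : Fin d → Fin d → ℚ
  k x y = inv𝟙 τ x y * t y <𝟙 x
  K-⨁ : fromℕ K ≡ ⨁² d k
  K-⨁ = trans (⨁²-count below?) (⨁²-cong λ x y → trans (𝟙-× (isInversion? τ (x , y)) _)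
          (cong₂ _*_ (inversion-𝟙 τ x y) (sym (<𝟙-def _ _))))
  tt : ∀ x → t (t x) ≡ x
  tt = swap-involutive i j
  K′-⨁ : fromℕ K ≡ ⨁² d (λ x y → inv𝟙 τ x y * x <𝟙 t y)
  K′-⨁ = begin
    fromℕ K                       ≡⟨ K-⨁ ⟩
    ⨁² d k                        ≡⟨ ⨁²-permute τ k ⟨
    ⨁² d (λ x y → k (t x) (t y))  ≡⟨ ⨁²-swap ⟩
    ⨁² d (λ x y → k (t y) (t x))  ≡⟨ ⨁²-cong (λ x y → cong₂ _*_ (trans (cong (t y <𝟙 t x *_) (cong₂ _<𝟙_ (tt x) (tt y))) (*-comm _ _)) (cong (_<𝟙 t y) (tt x))) ⟩
    ⨁² d (λ x y → inv𝟙 τ x y * x <𝟙 t y) ∎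
  fixed : Fin d → Fin d → ℚ
  fixed x y = inv𝟙 τ x y * 𝟙 (x Fin.≟ t y)
  split : ∀ x y → inv𝟙 τ x y ≡ fixed x y + (inv𝟙 τ x y * t y <𝟙 x + inv𝟙 τ x y * x <𝟙 t y)
  split x y with toSum (x Fin.≟ t y)
  ... | inj₁ eq rewrite 𝟙-yes (x Fin.≟ t y) eq | <𝟙-no {i = t y} {x} (λ lt → Fin.<⇒≢ lt (sym eq)) | <𝟙-no {i = x} {t y} (λ lt → Fin.<⇒≢ lt eq) = lemma _
    where
    opaque
      unfolding _+_
      lemma : ∀ a → a ≡ a * 1ℚ + (a * 0ℚ + a * 0ℚ)
      lemma = solve-∀ ℚ-ring
  ... | inj₂ neq rewrite 𝟙-no (x Fin.≟ t y) neq = trans (sym (*-identityʳ _)) (trans (cong (inv𝟙 τ x y *_) (sym (<𝟙-total (t y) x (neq ∘ sym)))) (lemma _ _ _))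
    where
    opaque
      unfolding _+_
      lemma : ∀ a b c → a * (b + c) ≡ a * 0ℚ + (a * b + a * c)
      lemma = solve-∀ ℚ-ring
  fixed-⨁ : ⨁² d fixed ≡ 1ℚ
  fixed-⨁ = begin
    ⨁² d fixed ≡⟨ ⨁²-swap ⟩
    ⨁² d (λ y x → fixed x y) ≡⟨ ⨁-cong (λ y → trans (⨁-cong (λ x → *-comm (inv𝟙 τ x y) (𝟙 (x Fin.≟ t y)))) (⨁-pick-Fin (λ x → inv𝟙 τ x y) (t y))) ⟩
    ⨁ (allFin d) (λ y → inv𝟙 τ (t y) y) ≡⟨ ⨁-cong moved ⟩
    ⨁ (allFin d) (λ y → 𝟙 (y Fin.≟ i) * (j <𝟙 i) + 𝟙 (y Fin.≟ j) * (i <𝟙 j)) ≡⟨ ⨁-+ ⟩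
    ⨁ (allFin d) (λ y → 𝟙 (y Fin.≟ i) * (j <𝟙 i)) + ⨁ (allFin d) (λ y → 𝟙 (y Fin.≟ j) * (i <𝟙 j))
      ≡⟨ cong₂ _+_ (⨁-pick-Fin (λ _ → j <𝟙 i) i) (⨁-pick-Fin (λ _ → i <𝟙 j) j) ⟩
    j <𝟙 i + i <𝟙 j ≡⟨ <𝟙-total j i (i≢j ∘ sym) ⟩
    1ℚ ∎
    where
    idem : ∀ {n} (x y : Fin n) → x <𝟙 y * x <𝟙 y ≡ x <𝟙 y
    idem x y with toSum (x Fin.<? y)
    ... | inj₁ p rewrite <𝟙-yes p = *-identityʳ 1ℚ
    ... | inj₂ ¬p rewrite <𝟙-no ¬p = zeroʳ 0ℚ
    moved : ∀ y → inv𝟙 τ (t y) y ≡ 𝟙 (y Fin.≟ i) * (j <𝟙 i) + 𝟙 (y Fin.≟ j) * (i <𝟙 j)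
    moved y with which i j y
    ... | inj₁ refl rewrite 𝟙-yes (y Fin.≟ y) refl | 𝟙-no (y Fin.≟ j) i≢j = trans
      (cong₂ _*_ (cong (_<𝟙 y) (swap-fst y j)) (cong₂ _<𝟙_ (swap-fst y j) (tt y)))
      (trans (idem j y) (lemma _ _))
      where
      opaque
        unfolding _+_
        lemma : ∀ a b → a ≡ 1ℚ * a + 0ℚ * b
        lemma = solve-∀ ℚ-ring
    ... | inj₂ (inj₁ refl) rewrite 𝟙-no (y Fin.≟ i) (i≢j ∘ sym) | 𝟙-yes (y Fin.≟ y) refl = trans
      (cong₂ _*_ (cong (_<𝟙 y) (swap-snd i y)) (cong₂ _<𝟙_ (swap-snd i y) (tt y)))
      (trans (idem i y) (lemma _ _))
      where
      opaque
        unfolding _+_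
        lemma : ∀ a b → a ≡ 0ℚ * b + 1ℚ * a
        lemma = solve-∀ ℚ-ring
    ... | inj₂ (inj₂ (y≢i , y≢j)) rewrite 𝟙-no (y Fin.≟ i) y≢i | 𝟙-no (y Fin.≟ j) y≢j = trans
      (cong (_* t y <𝟙 t (t y)) (trans (cong (_<𝟙 y) (swap-other i j y≢i y≢j)) (<𝟙-no {i = y} (Fin.<-irrefl refl)))) (lemma (j <𝟙 i) (i <𝟙 j) (t y <𝟙 t (t y)))
      where
      opaque
        unfolding _+_
        lemma : ∀ a b c → 0ℚ * c ≡ 0ℚ * a + 0ℚ * b
        lemma = solve-∀ ℚ-ring
  N≡1+2K : inversions τ ≡ suc (K ℕ.+ K)
  N≡1+2K = fromℕ-injective (begin
    fromℕ (inversions τ) ≡⟨ inversions-⨁ τ ⟩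
    ⨁² d (inv𝟙 τ) ≡⟨ ⨁²-cong split ⟩
    ⨁² d (λ x y → fixed x y + (k x y + inv𝟙 τ x y * x <𝟙 t y)) ≡⟨ ⨁²-+ ⟩
    ⨁² d fixed + ⨁² d (λ x y → k x y + inv𝟙 τ x y * x <𝟙 t y) ≡⟨ cong₂ _+_ fixed-⨁ ⨁²-+ ⟩
    1ℚ + (⨁² d k + ⨁² d (λ x y → inv𝟙 τ x y * x <𝟙 t y)) ≡⟨ cong (1ℚ +_) (cong₂ _+_ K-⨁ K′-⨁) ⟨
    1ℚ + (fromℕ K + fromℕ K) ≡⟨ trans (fromℕ-suc (K ℕ.+ K)) (cong (1ℚ +_) (fromℕ-+ K K)) ⟨
    fromℕ (suc (K ℕ.+ K)) ∎)

-- Counting and sorting within columns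

injective⇒permutation : ∀ {d} (f : Fin d → Fin d) → (∀ {x y} → f x ≡ f y → x ≡ y) →
                        Σ[ σ ∈ Permutation′ d ] (∀ x → σ ⟨$⟩ʳ x ≡ f x)
injective⇒permutation {zero}  f inj = idₚ , λ ()
injective⇒permutation {suc d} f inj = permutation f (proj₁ ∘ preimage) (proj₂ ∘ preimage) (λ x → inj (proj₂ (preimage (f x)))) , λ _ → refl
  where
  preimage : ∀ y → ∃[ x ] f x ≡ y
  preimage y with Fin.any? (λ x → f x Fin.≟ y)
  ... | yes x,fx≡y = x,fx≡y
  ... | no  y∉f    = contradiction
    (Fin.injective⇒≤ {f = λ x → punchOut {i = y} {f x} (λ y≡fx → y∉f (x , sym y≡fx))}
      (λ eq → inj (Fin.punchOut-injective {i = y} _ _ eq)))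
    ℕ.1+n≰n

fromℕ-cancel-≤ : ∀ {m n} → fromℕ m ℚ.≤ fromℕ n → m ℕ.≤ n
fromℕ-cancel-≤ {m} {n} m≤n with ℕ.≤-total m n
... | inj₁ m≤n′ = m≤n′
... | inj₂ n≤m  = ℕ.≤-reflexive (fromℕ-injective (ℚ.≤-antisym m≤n (fromℕ-mono-≤ n≤m)))

count : ∀ {d} {P : Fin d → Set} → (∀ x → Dec (P x)) → ℕ
count {d} P? = length (filter P? (allFin d))

⨁-unique : ∀ {d} {P : Fin d → Set} (P? : ∀ x → Dec (P x)) → (∀ {x y} → P x → P y → x ≡ y) →
           ⨁ (allFin d) (λ x → 𝟙 (P? x)) ℚ.≤ 1ℚ
⨁-unique {d} {P} P? unique with Fin.any? P?
... | yes (y , Py) = subst (⨁ (allFin d) (λ x → 𝟙 (P? x)) ℚ.≤_) (FinE.once y) (⨁-mono-≤ 𝟙≤)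
  where
  𝟙≤ : ∀ x → 𝟙 (P? x) ℚ.≤ 𝟙 (x Fin.≟ y)
  𝟙≤ x with toSum (P? x)
  ... | inj₁ Px  = ℚ.≤-reflexive (trans (𝟙-yes (P? x) Px) (sym (𝟙-yes (x Fin.≟ y) (unique Px Py))))
  ... | inj₂ ¬Px = ℚ.≤-trans (ℚ.≤-reflexive (𝟙-no (P? x) ¬Px)) (0≤𝟙 (x Fin.≟ y))
... | no ¬∃P = ℚ.≤-trans (ℚ.≤-reflexive (⨁-zero (λ x → 𝟙-no (P? x) (λ Px → ¬∃P (x , Px)))))
                         (fromℕ-mono-≤ {0} {1} ℕ.z≤n)

count-≤ : ∀ {d} {P : Fin d → Set} (P? : ∀ x → Dec (P x)) (h : Fin d → ℕ) N →
          (∀ {x} → P x → h x ℕ.< N) → (∀ {x y} → P x → P y → h x ≡ h y → x ≡ y) → count P? ℕ.≤ N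
count-≤ {d} P? h N h<N h-inj = fromℕ-cancel-≤ (subst₂ ℚ._≤_
  (sym (trans (⨁-𝟙 P? (allFin d)) (trans (⨁-cong level) ⨁-swap)))
  (trans ⨁-allFin-const (*-identityʳ (fromℕ N)))
  (⨁-mono-≤ {xs = allFin N} (λ i → ⨁-unique (at i) (λ (Px , i≡hx) (Py , i≡hy) → h-inj Px Py (trans (sym i≡hx) i≡hy)))))
  where
  at : ∀ i x → Dec _
  at i x = P? x ×-dec (toℕ {N} i ℕ.≟ h x)
  level : ∀ x → 𝟙 (P? x) ≡ ⨁ (allFin N) (λ i → 𝟙 (at i x))
  level x with toSum (P? x)
  ... | inj₁ Px = trans (𝟙-yes (P? x) Px) (sym (trans
    (⨁-cong (λ i → 𝟙-⇔ (at i x) (i Fin.≟ Fin.fromℕ< (h<N Px))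
      (λ (_ , i≡hx) → Fin.toℕ-injective (trans i≡hx (sym (Fin.toℕ-fromℕ< (h<N Px)))))
      (λ i≡ → Px , trans (cong toℕ i≡) (Fin.toℕ-fromℕ< (h<N Px)))))
    (FinE.once (Fin.fromℕ< (h<N Px)))))
  ... | inj₂ ¬Px = trans (𝟙-no (P? x) ¬Px) (sym (⨁-zero (λ i → 𝟙-no (at i x) (λ (Px , _) → ¬Px Px))))

count-< : ∀ {d} {P Q : Fin d → Set} (P? : ∀ x → Dec (P x)) (Q? : ∀ x → Dec (Q x)) →
          (∀ {x} → P x → Q x) → ∀ y → Q y → ¬ P y → count P? ℕ.< count Q?
count-< {d} P? Q? P⇒Q y Qy ¬Py = fromℕ-cancel-≤ (subst₂ ℚ._≤_
  (trans ⨁-+ (sym (trans (fromℕ-suc (count P?)) (cong₂ _+_ (sym (FinE.once y)) (⨁-𝟙 P? (allFin d))))))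
  (sym (⨁-𝟙 Q? (allFin d)))
  (⨁-mono-≤ pointwise))
  where
  pointwise : ∀ x → 𝟙 (x Fin.≟ y) + 𝟙 (P? x) ℚ.≤ 𝟙 (Q? x)
  pointwise x with toSum (P? x) | toSum (x Fin.≟ y)
  ... | inj₁ Px  | inj₁ refl = contradiction Px ¬Py
  ... | inj₁ Px  | inj₂ x≢y  = ℚ.≤-reflexive (trans (cong₂ _+_ (𝟙-no (x Fin.≟ y) x≢y) (𝟙-yes (P? x) Px))
                                 (trans (+-identityˡ 1ℚ) (sym (𝟙-yes (Q? x) (P⇒Q Px)))))
  ... | inj₂ ¬Px | inj₁ refl = ℚ.≤-reflexive (trans (cong₂ _+_ (𝟙-yes (x Fin.≟ x) refl) (𝟙-no (P? x) ¬Px))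
                                 (trans (+-identityʳ 1ℚ) (sym (𝟙-yes (Q? x) Qy))))
  ... | inj₂ ¬Px | inj₂ x≢y  = subst (ℚ._≤ 𝟙 (Q? x)) (sym (trans (cong₂ _+_ (𝟙-no (x Fin.≟ y) x≢y) (𝟙-no (P? x) ¬Px)) (+-identityʳ 0ℚ))) (0≤𝟙 (Q? x))

-- Unless g takes a value twice on some column, the permutation below sorts each
-- column by g.
module Sorting {d} (row col : Fin d → ℕ)
  (cell-injective : ∀ {x y} → row x ≡ row y → col x ≡ col y → x ≡ y)
  (down-closed : ∀ y {i} → i ℕ.< row y → ∃[ x ] (row x ≡ i × col x ≡ col y))
  where

  Collision : (Fin d → ℕ) → Set
  Collision g = ∃[ x ] ∃[ y ] (x ≢ y × col x ≡ col y × g x ≡ g y)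

  SortedBelow : (Fin d → ℕ) → Set
  SortedBelow g = ∃[ q ] ((∀ x → col (q ⟨$⟩ʳ x) ≡ col x) × (∀ x → row (q ⟨$⟩ʳ x) ℕ.≤ g x))

  -- The common source of three dichotomies below, for exponent vectors, for images of tableau rows
  -- and for colourings. A collision makes an alternating sum vanish through a transposition; in the
  -- other case a comparison of totals turns the inequalities into equalities.
  collision⊎sortedBelow : ∀ g → Collision g ⊎ SortedBelow g
  collision⊎sortedBelow g with Fin.any? (λ x → Fin.any? (λ y → ¬? (x Fin.≟ y) ×-dec ((col x ℕ.≟ col y) ×-dec (g x ℕ.≟ g y))))
  ... | yes collision  = inj₁ collision
  ... | no  ¬collision = inj₂ (q , (λ x → trans (cong col (q≡ x)) (proj₂ (proj₂ (target x)))) ,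
                               (λ x → subst (ℕ._≤ g x) (sym (trans (cong row (q≡ x)) (proj₁ (proj₂ (target x))))) (rank≤g x)))
    where
    g-injective : ∀ {x y} → col x ≡ col y → g x ≡ g y → x ≡ y
    g-injective {x} {y} col≡ g≡ with x Fin.≟ y
    ... | yes x≡y = x≡y
    ... | no  x≢y = contradiction (x , y , x≢y , col≡ , g≡) ¬collision

    below? : ∀ x y → Dec (col y ≡ col x × g y ℕ.< g x)
    below? x y = (col y ℕ.≟ col x) ×-dec (g y ℕ.<? g x)

    rank : Fin d → ℕ
    rank x = count (below? x)

    rank≤g : ∀ x → rank x ℕ.≤ g x
    rank≤g x = count-≤ (below? x) g (g x) proj₂ (λ (p , _) (q , _) → g-injective (trans p (sym q)))

    rank-mono : ∀ {x y} → col x ≡ col y → g x ℕ.< g y → rank x ℕ.< rank y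
    rank-mono {x} {y} col≡ g< = count-< (below? x) (below? y)
      (λ (p , lt) → trans p col≡ , ℕ.<-trans lt g<) x (col≡ , g<) (λ (_ , lt) → ℕ.<-irrefl refl lt)

    rank<height : ∀ x → rank x ℕ.< count (λ y → col y ℕ.≟ col x)
    rank<height x = count-< (below? x) (λ y → col y ℕ.≟ col x) proj₁ x refl (λ (_ , lt) → ℕ.<-irrefl refl lt)

    target : ∀ x → ∃[ y ] (row y ≡ rank x × col y ≡ col x)
    target x with Fin.any? (λ y → (row y ℕ.≟ rank x) ×-dec (col y ℕ.≟ col x))
    ... | yes found = found
    -- If no cell of the column had row `rank x`, down-closure would keep all its rows below
    -- `rank x`, and the column would have at most `rank x` cells.
    ... | no  ¬found = contradiction (rank<height x) (ℕ.≤⇒≯ (count-≤ (λ y → col y ℕ.≟ col x) row (rank x) row<rank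
                         (λ p q eq → cell-injective eq (trans p (sym q)))))
      where
      row<rank : ∀ {y} → col y ≡ col x → row y ℕ.< rank x
      row<rank {y} col≡ with ℕ.<-cmp (row y) (rank x)
      ... | tri< lt _ _ = lt
      ... | tri≈ _ eq _ = contradiction (y , eq , col≡) ¬found
      ... | tri> _ _ gt with z , row≡ , col≡′ ← down-closed y gt = contradiction (z , row≡ , trans col≡′ col≡) ¬found

    target-injective : ∀ {x y} → proj₁ (target x) ≡ proj₁ (target y) → x ≡ y
    target-injective {x} {y} eq = g-injective col≡ g≡
      where
      col≡ : col x ≡ col y
      col≡ = trans (sym (proj₂ (proj₂ (target x)))) (trans (cong col eq) (proj₂ (proj₂ (target y))))
      rank≡ : rank x ≡ rank y
      rank≡ = trans (sym (proj₁ (proj₂ (target x)))) (trans (cong row eq) (proj₁ (proj₂ (target y))))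
      g≡ : g x ≡ g y
      g≡ with ℕ.<-cmp (g x) (g y)
      ... | tri< lt _ _ = contradiction rank≡ (ℕ.<⇒≢ (rank-mono col≡ lt))
      ... | tri≈ _ eq _ = eq
      ... | tri> _ _ gt = contradiction (sym rank≡) (ℕ.<⇒≢ (rank-mono (sym col≡) gt))

    q : Permutation′ d
    q = proj₁ (injective⇒permutation (proj₁ ∘ target) target-injective)
    q≡ : ∀ x → q ⟨$⟩ʳ x ≡ proj₁ (target x)
    q≡ = proj₂ (injective⇒permutation (proj₁ ∘ target) target-injective)

-- Sums over initial segments of ℕ

⨁< : ℕ → (ℕ → ℚ) → ℚ
⨁< m f = ⨁ (allFin m) (f ∘ toℕ)

⨁<-suc : ∀ m f → ⨁< (suc m) f ≡ f 0 + ⨁< m (f ∘ suc)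
⨁<-suc m f = ⨁-allFin-suc

⨁<-zero : ∀ f → ⨁< 0 f ≡ 0ℚ
⨁<-zero f = ⨁-[]

⨁<-cong : ∀ m {f g} → (∀ k → k ℕ.< m → f k ≡ g k) → ⨁< m f ≡ ⨁< m g
⨁<-cong m eq = ⨁-cong (λ i → eq (toℕ i) (Fin.toℕ<n i))

⨁<-split : ∀ m n f → ⨁< (m ℕ.+ n) f ≡ ⨁< m f + ⨁< n (λ k → f (m ℕ.+ k))
⨁<-split zero    n f = sym (trans (cong (_+ ⨁< n f) (⨁<-zero f)) (+-identityˡ (⨁< n f)))
⨁<-split (suc m) n f = trans (⨁<-suc (m ℕ.+ n) f) (trans (cong (f 0 +_) (⨁<-split m n (f ∘ suc)))
  (trans (sym (+-assoc (f 0) _ _)) (cong (_+ ⨁< n (λ k → f (suc m ℕ.+ k))) (sym (⨁<-suc m f)))))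

⨁<-reverse : ∀ m f → ⨁< m f ≡ ⨁< m (λ k → f (m ℕ.∸ suc k))
⨁<-reverse m f = trans (sym (⨁-permute (reverse {m}) (f ∘ toℕ)))
  (⨁-cong (λ i → cong f (Fin.opposite-prop i)))

⨁<-vanish : ∀ {m n} f → m ℕ.≤ n → (∀ k → m ℕ.≤ k → f k ≡ 0ℚ) → ⨁< n f ≡ ⨁< m f
⨁<-vanish {m} {n} f m≤n f≡0 = begin
  ⨁< n f                                          ≡⟨ cong (λ n → ⨁< n f) (ℕ.m+[n∸m]≡n m≤n) ⟨
  ⨁< (m ℕ.+ (n ℕ.∸ m)) f                          ≡⟨ ⨁<-split m (n ℕ.∸ m) f ⟩
  ⨁< m f + ⨁< (n ℕ.∸ m) (λ k → f (m ℕ.+ k))       ≡⟨ cong (⨁< m f +_) (⨁-zero (λ i → f≡0 (m ℕ.+ toℕ i) (ℕ.m≤m+n m (toℕ i)))) ⟩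
  ⨁< m f + 0ℚ                                     ≡⟨ +-identityʳ (⨁< m f) ⟩
  ⨁< m f                                          ∎

⨁<-𝟙 : ∀ {m n} f {P : ℕ → Set} (P? : ∀ k → Dec (P k)) → m ℕ.≤ n → (∀ k → P k → k ℕ.< m) → (∀ k → k ℕ.< m → P k) →
       ⨁< n (λ k → 𝟙 (P? k) * f k) ≡ ⨁< m f
⨁<-𝟙 {m} {n} f P? m≤n P⇒< <⇒P = trans
  (⨁<-vanish _ m≤n (λ k m≤k → trans (cong (_* f k) (𝟙-no (P? k) (λ Pk → ℕ.<⇒≱ (P⇒< k Pk) m≤k))) (zeroˡ (f k))))
  (⨁<-cong m (λ k k<m → trans (cong (_* f k) (𝟙-yes (P? k) (<⇒P k k<m))) (*-identityˡ (f k))))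

⨁<-antisymmetric : ∀ m f → (∀ k → k ℕ.< m → f (m ℕ.∸ suc k) ≡ - f k) → ⨁< m f ≡ 0ℚ
⨁<-antisymmetric m f anti = p≡-p⇒p≡0 (trans (⨁<-reverse m f) (trans (⨁<-cong m anti) ⨁-neg))

-- Alternants

infix 4 _≗?_

_≗?_ : ∀ {n} (A B : Fin n → ℤ) → Dec (A ≗ B)
A ≗? B = Fin.all? (λ i → A i ℤ.≟ B i)

nonneg? : ∀ {n} (A : Fin n → ℤ) → Dec (∀ i → 0ℤ ℤ.≤ A i)
nonneg? A = Fin.all? (λ i → 0ℤ ℤ.≤? A i)


-- The coefficient of x^A y^B in det (1 / (1 - xᵢ yⱼ)), if A is nonnegative.
Alt : (A B : Fin n → ℤ) → ℚ
Alt {n} A B = ⨁ (permutations n) (λ w → sgn w * 𝟙 (A ≗? B ∘ (w ⟨$⟩ʳ_)))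

Alt-cong : ∀ {A A′ B B′ : Fin n → ℤ} → A ≗ A′ → B ≗ B′ → Alt A B ≡ Alt A′ B′
Alt-cong {n} {A} {A′} {B} {B′} A≗ B≗ = ⨁-cong (λ w → cong (sgn w *_)
  (𝟙-⇔ (A ≗? B ∘ (w ⟨$⟩ʳ_)) (A′ ≗? B′ ∘ (w ⟨$⟩ʳ_))
    (λ eq i → trans (sym (A≗ i)) (trans (eq i) (B≗ (w ⟨$⟩ʳ i))))
    (λ eq i → trans (A≗ i) (trans (eq i) (sym (B≗ (w ⟨$⟩ʳ i)))))))

Alt-summand-cong : ∀ (A B : Fin n → ℤ) → PermE.Respects (λ w → sgn w * 𝟙 (A ≗? B ∘ (w ⟨$⟩ʳ_)))
Alt-summand-cong A B {w} {w′} w≈ = cong₂ _*_ (sgn-cong {σ = w} {w′} w≈)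
  (𝟙-⇔ (A ≗? B ∘ (w ⟨$⟩ʳ_)) (A ≗? B ∘ (w′ ⟨$⟩ʳ_))
    (λ eq i → trans (eq i) (cong B (w≈ i))) (λ eq i → trans (eq i) (cong B (sym (w≈ i)))))

Alt-permute : ∀ (σ : Permutation′ n) A B → Alt (A ∘ (σ ⟨$⟩ʳ_)) B ≡ sgn σ * Alt A B
Alt-permute {n} σ A B = begin
  Alt (A ∘ (σ ⟨$⟩ʳ_)) B
    ≡⟨ ⨁-right σ (Alt-summand-cong (A ∘ (σ ⟨$⟩ʳ_)) B) ⟨
  ⨁ (permutations n) (λ w → sgn (w · σ) * 𝟙 (A ∘ (σ ⟨$⟩ʳ_) ≗? B ∘ ((w · σ) ⟨$⟩ʳ_)))
    ≡⟨ ⨁-cong (λ w → trans (cong₂ _*_ (trans (sgn-· w σ) (*-comm (sgn w) (sgn σ)))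
         (𝟙-⇔ (A ∘ (σ ⟨$⟩ʳ_) ≗? B ∘ ((w · σ) ⟨$⟩ʳ_)) (A ≗? B ∘ (w ⟨$⟩ʳ_))
           (λ eq i → subst (λ j → A j ≡ B (w ⟨$⟩ʳ j)) (inverseʳ σ) (eq (σ ⟨$⟩ˡ i))) (λ eq i → eq (σ ⟨$⟩ʳ i))))
         (*-assoc (sgn σ) (sgn w) _)) ⟩
  ⨁ (permutations n) (λ w → sgn σ * (sgn w * 𝟙 (A ≗? B ∘ (w ⟨$⟩ʳ_))))
    ≡⟨ ⨁-*ˡ ⟩
  sgn σ * Alt A B ∎

Alt-swap : ∀ {i j : Fin n} → i ≢ j → ∀ A B → Alt (A ∘ (swap i j ⟨$⟩ʳ_)) B ≡ - Alt A B
Alt-swap {i = i} {j} i≢j A B = trans (Alt-permute (swap i j) A B) (trans (cong (_* Alt A B) (sgn-swap i≢j))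
  (lemma (Alt A B)))
  where
  opaque
    unfolding _+_
    lemma : ∀ x → - 1ℚ * x ≡ - x
    lemma = solve-∀ ℚ-ring

Alt-repeat : ∀ {i j : Fin n} → i ≢ j → ∀ A B → A i ≡ A j → Alt A B ≡ 0ℚ
Alt-repeat {i = i} {j} i≢j A B Ai≡Aj = p≡-p⇒p≡0 (trans
  (Alt-cong {A = A} {A ∘ (swap i j ⟨$⟩ʳ_)} {B} (λ k → sym (swap-elim i j A Ai≡Aj k)) (λ _ → refl))
  (Alt-swap i≢j A B))

Alt-comm : ∀ (A B : Fin n → ℤ) → Alt A B ≡ Alt B A
Alt-comm {n} A B = trans (sym (⨁-flip (Alt-summand-cong A B))) (⨁-cong (λ w → cong₂ _*_ (sgn-flip w)
  (𝟙-⇔ (A ≗? B ∘ (w ⟨$⟩ˡ_)) (B ≗? A ∘ (w ⟨$⟩ʳ_))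
    (λ eq i → sym (trans (eq (w ⟨$⟩ʳ i)) (cong B (inverseˡ w))))
    (λ eq i → sym (trans (eq (w ⟨$⟩ˡ i)) (cong A (inverseʳ w)))))))

Alt-zero : ∀ {A B : Fin n → ℤ} → (∀ w → ¬ (A ≗ B ∘ (w ⟨$⟩ʳ_))) → Alt A B ≡ 0ℚ
Alt-zero {n} {A} {B} A≢ = ⨁-zero (λ w → trans (cong (sgn w *_) (𝟙-no (A ≗? B ∘ (w ⟨$⟩ʳ_)) (A≢ w))) (zeroʳ (sgn w)))

Alt-self : ∀ {A : Fin n → ℤ} → (∀ {i j} → A i ≡ A j → i ≡ j) → Alt A A ≡ 1ℚ
Alt-self {n} {A} A-inj = begin
  Alt A A
    ≡⟨ ⨁-cong (λ w → trans (*-comm (sgn w) _) (cong (_* sgn w)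
         (𝟙-⇔ (A ≗? A ∘ (w ⟨$⟩ʳ_)) (w ≈ₚ? idₚ) (λ eq i → sym (A-inj (eq i))) (λ eq i → cong A (sym (eq i)))))) ⟩
  ⨁ (permutations n) (λ w → 𝟙 (w ≈ₚ? idₚ) * sgn w)
    ≡⟨ PermE.⨁-pick (λ {σ} {τ} → sgn-cong {σ = σ} {τ}) idₚ ⟩
  sgn (idₚ {n})
    ≡⟨ sgn-id {n} ⟩
  1ℚ ∎

-- The coefficient in the Cauchy determinant for arbitrary integer vectors. `Alt` vanishes unless A
-- and B are rearrangements of each other, so the test on A settles B as well.
G : (A B : Fin n → ℤ) → ℚ
G A B = 𝟙 (nonneg? A) * Alt A B

G-cong : ∀ {A A′ B B′ : Fin n → ℤ} → A ≗ A′ → B ≗ B′ → G A B ≡ G A′ B′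
G-cong {A = A} {A′} {B} {B′} A≗ B≗ = cong₂ _*_ (𝟙-⇔ (nonneg? A) (nonneg? A′) (λ p i → subst (0ℤ ℤ.≤_) (A≗ i) (p i))
  (λ p i → subst (0ℤ ℤ.≤_) (sym (A≗ i)) (p i))) (Alt-cong {A = A} {A′} {B} {B′} A≗ B≗)

total : (Fin n → ℤ) → ℚ
total {n} A = ⨁ (allFin n) (fromℤ ∘ A)

δ : Fin n → ℤ
δ i = ℤ.+ toℕ (opposite i)

opposite-injective : ∀ {i j : Fin n} → toℕ (opposite i) ≡ toℕ (opposite j) → i ≡ j
opposite-injective {i = i} {j} eq = trans (sym (Fin.opposite-involutive i)) (trans (cong opposite (Fin.toℕ-injective eq)) (Fin.opposite-involutive j))

δ-injective : ∀ {i j : Fin n} → δ i ≡ δ j → i ≡ j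
δ-injective = opposite-injective ∘ ℤ.+-injective

total-permute : ∀ (σ : Permutation′ n) A → total (A ∘ (σ ⟨$⟩ʳ_)) ≡ total A
total-permute σ A = ⨁-permute σ (fromℤ ∘ A)

-- Sorting applied to a single column of n cells, whose rows are numbered by `opposite` and hence by
-- the entries of δ.
repeat⊎δ≤ : ∀ (A : Fin n → ℤ) → (∀ i → 0ℤ ℤ.≤ A i) →
            (∃[ i ] ∃[ j ] (i ≢ j × A i ≡ A j)) ⊎ (∃[ q ] (∀ i → δ (q ⟨$⟩ʳ i) ℤ.≤ A i))
repeat⊎δ≤ {n} A A≥0 with Sorting.collision⊎sortedBelow (toℕ ∘ opposite) (λ _ → 0) (λ eq _ → opposite-injective eq) down-closed (λ i → ℤ.∣ A i ∣)
  where
  down-closed : ∀ (y : Fin n) {k} → k ℕ.< toℕ (opposite y) → ∃[ x ] (toℕ (opposite x) ≡ k × 0 ≡ 0)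
  down-closed y {k} k<y = opposite (Fin.fromℕ< k<n) , trans (cong toℕ (Fin.opposite-involutive (Fin.fromℕ< k<n))) (Fin.toℕ-fromℕ< k<n) , refl
    where
    k<n : k ℕ.< n
    k<n = ℕ.<-trans k<y (Fin.toℕ<n (opposite y))
... | inj₁ (i , j , i≢j , _ , eq) = inj₁ (i , j , i≢j , trans (sym (ℤ.0≤i⇒+∣i∣≡i (A≥0 i))) (trans (cong ℤ.+_ eq) (ℤ.0≤i⇒+∣i∣≡i (A≥0 j))))
... | inj₂ (q , _ , q≤) = inj₂ (q , λ i → subst (δ (q ⟨$⟩ʳ i) ℤ.≤_) (ℤ.0≤i⇒+∣i∣≡i (A≥0 i)) (ℤ.+≤+ (q≤ i)))

total-mono-≤ : ∀ {A B : Fin n → ℤ} → (∀ i → A i ℤ.≤ B i) → total A ℚ.≤ total B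
total-mono-≤ {n} A≤B = ⨁-mono-≤ (λ i → fromℤ-mono-≤ (A≤B i))

opaque
  unfolding _+_

  p≤q⇒0≤q-p : ∀ {p q} → p ℚ.≤ q → 0ℚ ℚ.≤ q + - p
  p≤q⇒0≤q-p {p} {q} p≤q = subst (ℚ._≤ q + - p) (-‿inverseʳ p) (ℚ.+-monoˡ-≤ (- p) p≤q)

  q-p≡0⇒p≡q : ∀ {p q} → q + - p ≡ 0ℚ → p ≡ q
  q-p≡0⇒p≡q {p} {q} eq = trans (sym (+-identityʳ p)) (trans (cong (p +_) (sym eq)) (lemma p q))
    where
    lemma : ∀ p q → p + (q + - p) ≡ q
    lemma = solve-∀ ℚ-ring

⨁-≤-≡ : ∀ {n} (f g : Fin n → ℚ) → (∀ i → f i ℚ.≤ g i) → ⨁ (allFin n) g ≡ ⨁ (allFin n) f → ∀ i → f i ≡ g i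
⨁-≤-≡ {n} f g f≤g eq i = q-p≡0⇒p≡q (FinE.⨁≡0⇒≡0 {f = λ i → g i + - f i} (cong (λ i → g i + - f i)) (λ i → p≤q⇒0≤q-p (f≤g i)) (begin
  ⨁ (allFin n) (λ i → g i + - f i)        ≡⟨ ⨁-+ ⟩
  ⨁ (allFin n) g + ⨁ (allFin n) (-_ ∘ f)  ≡⟨ cong₂ _+_ eq ⨁-neg ⟩
  ⨁ (allFin n) f + - ⨁ (allFin n) f       ≡⟨ -‿inverseʳ (⨁ (allFin n) f) ⟩
  0ℚ                                      ∎) i)

total-≤-≡ : ∀ {A B : Fin n → ℤ} → (∀ i → A i ℤ.≤ B i) → total B ≡ total A → A ≗ B
total-≤-≡ {A = A} {B} A≤B eq i = fromℤ-injective (⨁-≤-≡ (fromℤ ∘ A) (fromℤ ∘ B) (λ i → fromℤ-mono-≤ (A≤B i)) eq i)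

-- Distinct nonnegative integers sum to at least `total δ`. Below that total A has a negative entry,
-- excluded by the test in `G`, or a repeated one, for which the alternant vanishes.
G-degenerate : ∀ (A B : Fin n → ℤ) → ¬ (total (δ {n}) ℚ.≤ total A) → G A B ≡ 0ℚ
G-degenerate A B small with toSum (nonneg? A)
... | inj₂ ¬A≥0 = trans (cong (_* Alt A B) (𝟙-no (nonneg? A) ¬A≥0)) (zeroˡ (Alt A B))
... | inj₁ A≥0 with repeat⊎δ≤ A A≥0
...   | inj₁ (i , j , i≢j , eq) = trans (cong (𝟙 (nonneg? A) *_) (Alt-repeat i≢j A B eq)) (zeroʳ (𝟙 (nonneg? A)))
...   | inj₂ (q , δq≤A) = contradiction (subst (ℚ._≤ total A) (total-permute q δ) (total-mono-≤ δq≤A)) small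

-- The case of no points in `U≡G`, where `s A` and `s B` are coefficients of the Vandermonde
-- product. At the least total, A is a rearrangement `δ ∘ q`, and both sides equal
-- `sgn q * Alt δ B`, unless an entry is negative or repeated, and then both vanish.
G-minimal : ∀ (A B : Fin n → ℤ) → total A ≡ total (δ {n}) → Alt A δ * Alt B δ ≡ G A B
G-minimal {n} A B A≡δ with toSum (nonneg? A)
... | inj₂ ¬A≥0 = trans
  (trans (cong (_* Alt B δ) (Alt-zero {A = A} {δ} (λ w eq → ¬A≥0 (λ i → subst (0ℤ ℤ.≤_) (sym (eq i)) (ℤ.+≤+ ℕ.z≤n))))) (zeroˡ (Alt B δ)))
  (sym (trans (cong (_* Alt A B) (𝟙-no (nonneg? A) ¬A≥0)) (zeroˡ (Alt A B))))
... | inj₁ A≥0 with repeat⊎δ≤ A A≥0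
...   | inj₁ (i , j , i≢j , eq) = trans (trans (cong (_* Alt B δ) (Alt-repeat i≢j A δ eq)) (zeroˡ (Alt B δ)))
  (sym (trans (cong (𝟙 (nonneg? A) *_) (Alt-repeat i≢j A B eq)) (zeroʳ (𝟙 (nonneg? A)))))
...   | inj₂ (q , δq≤A) = begin
  Alt A δ * Alt B δ           ≡⟨ cong₂ _*_ (step δ) (Alt-comm B δ) ⟩
  sgn q * Alt δ δ * Alt δ B   ≡⟨ cong (λ x → sgn q * x * Alt δ B) (Alt-self {n} {δ} δ-injective) ⟩
  sgn q * 1ℚ * Alt δ B        ≡⟨ cong (_* Alt δ B) (*-identityʳ (sgn q)) ⟩
  sgn q * Alt δ B             ≡⟨ step B ⟨
  Alt A B                     ≡⟨ *-identityˡ (Alt A B) ⟨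
  1ℚ * Alt A B                ≡⟨ cong (_* Alt A B) (𝟙-yes (nonneg? A) A≥0) ⟨
  G A B                       ∎
  where
  A≗δq : A ≗ δ ∘ (q ⟨$⟩ʳ_)
  A≗δq i = sym (total-≤-≡ δq≤A (trans A≡δ (sym (total-permute q δ))) i)
  step : ∀ B → Alt A B ≡ sgn q * Alt δ B
  step B = trans (Alt-cong {A = A} {δ ∘ (q ⟨$⟩ʳ_)} {B} A≗δq (λ _ → refl)) (Alt-permute q δ B)

opaque

  e : Fin n → Fin n → ℤ
  e i j = if does (i Fin.≟ j) then 1ℤ else 0ℤ

  e-same : ∀ (i : Fin n) → e i i ≡ 1ℤ
  e-same i rewrite dec-true (i Fin.≟ i) refl = refl

  e-other : ∀ {i j : Fin n} → i ≢ j → e i j ≡ 0ℤ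
  e-other {i = i} {j} i≢j rewrite dec-false (i Fin.≟ j) i≢j = refl

e-permute : ∀ (σ : Permutation′ n) i j → e (σ ⟨$⟩ʳ i) (σ ⟨$⟩ʳ j) ≡ e i j
e-permute σ i j with i Fin.≟ j
... | yes refl = trans (e-same (σ ⟨$⟩ʳ i)) (sym (e-same i))
... | no  i≢j  = trans (e-other (i≢j ∘ ⟨$⟩ʳ-injective σ)) (sym (e-other i≢j))

infixl 10 _[_↓_] _[_↑_]

_[_↓_] _[_↑_] : (Fin n → ℤ) → Fin n → ℕ → (Fin n → ℤ)
(A [ i ↓ m ]) j = A j ℤ.- (ℤ.+ m) ℤ.* e i j
(A [ i ↑ m ]) j = A j ℤ.+ (ℤ.+ m) ℤ.* e i j

↓-same : ∀ (A : Fin n → ℤ) i m → (A [ i ↓ m ]) i ≡ A i ℤ.- (ℤ.+ m)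
↓-same A i m rewrite e-same i = cong (λ x → A i ℤ.- x) (ℤ.*-identityʳ (ℤ.+ m))

↓-other : ∀ (A : Fin n → ℤ) {i j} m → i ≢ j → (A [ i ↓ m ]) j ≡ A j
↓-other A {i} {j} m i≢j rewrite e-other i≢j | ℤ.*-zeroʳ (ℤ.+ m) = ℤ.+-identityʳ (A j)

↑-same : ∀ (A : Fin n → ℤ) i m → (A [ i ↑ m ]) i ≡ A i ℤ.+ (ℤ.+ m)
↑-same A i m rewrite e-same i = cong (λ x → A i ℤ.+ x) (ℤ.*-identityʳ (ℤ.+ m))

↑-other : ∀ (A : Fin n → ℤ) {i j} m → i ≢ j → (A [ i ↑ m ]) j ≡ A j
↑-other A {i} {j} m i≢j rewrite e-other i≢j | ℤ.*-zeroʳ (ℤ.+ m) = ℤ.+-identityʳ (A j)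

-- For a fixed w, lowering B at `w i` and raising A at i impose the same equation, so every change
-- of B can be transferred to A. The test for nonnegativity stays with the vector that has only been
-- lowered.
G-lowered : ∀ (A B : Fin n → ℤ) m →
  ⨁² n (λ c c′ → G (A [ c ↓ m ]) (B [ c′ ↓ m ])) ≡ ⨁² n (λ i i′ → 𝟙 (nonneg? (A [ i ↓ m ])) * Alt (A [ i ↓ m ] [ i′ ↑ m ]) B)
G-lowered {n} A B m = ⨁-cong (λ i → trans ⨁-*ˡ
  (trans (cong (𝟙 (nonneg? (A [ i ↓ m ])) *_) (inner (A [ i ↓ m ]))) (sym ⨁-*ˡ)))
  where
  inner : ∀ A → ⨁ (allFin n) (λ c → Alt A (B [ c ↓ m ])) ≡ ⨁ (allFin n) (λ i → Alt (A [ i ↑ m ]) B)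
  inner A = begin
    ⨁ (allFin n) (λ c → Alt A (B [ c ↓ m ]))
      ≡⟨ ⨁-swap ⟩
    ⨁ (permutations n) (λ w → ⨁ (allFin n) (λ c → sgn w * 𝟙 (A ≗? B [ c ↓ m ] ∘ (w ⟨$⟩ʳ_))))
      ≡⟨ ⨁-cong (λ w → ⨁-permute w (λ c → sgn w * 𝟙 (A ≗? B [ c ↓ m ] ∘ (w ⟨$⟩ʳ_)))) ⟨
    ⨁ (permutations n) (λ w → ⨁ (allFin n) (λ i → sgn w * 𝟙 (A ≗? B [ w ⟨$⟩ʳ i ↓ m ] ∘ (w ⟨$⟩ʳ_))))
      ≡⟨ ⨁-cong (λ w → ⨁-cong (λ i → cong (sgn w *_)
           (𝟙-⇔ (A ≗? B [ w ⟨$⟩ʳ i ↓ m ] ∘ (w ⟨$⟩ʳ_)) (A [ i ↑ m ] ≗? B ∘ (w ⟨$⟩ʳ_))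
             (λ eq j → trans (cong₂ ℤ._+_ (eq j) (cong (λ x → ℤ.+ m ℤ.* x) (sym (e-permute w i j)))) (cancel (B (w ⟨$⟩ʳ j)) _))
             (λ eq j → trans (sym (cancel′ (A j) _)) (cong₂ ℤ._-_ (eq j) (cong (λ x → ℤ.+ m ℤ.* x) (sym (e-permute w i j)))))))) ⟩
    ⨁ (permutations n) (λ w → ⨁ (allFin n) (λ i → sgn w * 𝟙 (A [ i ↑ m ] ≗? B ∘ (w ⟨$⟩ʳ_))))
      ≡⟨ ⨁-swap ⟩
    ⨁ (allFin n) (λ i → Alt (A [ i ↑ m ]) B) ∎
    where
    cancel : ∀ b x → b ℤ.- x ℤ.+ x ≡ b
    cancel = ℤ-solve
    cancel′ : ∀ b x → b ℤ.+ x ℤ.- x ≡ b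
    cancel′ = ℤ-solve


pos-∸ : ∀ {m n} → n ℕ.≤ m → ℤ.+ (m ℕ.∸ n) ≡ ℤ.+ m ℤ.- ℤ.+ n
pos-∸ {m} {n} n≤m = trans (sym (ℤ.⊖-≥ n≤m)) (sym (ℤ.m-n≡m⊖n m n))

δ-complement : ∀ (i : Fin n) → fromℕ (toℕ i) + fromℤ (δ i) + 1ℚ ≡ fromℕ n
δ-complement {n} i = begin
  fromℕ (toℕ i) + fromℕ (toℕ (opposite i)) + 1ℚ  ≡⟨ cong (_+ 1ℚ) (fromℕ-+ (toℕ i) (toℕ (opposite i))) ⟨
  fromℕ (toℕ i ℕ.+ toℕ (opposite i)) + 1ℚ        ≡⟨ fromℕ-+ (toℕ i ℕ.+ toℕ (opposite i)) 1 ⟨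
  fromℕ (toℕ i ℕ.+ toℕ (opposite i) ℕ.+ 1)       ≡⟨ cong fromℕ (trans (ℕ.+-comm _ 1) (trans (cong (λ k → suc (toℕ i) ℕ.+ k) (Fin.opposite-prop i)) (ℕ.m+[n∸m]≡n (Fin.toℕ<n i)))) ⟩
  fromℕ n                                        ∎

total-δ : ∀ n → total (δ {n}) + total (δ {n}) + fromℕ n ≡ fromℕ n * fromℕ n
total-δ n = begin
  total (δ {n}) + total (δ {n}) + fromℕ n
    ≡⟨ cong₂ (λ x y → x + total (δ {n}) + y) (⨁-permute (reverse {n}) (fromℤ ∘ δ)) (trans ⨁-allFin-const (*-identityʳ (fromℕ n))) ⟨
  ⨁ (allFin n) (λ i → fromℤ (δ (opposite i))) + total (δ {n}) + ⨁ (allFin n) (λ _ → 1ℚ)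
    ≡⟨ trans ⨁-+ (cong (_+ ⨁ (allFin n) (λ _ → 1ℚ)) ⨁-+) ⟨
  ⨁ (allFin n) (λ i → fromℤ (δ (opposite i)) + fromℤ (δ i) + 1ℚ)
    ≡⟨ ⨁-cong (λ i → trans (cong (λ j → fromℕ (toℕ j) + fromℤ (δ i) + 1ℚ) (Fin.opposite-involutive i)) (δ-complement i)) ⟩
  ⨁ (allFin n) (λ i → fromℕ n)
    ≡⟨ ⨁-allFin-const ⟩
  fromℕ n * fromℕ n ∎

-- The vectors C r, for 0 ≤ r ≤ a i + a i′, are the nonnegative points of the
-- line through A in the direction of e i - e i′. Exchanging the coordinates i
-- and i′ reverses the line, so the alternants along it sum to 0.
module _ {n} (a : Fin n → ℕ) (B : Fin n → ℤ) where

  private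
    A : Fin n → ℤ
    A i = ℤ.+ a i

  nonneg-↓⇒ : ∀ i k → (∀ j → 0ℤ ℤ.≤ (A [ i ↓ suc k ]) j) → k ℕ.< a i
  nonneg-↓⇒ i k ≥0 = ℤ.drop‿+≤+ (ℤ.0≤i-j⇒j≤i (subst (0ℤ ℤ.≤_) (↓-same A i (suc k)) (≥0 i)))

  nonneg-↓⇐ : ∀ i k → k ℕ.< a i → (∀ j → 0ℤ ℤ.≤ (A [ i ↓ suc k ]) j)
  nonneg-↓⇐ i k k<a j with i Fin.≟ j
  ... | yes refl = subst (0ℤ ℤ.≤_) (sym (↓-same A i (suc k))) (ℤ.i≤j⇒0≤j-i (ℤ.+≤+ k<a))
  ... | no  i≢j  = subst (0ℤ ℤ.≤_) (sym (↓-other A (suc k) i≢j)) (ℤ.+≤+ ℕ.z≤n)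

  ⨁<-nonneg : ∀ {M} i φ → a i ℕ.≤ M → ⨁< M (λ k → 𝟙 (nonneg? (A [ i ↓ suc k ])) * φ k) ≡ ⨁< (a i) φ
  ⨁<-nonneg i φ a≤M = ⨁<-𝟙 φ (λ k → nonneg? (A [ i ↓ suc k ])) a≤M (nonneg-↓⇒ i) (nonneg-↓⇐ i)

  moved : Fin n → Fin n → ℕ → ℚ
  moved i i′ m = Alt (A [ i ↓ m ] [ i′ ↑ m ]) B

  moved-same : ∀ i m → moved i i m ≡ Alt A B
  moved-same i m = Alt-cong {A = A [ i ↓ m ] [ i ↑ m ]} {A} {B} (λ j → lemma (A j) (ℤ.+ m ℤ.* e i j)) (λ _ → refl)
    where
    lemma : ∀ x y → x ℤ.- y ℤ.+ y ≡ x
    lemma = ℤ-solve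

  moved-sum : ∀ {i i′} → i ≢ i′ →
    ⨁< (a i) (λ k → moved i i′ (suc k)) + ⨁< (a i′) (λ k → moved i′ i (suc k)) ≡ - Alt A B
  moved-sum {i} {i′} i≢i′ = solve-for (begin
    ⨁< (a i) (λ k → moved i i′ (suc k)) + (Alt A B + ⨁< (a i′) (λ k → moved i′ i (suc k)))
      ≡⟨ cong₂ _+_ (trans (⨁<-reverse (a i) b) (⨁<-cong (a i) (λ k k<a → Alt-cong {B = B} (C-below k<a) (λ _ → refl))))
                   (cong₂ _+_ (Alt-cong {B = B} C-at (λ _ → refl)) (⨁<-cong (a i′) (λ k _ → Alt-cong {B = B} (C-above k) (λ _ → refl)))) ⟨
    ⨁< (a i) b + (b (a i ℕ.+ 0) + ⨁< (a i′) (λ k → b (a i ℕ.+ suc k)))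
      ≡⟨ cong (⨁< (a i) b +_) (⨁<-suc (a i′) (λ k → b (a i ℕ.+ k))) ⟨
    ⨁< (a i) b + ⨁< (suc (a i′)) (λ k → b (a i ℕ.+ k))
      ≡⟨ ⨁<-split (a i) (suc (a i′)) b ⟨
    ⨁< (a i ℕ.+ suc (a i′)) b
      ≡⟨ cong (λ N → ⨁< N b) (ℕ.+-suc (a i) (a i′)) ⟩
    ⨁< (suc (a i ℕ.+ a i′)) b
      ≡⟨ ⨁<-antisymmetric (suc (a i ℕ.+ a i′)) b (λ k k<N → trans (Alt-cong {B = B} (C-reverse (ℕ.≤-pred k<N)) (λ _ → refl)) (Alt-swap i≢i′ (C k) B)) ⟩
    0ℚ ∎)
    where
    opaque
      unfolding _+_
      solve-for : ∀ {x y z} → x + (y + z) ≡ 0ℚ → x + z ≡ - y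
      solve-for {x} {y} {z} eq = trans (lemma x y z) (trans (cong (_+ - y) eq) (+-identityˡ (- y)))
        where
        lemma : ∀ x y z → x + z ≡ x + (y + z) + - y
        lemma = solve-∀ ℚ-ring
    -- The parameter r is the value of coordinate i: `r = a i` gives A itself, smaller r moves units
    -- from i to i′, larger r from i′ to i.
    C : ℕ → Fin n → ℤ
    C r j = A j ℤ.+ (ℤ.+ r ℤ.- A i) ℤ.* (e i j ℤ.- e i′ j)
    b : ℕ → ℚ
    b r = Alt (C r) B
    C-below : ∀ {k} → k ℕ.< a i → C (a i ℕ.∸ suc k) ≗ A [ i ↓ suc k ] [ i′ ↑ suc k ]
    C-below {k} k<a j rewrite pos-∸ k<a = lemma (A j) (A i) (ℤ.+ suc k) (e i j) (e i′ j)
      where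
      lemma : ∀ x y k u v → x ℤ.+ (y ℤ.- k ℤ.- y) ℤ.* (u ℤ.- v) ≡ x ℤ.- k ℤ.* u ℤ.+ k ℤ.* v
      lemma = ℤ-solve
    C-at : C (a i ℕ.+ 0) ≗ A
    C-at j rewrite ℕ.+-identityʳ (a i) = lemma (A j) (A i) (e i j) (e i′ j)
      where
      lemma : ∀ x y u v → x ℤ.+ (y ℤ.- y) ℤ.* (u ℤ.- v) ≡ x
      lemma = ℤ-solve
    C-above : ∀ k → C (a i ℕ.+ suc k) ≗ A [ i′ ↓ suc k ] [ i ↑ suc k ]
    C-above k j rewrite ℤ.pos-+ (a i) (suc k) = lemma (A j) (A i) (ℤ.+ suc k) (e i j) (e i′ j)
      where
      lemma : ∀ x y k u v → x ℤ.+ (y ℤ.+ k ℤ.- y) ℤ.* (u ℤ.- v) ≡ x ℤ.- k ℤ.* v ℤ.+ k ℤ.* u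
      lemma = ℤ-solve
    C-reverse : ∀ {r} → r ℕ.≤ a i ℕ.+ a i′ → C (a i ℕ.+ a i′ ℕ.∸ r) ≗ C r ∘ (swap i i′ ⟨$⟩ʳ_)
    C-reverse {r} r≤N j with which i i′ j
    ... | inj₁ refl rewrite swap-fst i i′ | e-same i | e-other i≢i′ | e-other (i≢i′ ∘ sym) | e-same i′
                          | pos-∸ r≤N | ℤ.pos-+ (a i) (a i′) = lemma (A i) (A i′) (ℤ.+ r)
      where
      lemma : ∀ x y r → x ℤ.+ (x ℤ.+ y ℤ.- r ℤ.- x) ℤ.* 1ℤ ≡ y ℤ.+ (r ℤ.- x) ℤ.* (0ℤ ℤ.- 1ℤ)
      lemma = ℤ-solve
    ... | inj₂ (inj₁ refl) rewrite swap-snd i i′ | e-same i | e-other i≢i′ | e-other (i≢i′ ∘ sym) | e-same i′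
                                 | pos-∸ r≤N | ℤ.pos-+ (a i) (a i′) = lemma (A i) (A i′) (ℤ.+ r)
      where
      lemma : ∀ x y r → y ℤ.+ (x ℤ.+ y ℤ.- r ℤ.- x) ℤ.* (0ℤ ℤ.- 1ℤ) ≡ x ℤ.+ (r ℤ.- x) ℤ.* 1ℤ
      lemma = ℤ-solve
    ... | inj₂ (inj₂ (j≢i , j≢i′)) rewrite swap-other i i′ j≢i j≢i′ | e-other (j≢i ∘ sym) | e-other (j≢i′ ∘ sym)
      = cong (λ x → A j ℤ.+ x) (trans (ℤ.*-zeroʳ (ℤ.+ (a i ℕ.+ a i′ ℕ.∸ r) ℤ.- A i)) (sym (ℤ.*-zeroʳ (ℤ.+ r ℤ.- A i))))

  -- Adding the transposed sum pairs (i , i′) with (i′ , i). An off-diagonal pair gives `- Alt A B`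
  -- by `moved-sum`; a diagonal one gives `2 a i` times `Alt A B`, written as `2 a i + 1` less 1 so
  -- that all n² pairs share the term `- Alt A B`. By `total-δ`, n² - n is twice `total δ`.
  moved-total : ⨁² n (λ i i′ → ⨁< (a i) (λ k → moved i i′ (suc k))) ≡ (total A + - total (δ {n})) * Alt A B
  moved-total = 2*-cancel (begin
    ⨁² n D + ⨁² n D
      ≡⟨ cong (⨁² n D +_) ⨁²-swap ⟩
    ⨁² n D + ⨁² n (λ i i′ → D i′ i)
      ≡⟨ ⨁²-+ ⟨
    ⨁² n (λ i i′ → D i i′ + D i′ i)
      ≡⟨ ⨁²-cong pair ⟩
    ⨁² n (λ i i′ → 𝟙 (i′ Fin.≟ i) * ((fromℕ (a i) + fromℕ (a i) + 1ℚ) * Alt A B) + - Alt A B)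
      ≡⟨ ⨁-cong (λ i → trans ⨁-+ (cong₂ _+_ (⨁-pick-Fin (λ _ → (fromℕ (a i) + fromℕ (a i) + 1ℚ) * Alt A B) i) ⨁-allFin-const)) ⟩
    ⨁ (allFin n) (λ i → (fromℕ (a i) + fromℕ (a i) + 1ℚ) * Alt A B + fromℕ n * - Alt A B)
      ≡⟨ trans ⨁-+ (cong₂ _+_ ⨁-*ʳ ⨁-allFin-const) ⟩
    ⨁ (allFin n) (λ i → fromℕ (a i) + fromℕ (a i) + 1ℚ) * Alt A B + fromℕ n * (fromℕ n * - Alt A B)
      ≡⟨ cong₂ (λ x y → x * Alt A B + y) (trans ⨁-+ (cong₂ _+_ ⨁-+ (trans ⨁-allFin-const (*-identityʳ (fromℕ n)))))
               (trans (sym (*-assoc (fromℕ n) (fromℕ n) (- Alt A B))) (cong (_* - Alt A B) (sym (total-δ n)))) ⟩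
    (total A + total A + fromℕ n) * Alt A B + (total (δ {n}) + total (δ {n}) + fromℕ n) * - Alt A B
      ≡⟨ lemma (total A) (total (δ {n})) (fromℕ n) (Alt A B) ⟩
    (total A + - total (δ {n})) * Alt A B + (total A + - total (δ {n})) * Alt A B ∎)
    where
    D : Fin n → Fin n → ℚ
    D i i′ = ⨁< (a i) (λ k → moved i i′ (suc k))
    D-same : ∀ i → D i i ≡ fromℕ (a i) * Alt A B
    D-same i = trans (⨁<-cong (a i) (λ k _ → moved-same i (suc k))) ⨁-allFin-const
    opaque
      unfolding _+_
      lemma : ∀ t s n x → (t + t + n) * x + (s + s + n) * - x ≡ (t + - s) * x + (t + - s) * x
      lemma = solve-∀ ℚ-ring
      diagonal : ∀ p x → p * x + p * x ≡ 1ℚ * ((p + p + 1ℚ) * x) + - x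
      diagonal = solve-∀ ℚ-ring
      off-diagonal : ∀ y x → - x ≡ 0ℚ * y + - x
      off-diagonal = solve-∀ ℚ-ring
    pair : ∀ i i′ → D i i′ + D i′ i ≡ 𝟙 (i′ Fin.≟ i) * ((fromℕ (a i) + fromℕ (a i) + 1ℚ) * Alt A B) + - Alt A B
    pair i i′ with toSum (i′ Fin.≟ i)
    ... | inj₁ refl rewrite 𝟙-yes (i Fin.≟ i) refl = trans (cong₂ _+_ (D-same i) (D-same i)) (diagonal (fromℕ (a i)) (Alt A B))
    ... | inj₂ i′≢i rewrite 𝟙-no (i′ Fin.≟ i) i′≢i = trans (moved-sum (i′≢i ∘ sym)) (off-diagonal _ (Alt A B))

⨁²-*ˡ : ∀ {c} {f : Fin n → Fin n → ℚ} → ⨁² n (λ i j → c * f i j) ≡ c * ⨁² n f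
⨁²-*ˡ = trans (⨁-cong (λ i → ⨁-*ˡ)) ⨁-*ˡ

⨁-⨁² : ∀ {xs : List X} {f : X → Fin n → Fin n → ℚ} → ⨁ xs (λ x → ⨁² n (f x)) ≡ ⨁² n (λ i j → ⨁ xs (λ x → f x i j))
⨁-⨁² = trans ⨁-swap (⨁-cong (λ i → ⨁-swap))

-- Euler's identity for the Cauchy determinant det (1 / (1 - xᵢ yⱼ)).
G-euler : ∀ (A B : Fin n → ℤ) {M} → (∀ i → A i ℤ.≤ ℤ.+ M) →
  ⨁< M (λ k → ⨁² n (λ c c′ → G (A [ c ↓ suc k ]) (B [ c′ ↓ suc k ]))) ≡ (total A + - total (δ {n})) * G A B
G-euler {n} A B {M} A≤M with toSum (nonneg? A)
... | inj₁ A≥0 = begin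
  ⨁< M (λ k → ⨁² n (λ c c′ → G (A [ c ↓ suc k ]) (B [ c′ ↓ suc k ])))
    ≡⟨ ⨁<-cong M (λ k _ → trans (⨁²-cong (λ c c′ → G-cong {B = B [ c′ ↓ suc k ]} (λ j → cong (λ x → x ℤ.- ℤ.+ suc k ℤ.* e c j) (A≗a j)) (λ _ → refl)))
         (G-lowered A′ B (suc k))) ⟩
  ⨁< M (λ k → ⨁² n (λ i i′ → 𝟙 (nonneg? (A′ [ i ↓ suc k ])) * moved a B i i′ (suc k)))
    ≡⟨ ⨁-⨁² ⟩
  ⨁² n (λ i i′ → ⨁< M (λ k → 𝟙 (nonneg? (A′ [ i ↓ suc k ])) * moved a B i i′ (suc k)))
    ≡⟨ ⨁²-cong (λ i i′ → ⨁<-nonneg a B i (λ k → moved a B i i′ (suc k)) (ℤ.drop‿+≤+ (subst (ℤ._≤ ℤ.+ M) (A≗a i) (A≤M i)))) ⟩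
  ⨁² n (λ i i′ → ⨁< (a i) (λ k → moved a B i i′ (suc k)))
    ≡⟨ moved-total a B ⟩
  (total A′ + - total (δ {n})) * Alt A′ B
    ≡⟨ cong₂ (λ x y → (x + - total (δ {n})) * y) (⨁-cong (λ i → cong fromℤ (sym (A≗a i))))
         (trans (Alt-cong {B = B} (λ i → sym (A≗a i)) (λ _ → refl)) (trans (sym (*-identityˡ (Alt A B))) (cong (_* Alt A B) (sym (𝟙-yes (nonneg? A) A≥0))))) ⟩
  (total A + - total (δ {n})) * G A B ∎
  where
  a : Fin n → ℕ
  a i = ℤ.∣ A i ∣
  A′ : Fin n → ℤ
  A′ i = ℤ.+ a i
  A≗a : A ≗ A′
  A≗a i = sym (ℤ.0≤i⇒+∣i∣≡i (A≥0 i))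
... | inj₂ ¬A≥0 = trans
  (⨁-zero (λ k → ⨁-zero (λ c → ⨁-zero (λ c′ → trans
    (cong (_* Alt (A [ c ↓ suc (toℕ k) ]) (B [ c′ ↓ suc (toℕ k) ])) (𝟙-no (nonneg? (A [ c ↓ suc (toℕ k) ])) (λ ≥0 → ¬A≥0 (raise c (toℕ k) ≥0))))
    (zeroˡ _)))))
  (sym (trans (cong (λ x → (total A + - total (δ {n})) * (x * Alt A B)) (𝟙-no (nonneg? A) ¬A≥0)) (trans (cong ((total A + - total (δ {n})) *_) (zeroˡ (Alt A B))) (zeroʳ _))))
  where
  raise : ∀ c k → (∀ j → 0ℤ ℤ.≤ (A [ c ↓ suc k ]) j) → ∀ j → 0ℤ ℤ.≤ A j
  raise c k ≥0 j with c Fin.≟ j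
  ... | yes refl = ℤ.≤-trans (ℤ.+≤+ ℕ.z≤n) (ℤ.0≤i-j⇒j≤i {A c} {ℤ.+ suc k} (subst (0ℤ ℤ.≤_) (↓-same A c (suc k)) (≥0 c)))
  ... | no  c≢j  = subst (0ℤ ℤ.≤_) (↓-other A (suc k) c≢j) (≥0 j)

module _ {n} (x : Fin n → ℕ) (x-injective : ∀ {i j} → x i ≡ x j → i ≡ j) where

  private
    x⁺ : Fin n → ℤ
    x⁺ i = ℤ.+ x i

    x⁺-injective : ∀ {i j} → x⁺ i ≡ x⁺ j → i ≡ j
    x⁺-injective = x-injective ∘ ℤ.+-injective

  -- Moving m units from i to i′ leaves a rearrangement of the distinct values x only if nothing
  -- moves, with sign 1, or if the two values are exchanged, with sign -1. The exchanges later
  -- cancel the m for which `x i - m` is already an exponent.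
  moved-distinct : ∀ i i′ k → moved x x⁺ i i′ (suc k) ≡ 𝟙 (i′ Fin.≟ i) + - 𝟙 (x i ℕ.≟ x i′ ℕ.+ suc k)
  moved-distinct i i′ k with toSum (i′ Fin.≟ i) | toSum (x i ℕ.≟ x i′ ℕ.+ suc k)
  ... | inj₁ refl | inj₁ eq = contradiction (sym eq) (ℕ.m+1+n≢m (x i))
  ... | inj₁ refl | inj₂ x≢ rewrite 𝟙-yes (i Fin.≟ i) refl | 𝟙-no (x i ℕ.≟ x i ℕ.+ suc k) x≢ =
    trans (moved-same x x⁺ i (suc k)) (trans (Alt-self {A = x⁺} x⁺-injective) lemma)
    where
    opaque
      unfolding _+_
      lemma : 1ℚ ≡ 1ℚ + - 0ℚ
      lemma = refl
  ... | inj₂ i′≢i | inj₁ eq rewrite 𝟙-no (i′ Fin.≟ i) i′≢i | 𝟙-yes (x i ℕ.≟ x i′ ℕ.+ suc k) eq =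
    trans (Alt-cong {B = x⁺} exchanged (λ _ → refl)) (trans (Alt-swap (i′≢i ∘ sym) x⁺ x⁺) (trans (cong -_ (Alt-self {A = x⁺} x⁺-injective)) lemma))
    where
    opaque
      unfolding _+_
      lemma : - 1ℚ ≡ 0ℚ + - 1ℚ
      lemma = refl
    x⁺≡ : x⁺ i ≡ x⁺ i′ ℤ.+ ℤ.+ suc k
    x⁺≡ = trans (cong ℤ.+_ eq) (ℤ.pos-+ (x i′) (suc k))
    exchanged : x⁺ [ i ↓ suc k ] [ i′ ↑ suc k ] ≗ x⁺ ∘ (swap i i′ ⟨$⟩ʳ_)
    exchanged j with which i i′ j
    ... | inj₁ refl rewrite swap-fst i i′ = trans (↑-other (x⁺ [ i ↓ suc k ]) (suc k) i′≢i) (trans (↓-same x⁺ i (suc k))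
      (trans (cong (λ z → z ℤ.- ℤ.+ suc k) x⁺≡) (cancel (x⁺ i′) (ℤ.+ suc k))))
      where
      cancel : ∀ p q → p ℤ.+ q ℤ.- q ≡ p
      cancel = ℤ-solve
    ... | inj₂ (inj₁ refl) rewrite swap-snd i i′ = trans (↑-same (x⁺ [ i ↓ suc k ]) i′ (suc k)) (trans (cong (λ z → z ℤ.+ ℤ.+ suc k) (↓-other x⁺ (suc k) (i′≢i ∘ sym))) (sym x⁺≡))
    ... | inj₂ (inj₂ (j≢i , j≢i′)) rewrite swap-other i i′ j≢i j≢i′ = trans (↑-other (x⁺ [ i ↓ suc k ]) (suc k) (j≢i′ ∘ sym)) (↓-other x⁺ (suc k) (j≢i ∘ sym))
  ... | inj₂ i′≢i | inj₂ x≢ rewrite 𝟙-no (i′ Fin.≟ i) i′≢i | 𝟙-no (x i ℕ.≟ x i′ ℕ.+ suc k) x≢ =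
    trans (Alt-zero {B = x⁺} impossible) lemma
    where
    opaque
      unfolding _+_
      lemma : 0ℚ ≡ 0ℚ + - 0ℚ
      lemma = refl
    raised : ∀ w → x⁺ [ i ↓ suc k ] [ i′ ↑ suc k ] ≗ x⁺ ∘ (w ⟨$⟩ʳ_) → x⁺ i ≡ x⁺ (w ⟨$⟩ʳ i) ℤ.+ ℤ.+ suc k
    raised w eq = trans (sym (cancel (x⁺ i) (ℤ.+ suc k))) (cong (λ y → y ℤ.+ ℤ.+ suc k)
      (trans (sym (trans (↑-other (x⁺ [ i ↓ suc k ]) (suc k) i′≢i) (↓-same x⁺ i (suc k)))) (eq i)))
      where
      cancel : ∀ p q → p ℤ.- q ℤ.+ q ≡ p
      cancel = ℤ-solve
    raised-to : ∀ w → x⁺ [ i ↓ suc k ] [ i′ ↑ suc k ] ≗ x⁺ ∘ (w ⟨$⟩ʳ_) → ∀ {l} → w ⟨$⟩ʳ i ≡ l → x i ≡ x l ℕ.+ suc k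
    raised-to w eq refl = ℤ.+-injective (trans (raised w eq) (sym (ℤ.pos-+ (x (w ⟨$⟩ʳ i)) (suc k))))
    impossible : ∀ w → ¬ (x⁺ [ i ↓ suc k ] [ i′ ↑ suc k ] ≗ x⁺ ∘ (w ⟨$⟩ʳ_))
    impossible w eq with which i i′ (w ⟨$⟩ʳ i)
    ... | inj₁ wi≡i = ℕ.m+1+n≢m (x i) (sym (raised-to w eq wi≡i))
    ... | inj₂ (inj₁ wi≡i′) = x≢ (raised-to w eq wi≡i′)
    -- The index `w i` is not touched by the move, so w fixes it by injectivity of x, and
    -- injectivity of w then gives `w i = i`.
    ... | inj₂ (inj₂ (wi≢i , wi≢i′)) = wi≢i (sym (⟨$⟩ʳ-injective w (x⁺-injective (begin
      x⁺ (w ⟨$⟩ʳ i)                                        ≡⟨ ↓-other x⁺ (suc k) (wi≢i ∘ sym) ⟨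
      (x⁺ [ i ↓ suc k ]) (w ⟨$⟩ʳ i)                        ≡⟨ ↑-other (x⁺ [ i ↓ suc k ]) (suc k) (wi≢i′ ∘ sym) ⟨
      (x⁺ [ i ↓ suc k ] [ i′ ↑ suc k ]) (w ⟨$⟩ʳ i)         ≡⟨ eq (w ⟨$⟩ʳ i) ⟩
      x⁺ (w ⟨$⟩ʳ (w ⟨$⟩ʳ i))                               ∎))))

  G-distinct : ∀ (F : ℕ → ℚ) {M} → (∀ i → x i ℕ.≤ M) →
    ⨁< M (λ k → F k * ⨁² n (λ c c′ → G (x⁺ [ c ↓ suc k ]) (x⁺ [ c′ ↓ suc k ])))
    ≡ ⨁ (allFin n) (λ i → ⨁< (x i) F) + - ⨁² n (λ i i′ → ⨁< (x i) (λ k → 𝟙 (x i ℕ.≟ x i′ ℕ.+ suc k) * F k))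
  G-distinct F {M} x≤M = begin
    ⨁< M (λ k → F k * ⨁² n (λ c c′ → G (x⁺ [ c ↓ suc k ]) (x⁺ [ c′ ↓ suc k ])))
      ≡⟨ ⨁<-cong M (λ k _ → trans (cong (F k *_) (G-lowered x⁺ x⁺ (suc k))) (trans (sym ⨁²-*ˡ)
           (⨁²-cong (λ i i′ → commute (F k) (𝟙 (nonneg? (x⁺ [ i ↓ suc k ]))) (moved x x⁺ i i′ (suc k)))))) ⟩
    ⨁< M (λ k → ⨁² n (λ i i′ → 𝟙 (nonneg? (x⁺ [ i ↓ suc k ])) * (moved x x⁺ i i′ (suc k) * F k)))
      ≡⟨ ⨁-⨁² ⟩
    ⨁² n (λ i i′ → ⨁< M (λ k → 𝟙 (nonneg? (x⁺ [ i ↓ suc k ])) * (moved x x⁺ i i′ (suc k) * F k)))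
      ≡⟨ ⨁²-cong (λ i i′ → trans (⨁<-nonneg x x⁺ i (λ k → moved x x⁺ i i′ (suc k) * F k) (x≤M i))
           (trans (⨁<-cong (x i) (λ k _ → trans (cong (_* F k) (moved-distinct i i′ k)) (expand (𝟙 (i′ Fin.≟ i)) (𝟙 (x i ℕ.≟ x i′ ℕ.+ suc k)) (F k))))
             (trans ⨁-+ (cong₂ _+_ ⨁-*ˡ ⨁-neg)))) ⟩
    ⨁² n (λ i i′ → 𝟙 (i′ Fin.≟ i) * ⨁< (x i) F + - ⨁< (x i) (λ k → 𝟙 (x i ℕ.≟ x i′ ℕ.+ suc k) * F k))
      ≡⟨ ⨁²-+ ⟩
    ⨁² n (λ i i′ → 𝟙 (i′ Fin.≟ i) * ⨁< (x i) F) + ⨁² n (λ i i′ → - ⨁< (x i) (λ k → 𝟙 (x i ℕ.≟ x i′ ℕ.+ suc k) * F k))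
      ≡⟨ cong₂ _+_ (⨁-cong (λ i → ⨁-pick-Fin (λ _ → ⨁< (x i) F) i)) (trans (⨁-cong (λ i → ⨁-neg)) ⨁-neg) ⟩
    ⨁ (allFin n) (λ i → ⨁< (x i) F) + - ⨁² n (λ i i′ → ⨁< (x i) (λ k → 𝟙 (x i ℕ.≟ x i′ ℕ.+ suc k) * F k)) ∎
    where
    opaque
      unfolding _+_
      commute : ∀ f p q → f * (p * q) ≡ p * (q * f)
      commute = solve-∀ ℚ-ring
      expand : ∀ p q f → (p + - q) * f ≡ p * f + - (q * f)
      expand = solve-∀ ℚ-ring

iterate-suc : ∀ {A : Set} (f : A → A) x k → iterate f x (suc k) ≡ f (iterate f x k)
iterate-suc f x zero    = refl
iterate-suc f x (suc k) = iterate-suc f (f x) k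

iterate-+ : ∀ {A : Set} (f : A → A) x j k → iterate f x (j ℕ.+ k) ≡ iterate f (iterate f x j) k
iterate-+ f x zero    k = refl
iterate-+ f x (suc j) k = iterate-+ f (f x) j k

-- Cycles

module _ {d} (σ : Permutation′ d) where

  -- The exponent is unrestricted, so that exponents can be added; `period` brings them back below
  -- d.
  Orbit : Fin d → Fin d → Set
  Orbit i j = ∃[ k ] iterate (σ ⟨$⟩ʳ_) i k ≡ j

  iterate-injective : ∀ k {i j} → iterate (σ ⟨$⟩ʳ_) i k ≡ iterate (σ ⟨$⟩ʳ_) j k → i ≡ j
  iterate-injective zero    eq = eq
  iterate-injective (suc k) eq = ⟨$⟩ʳ-injective σ (iterate-injective k eq)

  -- Among the iterates of i with exponents 0 to d two coincide, and injectivity cancels the smaller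
  -- exponent. The return time found may be a multiple of the least one; being at most d, it keeps
  -- all remainders modulo it below d.
  period : ∀ i → ∃[ r ] (suc r ℕ.≤ d × iterate (σ ⟨$⟩ʳ_) i (suc r) ≡ i)
  period i with a , b , a<b , eq ← Fin.pigeonhole (ℕ.n<1+n d) (λ k → iterate (σ ⟨$⟩ʳ_) i (toℕ k)) =
    r , subst (ℕ._≤ d) r-def (ℕ.≤-trans (ℕ.m∸n≤m (toℕ b) (toℕ a)) (ℕ.≤-pred (Fin.toℕ<n b))) ,
    sym (iterate-injective (toℕ a) (trans eq (trans (cong (iterate (σ ⟨$⟩ʳ_) i) b≡) (iterate-+ (σ ⟨$⟩ʳ_) i (suc r) (toℕ a)))))
    where
    r = toℕ b ℕ.∸ suc (toℕ a)
    r-def : toℕ b ℕ.∸ toℕ a ≡ suc r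
    r-def = ℕ.+-∸-assoc 1 {toℕ b} {suc (toℕ a)} a<b
    b≡ : toℕ b ≡ suc r ℕ.+ toℕ a
    b≡ = trans (sym (ℕ.m∸n+n≡m (ℕ.<⇒≤ a<b))) (cong (λ k → k ℕ.+ toℕ a) r-def)

  iterate-period : ∀ {i} r q → iterate (σ ⟨$⟩ʳ_) i r ≡ i → iterate (σ ⟨$⟩ʳ_) i (q ℕ.* r) ≡ i
  iterate-period r zero    eq = refl
  iterate-period {i} r (suc q) eq = trans (iterate-+ (σ ⟨$⟩ʳ_) i r (q ℕ.* r))
    (trans (cong (λ x → iterate (σ ⟨$⟩ʳ_) x (q ℕ.* r)) eq) (iterate-period r q eq))

  reduced : ∀ {i j} r → iterate (σ ⟨$⟩ʳ_) i (suc r) ≡ i → Orbit i j → ∃[ k ] (k ℕ.< suc r × iterate (σ ⟨$⟩ʳ_) i k ≡ j)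
  reduced {i} {j} r per (k , eq) = k ℕ.% suc r , ℕ.m%n<n k (suc r) , (begin
    iterate f i (k ℕ.% suc r)                                          ≡⟨ cong (λ x → iterate f x (k ℕ.% suc r)) (iterate-period (suc r) (k ℕ./ suc r) per) ⟨
    iterate f (iterate f i (k ℕ./ suc r ℕ.* suc r)) (k ℕ.% suc r)      ≡⟨ iterate-+ f i (k ℕ./ suc r ℕ.* suc r) (k ℕ.% suc r) ⟨
    iterate f i (k ℕ./ suc r ℕ.* suc r ℕ.+ k ℕ.% suc r)                ≡⟨ cong (iterate f i) (trans (ℕ.+-comm (k ℕ./ suc r ℕ.* suc r) _) (sym (ℕ.m≡m%n+[m/n]*n k (suc r)))) ⟩
    iterate f i k                                                      ≡⟨ eq ⟩
    j                                                                  ∎)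
    where
    f = σ ⟨$⟩ʳ_

  Orbit⇒InCycleOf : ∀ {i j} → Orbit i j → InCycleOf σ i j
  Orbit⇒InCycleOf {i} orb with r , r<d , per ← period i with k , k≤r , eq ← reduced r per orb =
    Fin.fromℕ< k<d , trans (cong (iterate (σ ⟨$⟩ʳ_) i) (Fin.toℕ-fromℕ< k<d)) eq
    where
    k<d : k ℕ.< d
    k<d = ℕ.≤-trans k≤r r<d

  InCycleOf⇒Orbit : ∀ {i j} → InCycleOf σ i j → Orbit i j
  InCycleOf⇒Orbit (k , eq) = toℕ k , eq

  cycle-refl : ∀ i → InCycleOf σ i i
  cycle-refl i = Orbit⇒InCycleOf (0 , refl)

  cycle-trans : ∀ {i j k} → InCycleOf σ i j → InCycleOf σ j k → InCycleOf σ i k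
  cycle-trans {i} (a , p) (b , q) = Orbit⇒InCycleOf (toℕ a ℕ.+ toℕ b ,
    trans (iterate-+ (σ ⟨$⟩ʳ_) i (toℕ a) (toℕ b)) (trans (cong (λ x → iterate (σ ⟨$⟩ʳ_) x (toℕ b)) p) q))

  cycle-sym : ∀ {i j} → InCycleOf σ i j → InCycleOf σ j i
  cycle-sym {i} {j} inc with r , r<d , per ← period i with k , k≤r , eq ← reduced r per (InCycleOf⇒Orbit inc) =
    Orbit⇒InCycleOf (suc r ℕ.∸ k , (begin
      iterate f j (suc r ℕ.∸ k)                  ≡⟨ cong (λ x → iterate f x (suc r ℕ.∸ k)) eq ⟨
      iterate f (iterate f i k) (suc r ℕ.∸ k)    ≡⟨ iterate-+ f i k (suc r ℕ.∸ k) ⟨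
      iterate f i (k ℕ.+ (suc r ℕ.∸ k))          ≡⟨ cong (iterate f i) (ℕ.m+[n∸m]≡n (ℕ.<⇒≤ k≤r)) ⟩
      iterate f i (suc r)                        ≡⟨ per ⟩
      i                                          ∎))
    where
    f = σ ⟨$⟩ʳ_

  cycleLength-⨁ : ∀ i → fromℕ (cycleLength σ i) ≡ ⨁ (allFin d) (λ j → 𝟙 (inCycleOf? σ i j))
  cycleLength-⨁ i = ⨁-𝟙 (inCycleOf? σ i) (allFin d)

  cycleLength-cycle : ∀ {i j} → InCycleOf σ i j → cycleLength σ i ≡ cycleLength σ j
  cycleLength-cycle {i} {j} inc = fromℕ-injective (trans (cycleLength-⨁ i) (trans
    (⨁-cong (λ k → 𝟙-⇔ (inCycleOf? σ i k) (inCycleOf? σ j k) (cycle-trans (cycle-sym inc)) (cycle-trans inc)))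
    (sym (cycleLength-⨁ j))))

  cycleLength>0 : ∀ i → 0 ℕ.< cycleLength σ i
  cycleLength>0 i = subst (0 ℕ.<_) refl (ℕ.<-≤-trans (ℕ.s≤s ℕ.z≤n) (fromℕ-cancel-≤ {1} {cycleLength σ i}
    (subst (1ℚ ℚ.≤_) (sym (cycleLength-⨁ i)) (subst (ℚ._≤ ⨁ (allFin d) (λ j → 𝟙 (inCycleOf? σ i j))) (𝟙-yes (inCycleOf? σ i i) (cycle-refl i))
      (FinE.term≤⨁ {f = λ j → 𝟙 (inCycleOf? σ i j)} (cong (λ j → 𝟙 (inCycleOf? σ i j))) (λ j → 0≤𝟙 (inCycleOf? σ i j)) i)))))

  private
    least : ∀ i → ∃[ j ] (InCycleOf σ i j × IsLeastInCycle σ j)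
    least i with j , ¬¬inc , below ← Fin.¬∀⟶∃¬-smallest d (λ j → ¬ InCycleOf σ i j) (λ j → ¬? (inCycleOf? σ i j)) (λ ∀¬ → ∀¬ i (cycle-refl i)) =
      j , inc , λ k j~k → ℕ.≮⇒≥ (λ k<j → below (Fin.fromℕ< k<j) (subst (InCycleOf σ i) (Fin.toℕ-injective
        (sym (trans (Fin.toℕ-inject (Fin.fromℕ< k<j)) (Fin.toℕ-fromℕ< k<j)))) (cycle-trans inc j~k)))
      where
      inc : InCycleOf σ i j
      inc with inCycleOf? σ i j
      ... | yes p = p
      ... | no ¬p = contradiction ¬p ¬¬inc

  least-once : ∀ j → ⨁ (allFin d) (λ i → 𝟙 (isLeastInCycle? σ i) * 𝟙 (inCycleOf? σ i j)) ≡ 1ℚ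
  least-once j with m , j~m , m-least ← least j = trans (⨁-cong (λ i → trans
    (sym (𝟙-× (isLeastInCycle? σ i) (inCycleOf? σ i j)))
    (𝟙-⇔ (isLeastInCycle? σ i ×-dec inCycleOf? σ i j) (i Fin.≟ m)
      (λ (i-least , i~j) → Fin.≤-antisym (i-least m (cycle-trans i~j j~m)) (m-least i (cycle-trans (cycle-sym j~m) (cycle-sym i~j))))
      (λ { refl → m-least , cycle-sym j~m }))))
    (FinE.once m)

  -- The factor `cycleLength σ i` counts the points of the cycle, so a sum over representatives
  -- weighted by length spreads into an unweighted sum over points.
  ⨁-least : ∀ (F : ℕ → ℚ) → ⨁ (filter (isLeastInCycle? σ) (allFin d)) (λ i → fromℕ (cycleLength σ i) * F (cycleLength σ i))
                            ≡ ⨁ (allFin d) (λ i → F (cycleLength σ i))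
  ⨁-least F = begin
    ⨁ (filter (isLeastInCycle? σ) (allFin d)) (λ i → fromℕ (ℓ i) * F (ℓ i))
      ≡⟨ ⨁-filter (isLeastInCycle? σ) (allFin d) _ ⟩
    ⨁ (allFin d) (λ i → 𝟙 (isLeastInCycle? σ i) * (fromℕ (ℓ i) * F (ℓ i)))
      ≡⟨ ⨁-cong (λ i → trans (cong (λ x → 𝟙 (isLeastInCycle? σ i) * (x * F (ℓ i))) (cycleLength-⨁ i))
           (trans (cong (𝟙 (isLeastInCycle? σ i) *_) (sym ⨁-*ʳ))
             (sym ⨁-*ˡ))) ⟩
    ⨁ (allFin d) (λ i → ⨁ (allFin d) (λ j → 𝟙 (isLeastInCycle? σ i) * (𝟙 (inCycleOf? σ i j) * F (ℓ i))))
      ≡⟨ ⨁-swap ⟩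
    ⨁ (allFin d) (λ j → ⨁ (allFin d) (λ i → 𝟙 (isLeastInCycle? σ i) * (𝟙 (inCycleOf? σ i j) * F (ℓ i))))
      ≡⟨ ⨁-cong (λ j → trans (⨁-cong (λ i → trans
           (cong (𝟙 (isLeastInCycle? σ i) *_) (𝟙-cong (inCycleOf? σ i j) (cong F ∘ cycleLength-cycle)))
           (sym (*-assoc (𝟙 (isLeastInCycle? σ i)) (𝟙 (inCycleOf? σ i j)) (F (ℓ j))))))
           (trans ⨁-*ʳ (trans (cong (_* F (ℓ j)) (least-once j)) (*-identityˡ (F (ℓ j)))))) ⟩
    ⨁ (allFin d) (λ j → F (ℓ j)) ∎
    where
    ℓ = cycleLength σ

⨁-↭ : ∀ {I : Set} {xs ys : List I} (f : I → ℚ) → xs ↭ ys → ⨁ xs f ≡ ⨁ ys f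
⨁-↭ f ↭-refl = refl
⨁-↭ f (prep x p) = trans ⨁-∷ (trans (cong (f x +_) (⨁-↭ f p)) (sym ⨁-∷))
⨁-↭ f (↭-swap {xs} {ys} x y p) = begin
  ⨁ (x ∷ y ∷ xs) f        ≡⟨ trans ⨁-∷ (cong (f x +_) ⨁-∷) ⟩
  f x + (f y + ⨁ xs f)    ≡⟨ +-assoc (f x) (f y) (⨁ xs f) ⟨
  f x + f y + ⨁ xs f      ≡⟨ cong₂ _+_ (+-comm (f x) (f y)) (⨁-↭ f p) ⟩
  f y + f x + ⨁ ys f      ≡⟨ +-assoc (f y) (f x) (⨁ ys f) ⟩
  f y + (f x + ⨁ ys f)    ≡⟨ trans ⨁-∷ (cong (f y +_) ⨁-∷) ⟨
  ⨁ (y ∷ x ∷ ys) f        ∎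
⨁-↭ f (↭-trans p q) = trans (⨁-↭ f p) (⨁-↭ f q)

open InsertionSort (DecTotalOrder.≥-decTotalOrder ℕ.≤-decTotalOrder) using (insertionSort)

cycleLengths : ∀ {d} → Permutation′ d → List ℕ
cycleLengths {d} σ = map (cycleLength σ) (filter (isLeastInCycle? σ) (allFin d))

cycleType-↭ : ∀ {d} (σ : Permutation′ d) → cycleType σ ↭ cycleLengths σ
cycleType-↭ σ = Data.List.Sort.Base.SortingAlgorithm.sort-↭ insertionSort (cycleLengths σ)

⨁-cycleType : ∀ {d} (σ : Permutation′ d) (F : ℕ → ℚ) →
              ⨁ (cycleType σ) (λ m → fromℕ m * F m) ≡ ⨁ (allFin d) (λ i → F (cycleLength σ i))
⨁-cycleType {d} σ F = trans (⨁-↭ _ (cycleType-↭ σ))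
  (trans (⨁-map (cycleLength σ) (filter (isLeastInCycle? σ) (allFin d)) _) (⨁-least σ F))

sum-⨁ : ∀ xs → fromℕ (sum xs) ≡ ⨁ xs fromℕ
sum-⨁ []       = sym ⨁-[]
sum-⨁ (x ∷ xs) = trans (fromℕ-+ x (sum xs)) (trans (cong (fromℕ x +_) (sum-⨁ xs)) (sym ⨁-∷))

cycleType-isPartition : ∀ {d} (σ : Permutation′ d) → IsPartition d (cycleType σ)
cycleType-isPartition {d} σ =
  All-resp-↭ (↭-sym (cycleType-↭ σ)) (All.map⁺ (universal (cycleLength>0 σ) _)) ,
  Data.List.Sort.Base.SortingAlgorithm.sort-↗ insertionSort (cycleLengths σ) ,
  fromℕ-injective (begin
    fromℕ (sum (cycleType σ))   ≡⟨ sum-⨁ (cycleType σ) ⟩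
    ⨁ (cycleType σ) fromℕ                           ≡⟨ ⨁-cong (λ m → *-identityʳ (fromℕ m)) ⟨
    ⨁ (cycleType σ) (λ m → fromℕ m * 1ℚ)            ≡⟨ ⨁-cycleType σ (λ _ → 1ℚ) ⟩
    ⨁ (allFin d) (λ _ → 1ℚ)                         ≡⟨ trans ⨁-allFin-const (*-identityʳ (fromℕ d)) ⟩
    fromℕ d                                         ∎)

iterate-conj : ∀ {d} (ρ σ τ : Permutation′ d) → (∀ x → τ ⟨$⟩ʳ (ρ ⟨$⟩ʳ x) ≡ ρ ⟨$⟩ʳ (σ ⟨$⟩ʳ x)) →
               ∀ k x → iterate (τ ⟨$⟩ʳ_) (ρ ⟨$⟩ʳ x) k ≡ ρ ⟨$⟩ʳ iterate (σ ⟨$⟩ʳ_) x k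
iterate-conj ρ σ τ eq zero    x = refl
iterate-conj ρ σ τ eq (suc k) x = trans (cong (λ y → iterate (τ ⟨$⟩ʳ_) y k) (eq x)) (iterate-conj ρ σ τ eq k (σ ⟨$⟩ʳ x))

-- Stated for an intertwiner ρ, it covers conjugate permutations and, with `ρ = idₚ`, pointwise
-- equal ones.
cycleLength-intertwine : ∀ {d} (ρ σ τ : Permutation′ d) → (∀ x → τ ⟨$⟩ʳ (ρ ⟨$⟩ʳ x) ≡ ρ ⟨$⟩ʳ (σ ⟨$⟩ʳ x)) →
                         ∀ x → cycleLength τ (ρ ⟨$⟩ʳ x) ≡ cycleLength σ x
cycleLength-intertwine {d} ρ σ τ eq x = fromℕ-injective (begin
  fromℕ (cycleLength τ (ρ ⟨$⟩ʳ x))                                  ≡⟨ cycleLength-⨁ τ (ρ ⟨$⟩ʳ x) ⟩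
  ⨁ (allFin d) (λ j → 𝟙 (inCycleOf? τ (ρ ⟨$⟩ʳ x) j))                 ≡⟨ ⨁-permute ρ (λ j → 𝟙 (inCycleOf? τ (ρ ⟨$⟩ʳ x) j)) ⟨
  ⨁ (allFin d) (λ j → 𝟙 (inCycleOf? τ (ρ ⟨$⟩ʳ x) (ρ ⟨$⟩ʳ j)))        ≡⟨ ⨁-cong (λ j → 𝟙-⇔ (inCycleOf? τ (ρ ⟨$⟩ʳ x) (ρ ⟨$⟩ʳ j)) (inCycleOf? σ x j)
       (λ (k , p) → k , ⟨$⟩ʳ-injective ρ (trans (sym (iterate-conj ρ σ τ eq (toℕ k) x)) p))
       (λ (k , p) → k , trans (iterate-conj ρ σ τ eq (toℕ k) x) (cong (ρ ⟨$⟩ʳ_) p))) ⟩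
  ⨁ (allFin d) (λ j → 𝟙 (inCycleOf? σ x j))                         ≡⟨ cycleLength-⨁ σ x ⟨
  fromℕ (cycleLength σ x)                                           ∎)

cycleLength-cong : ∀ {d} {σ τ : Permutation′ d} → σ ≈ₚ τ → ∀ x → cycleLength σ x ≡ cycleLength τ x
cycleLength-cong {σ = σ} {τ} eq = cycleLength-intertwine idₚ τ σ eq

-- The permutation of Fin (suc d) in which 0 is a fixed point, or is inserted
-- into the cycles of π in front of j.
attach : ∀ {d} → Fin (suc d) → Permutation′ d → Permutation′ (suc d)
attach j π = swap zero j · lift₀ π

attach-zero : ∀ {d} (j : Fin (suc d)) π → attach j π ⟨$⟩ʳ zero ≡ j
attach-zero j π = swap-fst zero j

attach-fixed : ∀ {d} (π : Permutation′ d) y → attach zero π ⟨$⟩ʳ suc y ≡ suc (π ⟨$⟩ʳ y)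
attach-fixed π y = swap-other zero zero (λ ()) (λ ())

attach-hit : ∀ {d} j (π : Permutation′ d) {y} → π ⟨$⟩ʳ y ≡ j → attach (suc j) π ⟨$⟩ʳ suc y ≡ zero
attach-hit j π refl = swap-snd zero (suc j)

attach-miss : ∀ {d} j (π : Permutation′ d) {y} → π ⟨$⟩ʳ y ≢ j → attach (suc j) π ⟨$⟩ʳ suc y ≡ suc (π ⟨$⟩ʳ y)
attach-miss j π πy≢j = swap-other zero (suc j) (λ ()) (πy≢j ∘ Fin.suc-injective)

-- The list is built with `insert`, which does not describe cycles. For each j the two
-- parametrisations run over the same permutations, those sending 0 to j: left translation by
-- `swap zero j` carries the permutations fixing 0 onto them.
⨁-attach : ∀ {d} {f : Permutation′ (suc d) → ℚ} → PermE.Respects f →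
           ⨁ (permutations (suc d)) f ≡ ⨁ (allFin (suc d)) (λ j → ⨁ (permutations d) (λ π → f (attach j π)))
⨁-attach {d} {f} f-resp = trans (unfold f) (⨁-cong step)
  where
  unfold : ∀ f → ⨁ (permutations (suc d)) f ≡ ⨁ (allFin (suc d)) (λ j → ⨁ (permutations d) (λ π → f (insert zero j π)))
  unfold f = trans ⨁-concatMap (⨁-cong (λ j → ⨁-map (insert zero j) (permutations d) f))
  fibre : ∀ {g} j → ⨁ (permutations (suc d)) (λ σ → 𝟙 (σ ⟨$⟩ʳ zero Fin.≟ j) * g σ) ≡ ⨁ (permutations d) (λ π → g (insert zero j π))
  fibre {g} j = trans (unfold _) (trans (⨁-cong (λ i → ⨁-*ˡ)) (⨁-pick-Fin (λ i → ⨁ (permutations d) (λ π → g (insert zero i π))) j))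
  at-zero : ∀ j → PermE.Respects (λ σ → 𝟙 (σ ⟨$⟩ʳ zero Fin.≟ j) * f σ)
  at-zero j {σ} {τ} σ≈τ = cong₂ _*_ (cong (λ i → 𝟙 (i Fin.≟ j)) (σ≈τ zero)) (f-resp σ≈τ)
  insert-zero : ∀ (π : Permutation′ d) → insert zero zero π ≈ₚ lift₀ π
  insert-zero π zero    = refl
  insert-zero π (suc y) = insert-punchIn zero zero π y
  step : ∀ j → ⨁ (permutations d) (λ π → f (insert zero j π)) ≡ ⨁ (permutations d) (λ π → f (attach j π))
  step j = begin
    ⨁ (permutations d) (λ π → f (insert zero j π))
      ≡⟨ fibre {f} j ⟨
    ⨁ (permutations (suc d)) (λ σ → 𝟙 (σ ⟨$⟩ʳ zero Fin.≟ j) * f σ)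
      ≡⟨ ⨁-left (swap zero j) (at-zero j) ⟨
    ⨁ (permutations (suc d)) (λ σ → 𝟙 (swap zero j ⟨$⟩ʳ (σ ⟨$⟩ʳ zero) Fin.≟ j) * f (swap zero j · σ))
      ≡⟨ ⨁-cong (λ σ → cong (_* f (swap zero j · σ)) (𝟙-⇔ (swap zero j ⟨$⟩ʳ (σ ⟨$⟩ʳ zero) Fin.≟ j) (σ ⟨$⟩ʳ zero Fin.≟ zero)
           (λ eq → ⟨$⟩ʳ-injective (swap zero j) (trans eq (sym (swap-fst zero j)))) (λ eq → trans (cong (swap zero j ⟨$⟩ʳ_) eq) (swap-fst zero j)))) ⟩
    ⨁ (permutations (suc d)) (λ σ → 𝟙 (σ ⟨$⟩ʳ zero Fin.≟ zero) * f (swap zero j · σ))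
      ≡⟨ fibre {λ σ → f (swap zero j · σ)} zero ⟩
    ⨁ (permutations d) (λ π → f (swap zero j · insert zero zero π))
      ≡⟨ ⨁-cong (λ π → f-resp (λ i → cong (swap zero j ⟨$⟩ʳ_) (insert-zero π i))) ⟩
    ⨁ (permutations d) (λ π → f (attach j π)) ∎

cycleLength-attach-zero : ∀ {d} (π : Permutation′ d) → cycleLength (attach zero π) zero ≡ 1
cycleLength-attach-zero {d} π = fromℕ-injective (begin
  fromℕ (cycleLength σ zero)                                  ≡⟨ cycleLength-⨁ σ zero ⟩
  ⨁ (allFin (suc d)) (λ j → 𝟙 (inCycleOf? σ zero j))           ≡⟨ ⨁-cong (λ j → 𝟙-⇔ (inCycleOf? σ zero j) (j Fin.≟ zero)
                                                                 (λ (k , eq) → trans (sym eq) (stays (toℕ k))) (λ { refl → cycle-refl σ zero })) ⟩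
  ⨁ (allFin (suc d)) (λ j → 𝟙 (j Fin.≟ zero))                  ≡⟨ FinE.once zero ⟩
  1ℚ                                                          ∎)
  where
  σ = attach zero π
  stays : ∀ k → iterate (σ ⟨$⟩ʳ_) zero k ≡ zero
  stays zero    = refl
  stays (suc k) = trans (cong (λ x → iterate (σ ⟨$⟩ʳ_) x k) (attach-zero zero π)) (stays k)

cycleLength-attach-suc : ∀ {d} (j : Fin d) π → cycleLength (attach (suc j) π) zero ≡ suc (cycleLength π j)
cycleLength-attach-suc {d} j π = fromℕ-injective (begin
  fromℕ (cycleLength σ zero)                                  ≡⟨ cycleLength-⨁ σ zero ⟩
  ⨁ (allFin (suc d)) (λ y → 𝟙 (inCycleOf? σ zero y))           ≡⟨ ⨁-allFin-suc ⟩
  𝟙 (inCycleOf? σ zero zero) + ⨁ (allFin d) (λ y → 𝟙 (inCycleOf? σ zero (suc y)))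
                                                              ≡⟨ cong₂ _+_ (𝟙-yes (inCycleOf? σ zero zero) (cycle-refl σ zero))
                                                                   (⨁-cong (λ y → 𝟙-⇔ (inCycleOf? σ zero (suc y)) (inCycleOf? π j y) (to y) (from y))) ⟩
  1ℚ + ⨁ (allFin d) (λ y → 𝟙 (inCycleOf? π j y))               ≡⟨ cong (1ℚ +_) (cycleLength-⨁ π j) ⟨
  1ℚ + fromℕ (cycleLength π j)                                ≡⟨ fromℕ-suc (cycleLength π j) ⟨
  fromℕ (suc (cycleLength π j))                               ∎)
  where
  σ = attach (suc j) π
  s = σ ⟨$⟩ʳ_
  p = π ⟨$⟩ʳ_
  track : ∀ k → iterate s zero k ≡ zero ⊎ (∃[ y ] (iterate s zero k ≡ suc y × Orbit π j y))
  track zero = inj₁ refl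
  track (suc k) rewrite iterate-suc s zero k with track k
  ... | inj₁ eq = inj₂ (j , trans (cong s eq) (attach-zero (suc j) π) , 0 , refl)
  ... | inj₂ (y , eq , m , orb) with p y Fin.≟ j
  ...   | yes hit  = inj₁ (trans (cong s eq) (attach-hit j π hit))
  ...   | no  miss = inj₂ (p y , trans (cong s eq) (attach-miss j π miss) , suc m , trans (iterate-suc p j m) (cong p orb))
  to : ∀ y → InCycleOf σ zero (suc y) → InCycleOf π j y
  to y (k , eq) with track (toℕ k)
  ... | inj₁ eq′ with () ← trans (sym eq) eq′
  ... | inj₂ (y′ , eq′ , orb) with refl ← Fin.suc-injective (trans (sym eq) eq′) = Orbit⇒InCycleOf π orb
  follow : ∀ k → Orbit σ zero (suc (iterate p j k))
  follow zero = 1 , attach-zero (suc j) π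
  follow (suc k) rewrite iterate-suc p j k with m , eq ← follow k | p (iterate p j k) Fin.≟ j
  -- When π returns to j, the longer cycle passes through 0 first, and counting restarts: one step
  -- from 0 reaches j.
  ... | yes hit  rewrite hit = 1 , attach-zero (suc j) π
  ... | no  miss = suc m , trans (iterate-suc s zero m) (trans (cong s eq) (attach-miss j π miss))
  from : ∀ y → InCycleOf π j y → InCycleOf σ zero (suc y)
  from y (k , refl) = Orbit⇒InCycleOf σ (follow (toℕ k))


opaque
  unfolding _+_

  *-inverse-/ : ∀ m .{{_ : ℕ.NonZero m}} → fromℕ m * (ℤ.+ 1 / m) ≡ 1ℚ
  *-inverse-/ (suc m) = ℚ.toℚᵘ-injective (ℚᵘ.≃-trans (ℚ.toℚᵘ-homo-* (fromℕ (suc m)) (ℤ.+ 1 / suc m))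
    (ℚᵘ.≃-trans (ℚᵘ.*-cong (ℚ.toℚᵘ-fromℚᵘ (ℚᵘ.mkℚᵘ (ℤ.+ suc m) 0)) (ℚ.toℚᵘ-fromℚᵘ (ℚᵘ.mkℚᵘ (ℤ.+ 1) m)))
      (ℚᵘ.*≡* (cong ℤ.+_ (trans (ℕ.*-identityʳ (suc m ℕ.* 1)) (trans (ℕ.*-comm (suc m) 1) (cong (λ k → 1 ℕ.* suc k) (sym (ℕ.+-identityʳ m)))))))))

!*1/! : ∀ d → fromℕ (d !) * 1/ d ! ≡ 1ℚ
!*1/! d = *-inverse-/ (d !) {{d ℕ.!≢0}}

fromℕ-suc≢0 : ∀ d → fromℕ (suc d) ≢ 0ℚ
fromℕ-suc≢0 d eq with () ← fromℕ-injective {suc d} {0} eq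

!≢0 : ∀ d → fromℕ (d !) ≢ 0ℚ
!≢0 d eq = ℕ.≢-nonZero⁻¹ (d !) {{d ℕ.!≢0}} (fromℕ-injective {d !} {0} eq)

1/suc! : ∀ d → 1/ suc d ! * fromℕ (suc d) ≡ 1/ d !
1/suc! d = *-cancelˡ-≢0 (fromℕ (d !)) (!≢0 d) (begin
  fromℕ (d !) * (1/ suc d ! * fromℕ (suc d))    ≡⟨ commute (fromℕ (d !)) (1/ suc d !) (fromℕ (suc d)) ⟩
  fromℕ (suc d) * fromℕ (d !) * 1/ suc d !      ≡⟨ cong (_* 1/ suc d !) (fromℕ-* (suc d) (d !)) ⟨
  fromℕ (suc d !) * 1/ suc d !                  ≡⟨ !*1/! (suc d) ⟩
  1ℚ                                            ≡⟨ !*1/! d ⟨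
  fromℕ (d !) * 1/ d !                          ∎)
  where
  opaque
    unfolding _+_
    commute : ∀ a b c → a * (b * c) ≡ c * a * b
    commute = solve-∀ ℚ-ring

-- Colourings

infixr 5 _◂_

_◂_ : Fin n → (Fin d → Fin n) → (Fin (suc d) → Fin n)
(c ◂ f) zero    = c
(c ◂ f) (suc x) = f x

colourings : ∀ d n → List (Fin d → Fin n)
colourings zero    n = (λ ()) ∷ []
colourings (suc d) n = concatMap (λ c → map (c ◂_) (colourings d n)) (allFin n)

⨁-colourings : ∀ (φ : (Fin (suc d) → Fin n) → ℚ) →
               ⨁ (colourings (suc d) n) φ ≡ ⨁ (allFin n) (λ c → ⨁ (colourings d n) (λ f → φ (c ◂ f)))
⨁-colourings {d} {n} φ = trans ⨁-concatMap (⨁-cong (λ c → ⨁-map (c ◂_) (colourings d n) φ))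

infix 4 _≗ᶜ?_

_≗ᶜ?_ : (f g : Fin d → Fin n) → Dec (f ≗ g)
f ≗ᶜ? g = Fin.all? (λ x → f x Fin.≟ g x)

colourings-once : ∀ (g : Fin d → Fin n) → ⨁ (colourings d n) (λ f → 𝟙 (f ≗ᶜ? g)) ≡ 1ℚ
colourings-once {zero} g = trans ⨁-∷ (trans (cong₂ _+_ (𝟙-yes (_ ≗ᶜ? g) (λ ())) ⨁-[]) (+-identityʳ 1ℚ))
colourings-once {suc d} {n} g = begin
  ⨁ (colourings (suc d) n) (λ f → 𝟙 (f ≗ᶜ? g))
    ≡⟨ ⨁-colourings _ ⟩
  ⨁ (allFin n) (λ c → ⨁ (colourings d n) (λ f → 𝟙 ((c ◂ f) ≗ᶜ? g)))
    ≡⟨ ⨁-cong (λ c → trans (⨁-cong (λ f → trans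
         (𝟙-⇔ ((c ◂ f) ≗ᶜ? g) ((c Fin.≟ g zero) ×-dec (f ≗ᶜ? (g ∘ suc)))
           (λ eq → eq zero , eq ∘ suc) (λ { (p , q) zero → p ; (p , q) (suc x) → q x }))
         (𝟙-× (c Fin.≟ g zero) (f ≗ᶜ? (g ∘ suc)))))
         (trans ⨁-*ˡ (trans (cong (𝟙 (c Fin.≟ g zero) *_) (colourings-once (g ∘ suc))) (*-identityʳ _)))) ⟩
  ⨁ (allFin n) (λ c → 𝟙 (c Fin.≟ g zero))
    ≡⟨ FinE.once (g zero) ⟩
  1ℚ ∎

Colouring-enumeration : ∀ d n → Enumeration (Fin d → Fin n)
Colouring-enumeration d n = record
  { elements = colourings d n ; _~_ = _≗_ ; _~?_ = _≗ᶜ?_ ; ~-sym = λ eq x → sym (eq x) ; once = colourings-once }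

module ColourE {d} {n} = Enumeration (Colouring-enumeration d n)

⨁-colourings-permute : ∀ (τ : Permutation′ d) {φ : (Fin d → Fin n) → ℚ} → ColourE.Respects φ →
                       ⨁ (colourings d n) (λ f → φ (f ∘ (τ ⟨$⟩ʳ_))) ≡ ⨁ (colourings d n) φ
⨁-colourings-permute {d} {n} τ = ⨁-reindex (Colouring-enumeration d n) (Colouring-enumeration d n)
  (_∘ (τ ⟨$⟩ʳ_)) (_∘ (τ ⟨$⟩ˡ_))
  (λ f g eq x → trans (cong f (sym (inverseʳ τ))) (eq (τ ⟨$⟩ˡ x)))
  (λ f g eq x → trans (eq (τ ⟨$⟩ʳ x)) (cong g (inverseˡ τ)))

opaque

  cnt : (Fin d → Fin n) → Fin n → ℤ
  cnt {zero}  f i = 0ℤ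
  cnt {suc d} f i = e (f zero) i ℤ.+ cnt (f ∘ suc) i

  cnt-cong : ∀ {f g : Fin d → Fin n} → f ≗ g → cnt f ≗ cnt g
  cnt-cong {zero}  eq i = refl
  cnt-cong {suc d} eq i = cong₂ ℤ._+_ (cong (λ c → e c i) (eq zero)) (cnt-cong (eq ∘ suc) i)

  cnt-⨁ : ∀ (f : Fin d → Fin n) i → fromℤ (cnt f i) ≡ ⨁ (allFin d) (λ x → fromℤ (e (f x) i))
  cnt-⨁ {zero}  f i = sym ⨁-[]
  cnt-⨁ {suc d} f i = trans (fromℤ-+ (e (f zero) i) (cnt (f ∘ suc) i))
    (trans (cong (fromℤ (e (f zero) i) +_) (cnt-⨁ (f ∘ suc) i)) (sym ⨁-allFin-suc))

  cnt-[] : ∀ (f : Fin 0 → Fin n) i → cnt f i ≡ 0ℤ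
  cnt-[] f i = refl

  cnt-◂ : ∀ c (f : Fin d → Fin n) i → cnt (c ◂ f) i ≡ e c i ℤ.+ cnt f i
  cnt-◂ c f i = refl

cnt-permute : ∀ (τ : Permutation′ d) (f : Fin d → Fin n) → cnt (f ∘ (τ ⟨$⟩ʳ_)) ≗ cnt f
cnt-permute τ f i = fromℤ-injective (trans (cnt-⨁ (f ∘ (τ ⟨$⟩ʳ_)) i) (trans (⨁-permute τ (λ x → fromℤ (e (f x) i))) (sym (cnt-⨁ f i))))

-- The coefficient of x^A in Δ(x) ∏ x_{f y}.
D : (Fin n → ℤ) → (Fin d → Fin n) → ℚ
D A f = Alt (λ i → A i ℤ.- cnt f i) δ

D-cong : ∀ {A A′ : Fin n → ℤ} {f f′ : Fin d → Fin n} → A ≗ A′ → cnt f ≗ cnt f′ → D A f ≡ D A′ f′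
D-cong A≗ f≗ = Alt-cong {B = δ} (λ i → cong₂ ℤ._-_ (A≗ i) (f≗ i)) (λ _ → refl)

D-◂ : ∀ (A : Fin n → ℤ) c (f : Fin d → Fin n) → D A (c ◂ f) ≡ D (A [ c ↓ 1 ]) f
D-◂ A c f = Alt-cong {B = δ} (λ i → trans (cong (λ y → A i ℤ.- y) (cnt-◂ c f i)) (lemma (A i) (e c i) (cnt f i))) (λ _ → refl)
  where
  lemma : ∀ a x y → a ℤ.- (x ℤ.+ y) ≡ a ℤ.- 1ℤ ℤ.* x ℤ.- y
  lemma = ℤ-solve

fixed? : ∀ (σ : Permutation′ d) (f : Fin d → Fin n) → Dec (∀ x → f (σ ⟨$⟩ʳ x) ≡ f x)
fixed? σ f = Fin.all? (λ x → f (σ ⟨$⟩ʳ x) Fin.≟ f x)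

𝟙-fixed-cong : ∀ {σ τ : Permutation′ d} {f g : Fin d → Fin n} → σ ≈ₚ τ → f ≗ g → 𝟙 (fixed? σ f) ≡ 𝟙 (fixed? τ g)
𝟙-fixed-cong {σ = σ} {τ} {f} {g} σ≈ f≗ = 𝟙-⇔ (fixed? σ f) (fixed? τ g)
  (λ p x → trans (cong g (sym (σ≈ x))) (trans (sym (f≗ (σ ⟨$⟩ʳ x))) (trans (p x) (f≗ x))))
  (λ p x → trans (cong f (σ≈ x)) (trans (f≗ (τ ⟨$⟩ʳ x)) (trans (p x) (sym (f≗ x)))))

fixedSum : ((Fin d → Fin n) → ℚ) → Permutation′ d → ℚ
fixedSum {d} {n} φ σ = ⨁ (colourings d n) (λ f → 𝟙 (fixed? σ f) * φ f)

fixedSum-cong : ∀ {φ ψ : (Fin d → Fin n) → ℚ} {σ τ} → (∀ f → φ f ≡ ψ f) → σ ≈ₚ τ → fixedSum φ σ ≡ fixedSum ψ τ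
fixedSum-cong {d} {n} {σ = σ} {τ} φ≗ψ σ≈ = ⨁-cong (λ f → cong₂ _*_ (𝟙-fixed-cong {σ = σ} {τ} {f} σ≈ (λ _ → refl)) (φ≗ψ f))

fixedSum-conj : ∀ {φ : (Fin d → Fin n) → ℚ} → ColourE.Respects φ → ∀ ρ σ →
                fixedSum φ (ρ · σ · flip ρ) ≡ fixedSum (λ f → φ (f ∘ (ρ ⟨$⟩ˡ_))) σ
fixedSum-conj {d} {n} {φ} φ-resp ρ σ = trans
  (sym (⨁-colourings-permute (flip ρ) (λ {f} {g} f≗ → cong₂ _*_ (𝟙-fixed-cong {σ = ρ · σ · flip ρ} {ρ · σ · flip ρ} {f} {g} (λ _ → refl) f≗) (φ-resp f≗))))
  (⨁-cong (λ f → cong (_* φ (f ∘ (ρ ⟨$⟩ˡ_))) (𝟙-⇔ (fixed? (ρ · σ · flip ρ) (f ∘ (ρ ⟨$⟩ˡ_))) (fixed? σ f)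
    (λ p x → trans (cong (f ∘ (σ ⟨$⟩ʳ_)) (sym (inverseˡ ρ))) (trans (cong f (sym (inverseˡ ρ))) (trans (p (ρ ⟨$⟩ʳ x)) (cong f (inverseˡ ρ)))))
    (λ p x → trans (cong f (inverseˡ ρ)) (p (ρ ⟨$⟩ˡ x))))))

-- The Frobenius formula: s A σ is the coefficient of x^A in Δ(x) ∏ p_m(x), the
-- product ranging over the cycle lengths m of σ.
s : (Fin n → ℤ) → Permutation′ d → ℚ
s A = fixedSum (D A)

-- The colour of the marked point decides which exponent drops when its cycle is removed.
sAt : (Fin n → ℤ) → Fin d → Fin n → Permutation′ d → ℚ
sAt A x c = fixedSum (λ f → 𝟙 (f x Fin.≟ c) * D A f)

D-respects : ∀ (A : Fin n → ℤ) → ColourE.Respects (D {d = d} A)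
D-respects A {f} {g} f≗ = D-cong {A = A} {f = f} {g} (λ _ → refl) (cnt-cong f≗)

s-cong : ∀ {A A′ : Fin n → ℤ} {σ τ : Permutation′ d} → A ≗ A′ → σ ≈ₚ τ → s A σ ≡ s A′ τ
s-cong {σ = σ} {τ} A≗ = fixedSum-cong {σ = σ} {τ} (λ f → D-cong {f = f} {f} A≗ (λ _ → refl))

s-conj : ∀ (A : Fin n → ℤ) (ρ σ : Permutation′ d) → s A (ρ · σ · flip ρ) ≡ s A σ
s-conj A ρ σ = trans (fixedSum-conj (D-respects A) ρ σ) (fixedSum-cong {σ = σ} {σ} (λ f → D-cong {A = A} (λ _ → refl) (cnt-permute (flip ρ) f)) (λ _ → refl))

sAt-cong : ∀ {A A′ : Fin n → ℤ} {σ τ : Permutation′ d} x c → A ≗ A′ → σ ≈ₚ τ → sAt A x c σ ≡ sAt A′ x c τ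
sAt-cong {σ = σ} {τ} x c A≗ = fixedSum-cong {σ = σ} {τ} (λ f → cong (𝟙 (f x Fin.≟ c) *_) (D-cong {f = f} {f} A≗ (λ _ → refl)))

sAt-conj : ∀ (A : Fin n → ℤ) (ρ σ : Permutation′ d) x c → sAt A (ρ ⟨$⟩ʳ x) c (ρ · σ · flip ρ) ≡ sAt A x c σ
sAt-conj A ρ σ x c = trans
  (fixedSum-conj (λ {f} {g} f≗ → cong₂ _*_ (cong (λ i → 𝟙 (i Fin.≟ c)) (f≗ (ρ ⟨$⟩ʳ x))) (D-respects A f≗)) ρ σ)
  (fixedSum-cong {σ = σ} {σ} (λ f → cong₂ _*_ (cong (λ y → 𝟙 (f y Fin.≟ c)) (inverseˡ ρ)) (D-cong {A = A} (λ _ → refl) (cnt-permute (flip ρ) f))) (λ _ → refl))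

s-sAt : ∀ (A : Fin n → ℤ) (σ : Permutation′ d) x → s A σ ≡ ⨁ (allFin n) (λ c → sAt A x c σ)
s-sAt {n} {d} A σ x = sym (begin
  ⨁ (allFin n) (λ c → sAt A x c σ)
    ≡⟨ ⨁-swap ⟩
  ⨁ (colourings d n) (λ f → ⨁ (allFin n) (λ c → 𝟙 (fixed? σ f) * (𝟙 (f x Fin.≟ c) * D A f)))
    ≡⟨ ⨁-cong (λ f → trans ⨁-*ˡ (cong (𝟙 (fixed? σ f) *_)
         (trans (⨁-cong (λ c → cong (_* D A f) (𝟙-⇔ (f x Fin.≟ c) (c Fin.≟ f x) sym sym))) (⨁-pick-Fin (λ _ → D A f) (f x))))) ⟩
  s A σ ∎)

module _ {n d} (A : Fin n → ℤ) (c : Fin n) (π : Permutation′ d) where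

  private

    attached : ∀ j → sAt A zero c (attach j π) ≡ ⨁ (colourings d n) (λ f → 𝟙 (fixed? (attach j π) (c ◂ f)) * D (A [ c ↓ 1 ]) f)
    attached j = begin
      sAt A zero c (attach j π)
        ≡⟨ ⨁-colourings _ ⟩
      ⨁ (allFin n) (λ c₀ → ⨁ (colourings d n) (λ f → 𝟙 (fixed? (attach j π) (c₀ ◂ f)) * (𝟙 (c₀ Fin.≟ c) * D A (c₀ ◂ f))))
        ≡⟨ ⨁-cong (λ c₀ → trans (⨁-cong (λ f → exchange (𝟙 (fixed? (attach j π) (c₀ ◂ f))) (𝟙 (c₀ Fin.≟ c)) (D A (c₀ ◂ f))))
             ⨁-*ˡ) ⟩
      ⨁ (allFin n) (λ c₀ → 𝟙 (c₀ Fin.≟ c) * ⨁ (colourings d n) (λ f → 𝟙 (fixed? (attach j π) (c₀ ◂ f)) * D A (c₀ ◂ f)))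
        ≡⟨ ⨁-pick-Fin (λ c₀ → ⨁ (colourings d n) (λ f → 𝟙 (fixed? (attach j π) (c₀ ◂ f)) * D A (c₀ ◂ f))) c ⟩
      ⨁ (colourings d n) (λ f → 𝟙 (fixed? (attach j π) (c ◂ f)) * D A (c ◂ f))
        ≡⟨ ⨁-cong (λ f → cong (𝟙 (fixed? (attach j π) (c ◂ f)) *_) (D-◂ A c f)) ⟩
      ⨁ (colourings d n) (λ f → 𝟙 (fixed? (attach j π) (c ◂ f)) * D (A [ c ↓ 1 ]) f) ∎

  sAt-attach-zero : sAt A zero c (attach zero π) ≡ s (A [ c ↓ 1 ]) π
  sAt-attach-zero = trans (attached zero) (⨁-cong (λ f → cong (_* D (A [ c ↓ 1 ]) f)
    (𝟙-⇔ (fixed? (attach zero π) (c ◂ f)) (fixed? π f)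
      (λ p y → trans (sym (cong (c ◂ f) (attach-fixed π y))) (p (suc y)))
      (λ { p zero → cong (c ◂ f) (attach-zero zero π) ; p (suc y) → trans (cong (c ◂ f) (attach-fixed π y)) (p y) }))))

  -- A colouring fixed by `attach (suc j) π` gives 0 the colour of j, so deleting 0 lowers that
  -- exponent by 1 and passes the mark, with its colour, to j.
  sAt-attach-suc : ∀ j → sAt A zero c (attach (suc j) π) ≡ sAt (A [ c ↓ 1 ]) j c π
  sAt-attach-suc j = trans (attached (suc j)) (⨁-cong (λ f → trans (cong (_* D (A [ c ↓ 1 ]) f)
    (trans (𝟙-⇔ (fixed? (attach (suc j) π) (c ◂ f)) (fixed? π f ×-dec (f j Fin.≟ c)) (to f) (λ (p , q) → from f p q))
      (𝟙-× (fixed? π f) (f j Fin.≟ c))))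
    (*-assoc (𝟙 (fixed? π f)) (𝟙 (f j Fin.≟ c)) (D (A [ c ↓ 1 ]) f))))
    where
    to : ∀ f → (∀ x → (c ◂ f) (attach (suc j) π ⟨$⟩ʳ x) ≡ (c ◂ f) x) → (∀ x → f (π ⟨$⟩ʳ x) ≡ f x) × f j ≡ c
    to f p = fixed , fj≡c
      where
      fj≡c : f j ≡ c
      fj≡c = trans (sym (cong (c ◂ f) (attach-zero (suc j) π))) (p zero)
      fixed : ∀ x → f (π ⟨$⟩ʳ x) ≡ f x
      fixed x with π ⟨$⟩ʳ x Fin.≟ j
      ... | yes hit  = trans (trans (cong f hit) fj≡c) (trans (sym (cong (c ◂ f) (attach-hit j π hit))) (p (suc x)))
      ... | no  miss = trans (sym (cong (c ◂ f) (attach-miss j π miss))) (p (suc x))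
    from : ∀ f → (∀ x → f (π ⟨$⟩ʳ x) ≡ f x) → f j ≡ c → ∀ x → (c ◂ f) (attach (suc j) π ⟨$⟩ʳ x) ≡ (c ◂ f) x
    from f p q zero    = trans (cong (c ◂ f) (attach-zero (suc j) π)) q
    from f p q (suc x) with π ⟨$⟩ʳ x Fin.≟ j
    ... | yes hit  = trans (cong (c ◂ f) (attach-hit j π hit)) (trans (sym q) (trans (cong f (sym hit)) (p x)))
    ... | no  miss = trans (cong (c ◂ f) (attach-miss j π miss)) (p x)

-- Inner products of the functions `s A` and their recursion

U : ∀ d → (A B : Fin n → ℤ) → ℚ
U d A B = 1/ d ! * ⨁ (permutations d) (λ σ → s A σ * s B σ)

U-cong : ∀ d {A A′ B B′ : Fin n → ℤ} → A ≗ A′ → B ≗ B′ → U d A B ≡ U d A′ B′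
U-cong d A≗ B≗ = cong (1/ d ! *_) (⨁-cong (λ σ → cong₂ _*_ (s-cong {σ = σ} {σ} A≗ (λ _ → refl)) (s-cong {σ = σ} {σ} B≗ (λ _ → refl))))

pointed : (ℕ → ℚ) → Fin d → (c c′ : Fin n) → (A B : Fin n → ℤ) → Permutation′ d → ℚ
pointed F x c c′ A B σ = F (cycleLength σ x) * (sAt A x c σ * sAt B x c′ σ)

pointed-cong : ∀ (F : ℕ → ℚ) x c c′ (A B : Fin n → ℤ) → PermE.Respects (pointed {d} F x c c′ A B)
pointed-cong F x c c′ A B {σ} {τ} σ≈ = cong₂ _*_ (cong F (cycleLength-cong {σ = σ} {τ} σ≈ x))
  (cong₂ _*_ (sAt-cong {A = A} {σ = σ} {τ} x c (λ _ → refl) σ≈) (sAt-cong {A = B} {σ = σ} {τ} x c′ (λ _ → refl) σ≈))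

-- Conjugation by `swap y x` carries the mark from y to x. This allows the marked point to be 0,
-- where `attach` applies.
⨁-pointed : ∀ F (x y : Fin d) c c′ (A B : Fin n → ℤ) →
            ⨁ (permutations d) (pointed F x c c′ A B) ≡ ⨁ (permutations d) (pointed F y c c′ A B)
⨁-pointed {d} F x y c c′ A B = trans (sym (⨁-conj ρ (λ {σ} {τ} → pointed-cong F x c c′ A B {σ} {τ}))) (⨁-cong (λ σ →
  subst (λ z → pointed F z c c′ A B (ρ · σ · flip ρ) ≡ pointed F y c c′ A B σ) (swap-fst y x)
    (cong₂ _*_ (cong F (cycleLength-intertwine ρ σ (ρ · σ · flip ρ) (λ z → cong (λ z → ρ ⟨$⟩ʳ (σ ⟨$⟩ʳ z)) (inverseˡ ρ)) y))
      (cong₂ _*_ (sAt-conj A ρ σ y c) (sAt-conj B ρ σ y c′)))))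
  where ρ = swap y x

-- Removing the cycle through a marked point, of length m and coloured (c , c′),
-- lowers A c and B c′ by m.
⨁-peel : ∀ d (F : ℕ → ℚ) c c′ (A B : Fin n → ℤ) →
  1/ d ! * ⨁ (allFin d) (λ x → ⨁ (permutations d) (pointed F x c c′ A B))
  ≡ ⨁< d (λ k → F (suc k) * U (d ℕ.∸ suc k) (A [ c ↓ suc k ]) (B [ c′ ↓ suc k ]))
⨁-peel zero    F c c′ A B = trans (cong (1/ 0 ! *_) ⨁-[]) (trans (zeroʳ (1/ 0 !)) (sym (⨁<-zero (λ k → F (suc k) * U (0 ℕ.∸ suc k) (A [ c ↓ suc k ]) (B [ c′ ↓ suc k ])))))
⨁-peel (suc d) F c c′ A B = begin
  1/ suc d ! * ⨁ (allFin (suc d)) (λ x → ⨁ (permutations (suc d)) (pointed F x c c′ A B))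
    ≡⟨ cong (1/ suc d ! *_) (trans (⨁-cong (λ x → ⨁-pointed F x zero c c′ A B)) ⨁-allFin-const) ⟩
  1/ suc d ! * (fromℕ (suc d) * P₀)
    ≡⟨ trans (sym (*-assoc (1/ suc d !) (fromℕ (suc d)) P₀)) (cong (_* P₀) (1/suc! d)) ⟩
  1/ d ! * P₀
    ≡⟨ cong (1/ d ! *_) (trans (⨁-attach (λ {σ} {τ} → pointed-cong F zero c c′ A B {σ} {τ})) ⨁-allFin-suc) ⟩
  1/ d ! * (⨁ (permutations d) (λ π → pointed F zero c c′ A B (attach zero π))
            + ⨁ (allFin d) (λ j → ⨁ (permutations d) (λ π → pointed F zero c c′ A B (attach (suc j) π))))
    ≡⟨ cong (1/ d ! *_) (cong₂ _+_
         (trans (⨁-cong (λ π → cong₂ _*_ (cong F (cycleLength-attach-zero π)) (cong₂ _*_ (sAt-attach-zero A c π) (sAt-attach-zero B c′ π))))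
           ⨁-*ˡ)
         (⨁-cong (λ j → ⨁-cong (λ π → cong₂ _*_ (cong F (cycleLength-attach-suc j π)) (cong₂ _*_ (sAt-attach-suc A c π j) (sAt-attach-suc B c′ π j)))))) ⟩
  1/ d ! * (F 1 * ⨁ (permutations d) (λ π → s (A [ c ↓ 1 ]) π * s (B [ c′ ↓ 1 ]) π)
            + ⨁ (allFin d) (λ j → ⨁ (permutations d) (pointed (F ∘ suc) j c c′ (A [ c ↓ 1 ]) (B [ c′ ↓ 1 ]))))
    ≡⟨ distribute (1/ d !) (F 1) _ _ ⟩
  F 1 * U d (A [ c ↓ 1 ]) (B [ c′ ↓ 1 ])
    + 1/ d ! * ⨁ (allFin d) (λ j → ⨁ (permutations d) (pointed (F ∘ suc) j c c′ (A [ c ↓ 1 ]) (B [ c′ ↓ 1 ])))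
    -- The cycle through 0 is one longer than the cycle of j that remains, hence the recursion at
    -- `F ∘ suc`.
    ≡⟨ cong (F 1 * U d (A [ c ↓ 1 ]) (B [ c′ ↓ 1 ]) +_) (⨁-peel d (F ∘ suc) c c′ (A [ c ↓ 1 ]) (B [ c′ ↓ 1 ])) ⟩
  F 1 * U d (A [ c ↓ 1 ]) (B [ c′ ↓ 1 ])
    + ⨁< d (λ k → F (suc (suc k)) * U (d ℕ.∸ suc k) (A [ c ↓ 1 ] [ c ↓ suc k ]) (B [ c′ ↓ 1 ] [ c′ ↓ suc k ]))
    ≡⟨ cong (F 1 * U d (A [ c ↓ 1 ]) (B [ c′ ↓ 1 ]) +_) (⨁<-cong d (λ k _ → cong (F (suc (suc k)) *_) (U-cong (d ℕ.∸ suc k) (↓-suc A c k) (↓-suc B c′ k)))) ⟩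
  F 1 * U d (A [ c ↓ 1 ]) (B [ c′ ↓ 1 ])
    + ⨁< d (λ k → F (suc (suc k)) * U (d ℕ.∸ suc k) (A [ c ↓ suc (suc k) ]) (B [ c′ ↓ suc (suc k) ]))
    ≡⟨ ⨁<-suc d (λ k → F (suc k) * U (d ℕ.∸ k) (A [ c ↓ suc k ]) (B [ c′ ↓ suc k ])) ⟨
  ⨁< (suc d) (λ k → F (suc k) * U (d ℕ.∸ k) (A [ c ↓ suc k ]) (B [ c′ ↓ suc k ])) ∎
  where
  P₀ = ⨁ (permutations (suc d)) (pointed F zero c c′ A B)
  opaque
    unfolding _+_
    distribute : ∀ a b x y → a * (b * x + y) ≡ b * (a * x) + a * y
    distribute = solve-∀ ℚ-ring
  ↓-suc : ∀ (A : Fin _ → ℤ) c k → A [ c ↓ 1 ] [ c ↓ suc k ] ≗ A [ c ↓ suc (suc k) ]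
  ↓-suc A c k i = trans (lemma (A i) (e c i) (ℤ.+ suc k)) (cong (λ m → A i ℤ.- m ℤ.* e c i) (sym (ℤ.pos-+ 1 (suc k))))
    where
    lemma : ∀ a x k → a ℤ.- 1ℤ ℤ.* x ℤ.- k ℤ.* x ≡ a ℤ.- (1ℤ ℤ.+ k) ℤ.* x
    lemma = ℤ-solve

-- Each point serves once as the mark, and both factors s are split by its colour in the respective
-- colouring. With F = 1 the sum over points is d, which gives the norm; the general F gives the
-- mean.
⨁-weighted : ∀ d (F : ℕ → ℚ) (A B : Fin n → ℤ) →
  1/ d ! * ⨁ (permutations d) (λ σ → ⨁ (allFin d) (λ x → F (cycleLength σ x)) * (s A σ * s B σ))
  ≡ ⨁< d (λ k → F (suc k) * ⨁² n (λ c c′ → U (d ℕ.∸ suc k) (A [ c ↓ suc k ]) (B [ c′ ↓ suc k ])))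
⨁-weighted {n} d F A B = begin
  1/ d ! * ⨁ (permutations d) (λ σ → ⨁ (allFin d) (λ x → F (cycleLength σ x)) * (s A σ * s B σ))
    ≡⟨ cong (1/ d ! *_) (trans (⨁-cong expand) (trans ⨁-swap
         (trans (⨁-cong (λ x → ⨁-⨁²)) ⨁-⨁²))) ⟩
  1/ d ! * ⨁² n (λ c c′ → ⨁ (allFin d) (λ x → ⨁ (permutations d) (pointed F x c c′ A B)))
    ≡⟨ ⨁²-*ˡ ⟨
  ⨁² n (λ c c′ → 1/ d ! * ⨁ (allFin d) (λ x → ⨁ (permutations d) (pointed F x c c′ A B)))
    ≡⟨ ⨁²-cong (λ c c′ → ⨁-peel d F c c′ A B) ⟩
  ⨁² n (λ c c′ → ⨁< d (λ k → F (suc k) * U (d ℕ.∸ suc k) (A [ c ↓ suc k ]) (B [ c′ ↓ suc k ])))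
    ≡⟨ ⨁-⨁² ⟨
  ⨁< d (λ k → ⨁² n (λ c c′ → F (suc k) * U (d ℕ.∸ suc k) (A [ c ↓ suc k ]) (B [ c′ ↓ suc k ])))
    ≡⟨ ⨁<-cong d (λ k _ → ⨁²-*ˡ {c = F (suc k)} {λ c c′ → U (d ℕ.∸ suc k) (A [ c ↓ suc k ]) (B [ c′ ↓ suc k ])}) ⟩
  ⨁< d (λ k → F (suc k) * ⨁² n (λ c c′ → U (d ℕ.∸ suc k) (A [ c ↓ suc k ]) (B [ c′ ↓ suc k ]))) ∎
  where
  expand : ∀ σ → ⨁ (allFin d) (λ x → F (cycleLength σ x)) * (s A σ * s B σ) ≡ ⨁ (allFin d) (λ x → ⨁² n (λ c c′ → pointed F x c c′ A B σ))
  expand σ = trans (sym ⨁-*ʳ) (⨁-cong (λ x → trans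
    (cong (F (cycleLength σ x) *_) (trans (cong₂ _*_ (s-sAt A σ x) (s-sAt B σ x)) ⨁-*-⨁))
    (sym ⨁²-*ˡ)))

total-↓ : ∀ (A : Fin n → ℤ) c m → total (A [ c ↓ m ]) + fromℕ m ≡ total A
total-↓ {n} A c m = begin
  total (A [ c ↓ m ]) + fromℕ m
    ≡⟨ cong (total (A [ c ↓ m ]) +_) (⨁-pick-Fin (λ _ → fromℕ m) c) ⟨
  total (A [ c ↓ m ]) + ⨁ (allFin n) (λ i → 𝟙 (i Fin.≟ c) * fromℕ m)
    ≡⟨ ⨁-+ ⟨
  ⨁ (allFin n) (λ i → fromℤ ((A [ c ↓ m ]) i) + 𝟙 (i Fin.≟ c) * fromℕ m)
    ≡⟨ ⨁-cong pointwise ⟩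
  total A ∎
  where
  pointwise : ∀ i → fromℤ ((A [ c ↓ m ]) i) + 𝟙 (i Fin.≟ c) * fromℕ m ≡ fromℤ (A i)
  pointwise i with toSum (i Fin.≟ c)
  ... | inj₁ refl rewrite 𝟙-yes (i Fin.≟ i) refl = trans (cong₂ _+_ (cong fromℤ (↓-same A i m)) (*-identityˡ (fromℕ m)))
    (trans (sym (fromℤ-+ (A i ℤ.- ℤ.+ m) (ℤ.+ m))) (cong fromℤ (cancel (A i) (ℤ.+ m))))
    where
    cancel : ∀ a b → a ℤ.- b ℤ.+ b ≡ a
    cancel = ℤ-solve
  ... | inj₂ i≢c rewrite 𝟙-no (i Fin.≟ c) i≢c = trans (cong₂ _+_ (cong fromℤ (↓-other A m (i≢c ∘ sym))) (zeroˡ (fromℕ m))) (+-identityʳ _)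

bounded : ∀ (A : Fin n → ℤ) → ∃[ M ] (∀ i → A i ℤ.≤ ℤ.+ M)
bounded {zero}  A = 0 , λ ()
bounded {suc n} A with M , A≤M ← bounded (A ∘ suc) = ℤ.∣ A zero ∣ ℕ.+ M , λ
  { zero    → ℤ.≤-trans (i≤∣i∣ (A zero)) (ℤ.+≤+ (ℕ.m≤m+n _ M))
  ; (suc i) → ℤ.≤-trans (A≤M i) (ℤ.+≤+ (ℕ.m≤n+m M _)) }
  where
  i≤∣i∣ : ∀ i → i ℤ.≤ ℤ.+ ℤ.∣ i ∣
  i≤∣i∣ (ℤ.+ m)  = ℤ.≤-refl
  i≤∣i∣ -[1+ m ] = ℤ.-≤+

module _ {n d} (A : Fin n → ℤ) (total-A : total A ≡ fromℕ d + total (δ {n})) where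

  private
    opaque
      unfolding _+_
      cancel-sum : ∀ {t m m′ u} → t + m ≡ (m′ + m) + u → t ≡ m′ + u
      cancel-sum {t} {m} {m′} {u} eq = trans (lemma₁ t m) (trans (cong (_+ - m) eq) (lemma₂ m m′ u))
        where
        lemma₁ : ∀ t m → t ≡ t + m + - m
        lemma₁ = solve-∀ ℚ-ring
        lemma₂ : ∀ m m′ u → m′ + m + u + - m ≡ m′ + u
        lemma₂ = solve-∀ ℚ-ring

  total-lowered : ∀ c {k} → k ℕ.< d → total (A [ c ↓ suc k ]) ≡ fromℕ (d ℕ.∸ suc k) + total (δ {n})
  total-lowered c {k} k<d = cancel-sum (trans (total-↓ A c (suc k)) (trans total-A (cong (_+ total (δ {n}))
    (trans (cong fromℕ (sym (ℕ.m∸n+n≡m k<d))) (fromℕ-+ (d ℕ.∸ suc k) (suc k))))))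

  total-too-low : ∀ c {k} → d ℕ.≤ k → ¬ (total (δ {n}) ℚ.≤ total (A [ c ↓ suc k ]))
  total-too-low c {k} d≤k δ≤ = ℕ.<⇒≱ (ℕ.s≤s d≤k) (fromℕ-cancel-≤ (cancel-≤ (subst ((total (δ {n}) + fromℕ (suc k)) ℚ.≤_)
    (trans (total-↓ A c (suc k)) total-A) (+-mono-≤ δ≤ (ℚ.≤-refl {fromℕ (suc k)})))))
    where
    opaque
      unfolding _+_
      cancel-≤ : ∀ {t p q} → t + p ℚ.≤ q + t → p ℚ.≤ q
      cancel-≤ {t} {p} {q} le = subst₂ ℚ._≤_ (lemma₁ t p) (lemma₂ t q) (ℚ.+-monoʳ-≤ (- t) le)
        where
        lemma₁ : ∀ t p → - t + (t + p) ≡ p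
        lemma₁ = solve-∀ ℚ-ring
        lemma₂ : ∀ t q → - t + (q + t) ≡ q
        lemma₂ = solve-∀ ℚ-ring

  -- Peeling stops at cycle length d, whereas the Euler identity runs up to a bound for the entries
  -- of A. Lowering by more than d brings the total below `total δ`, where `G-degenerate` applies.
  ⨁<-G-extend : ∀ {M} (F : ℕ → ℚ) B → d ℕ.≤ M →
    ⨁< M (λ k → F k * ⨁² n (λ c c′ → G (A [ c ↓ suc k ]) (B [ c′ ↓ suc k ])))
    ≡ ⨁< d (λ k → F k * ⨁² n (λ c c′ → G (A [ c ↓ suc k ]) (B [ c′ ↓ suc k ])))
  ⨁<-G-extend F B d≤M = ⨁<-vanish _ d≤M (λ k d≤k → trans (cong (F k *_) (⨁-zero (λ c → ⨁-zero (λ c′ →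
    G-degenerate (A [ c ↓ suc k ]) (B [ c′ ↓ suc k ]) (total-too-low c d≤k))))) (zeroʳ (F k)))

s-empty : ∀ (A : Fin n → ℤ) (σ : Permutation′ 0) → s A σ ≡ Alt A δ
s-empty A σ = trans ⨁-∷ (trans (cong₂ _+_ (trans (cong₂ _*_ (𝟙-yes (fixed? σ _) (λ ())) (Alt-cong {B = δ} (λ i → trans (cong (λ y → A i ℤ.- y) (cnt-[] _ i)) (ℤ.+-identityʳ (A i))) (λ _ → refl))) (*-identityˡ (Alt A δ))) ⨁-[]) (+-identityʳ (Alt A δ)))

-- Both sides obey one recursion: `⨁-weighted` with weight 1 expresses d times `U` by values at
-- lowered vectors, and `G-euler` does the same for d times `G`, as `total A - total δ` is d. In
-- `go`, N is fuel for a strong induction, since a removed cycle may contain many points.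
U≡G : ∀ d (A B : Fin n → ℤ) → total A ≡ fromℕ d + total (δ {n}) → U d A B ≡ G A B
U≡G {n} d A B = go d d ℕ.≤-refl A B
  where
  go : ∀ N d → d ℕ.≤ N → (A B : Fin n → ℤ) → total A ≡ fromℕ d + total (δ {n}) → U d A B ≡ G A B
  go N zero _ A B total-A = begin
    1/ 0 ! * ⨁ (permutations 0) (λ σ → s A σ * s B σ)  ≡⟨ *-identityˡ _ ⟩
    ⨁ (permutations 0) (λ σ → s A σ * s B σ)           ≡⟨ ⨁-∷ ⟩
    s A idₚ * s B idₚ + ⨁ [] (λ σ → s A σ * s B σ)      ≡⟨ cong₂ _+_ (cong₂ _*_ (s-empty A idₚ) (s-empty B idₚ)) ⨁-[] ⟩
    Alt A δ * Alt B δ + 0ℚ                             ≡⟨ +-identityʳ _ ⟩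
    Alt A δ * Alt B δ                                  ≡⟨ G-minimal A B (trans total-A (+-identityˡ (total (δ {n})))) ⟩
    G A B                                              ∎
  go (suc N) d@(suc d′) (ℕ.s≤s d′≤N) A B total-A with M , A≤M ← bounded A = *-cancelˡ-≢0 (fromℕ d) (fromℕ-suc≢0 d′) (begin
    fromℕ d * U d A B
      ≡⟨ exchange (fromℕ d) (1/ d !) _ ⟩
    1/ d ! * (fromℕ d * ⨁ (permutations d) (λ σ → s A σ * s B σ))
      ≡⟨ cong (1/ d ! *_) ⨁-*ˡ ⟨
    1/ d ! * ⨁ (permutations d) (λ σ → fromℕ d * (s A σ * s B σ))
      ≡⟨ cong (1/ d ! *_) (⨁-cong (λ σ → cong (_* (s A σ * s B σ)) (trans ⨁-allFin-const (*-identityʳ (fromℕ d))))) ⟨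
    1/ d ! * ⨁ (permutations d) (λ σ → ⨁ (allFin d) (λ x → 1ℚ) * (s A σ * s B σ))
      ≡⟨ ⨁-weighted d (λ _ → 1ℚ) A B ⟩
    ⨁< d (λ k → 1ℚ * ⨁² n (λ c c′ → U (d′ ℕ.∸ k) (A [ c ↓ suc k ]) (B [ c′ ↓ suc k ])))
      ≡⟨ ⨁<-cong d (λ k k<d → cong (1ℚ *_) (⨁²-cong (λ c c′ → go N (d′ ℕ.∸ k) (ℕ.≤-trans (ℕ.m∸n≤m d′ k) d′≤N)
           (A [ c ↓ suc k ]) (B [ c′ ↓ suc k ]) (total-lowered A total-A c k<d)))) ⟩
    ⨁< d (λ k → 1ℚ * ⨁² n (λ c c′ → G (A [ c ↓ suc k ]) (B [ c′ ↓ suc k ])))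
      ≡⟨ ⨁<-G-extend A total-A (λ _ → 1ℚ) B (ℕ.m≤m+n d M) ⟨
    ⨁< (d ℕ.+ M) (λ k → 1ℚ * ⨁² n (λ c c′ → G (A [ c ↓ suc k ]) (B [ c′ ↓ suc k ])))
      ≡⟨ ⨁<-cong (d ℕ.+ M) (λ k _ → *-identityˡ (⨁² n (λ c c′ → G (A [ c ↓ suc k ]) (B [ c′ ↓ suc k ])))) ⟩
    ⨁< (d ℕ.+ M) (λ k → ⨁² n (λ c c′ → G (A [ c ↓ suc k ]) (B [ c′ ↓ suc k ])))
      ≡⟨ G-euler A B (λ i → ℤ.≤-trans (A≤M i) (ℤ.+≤+ (ℕ.m≤n+m M d))) ⟩
    (total A + - total (δ {n})) * G A B
      ≡⟨ cong (_* G A B) (trans (cong (_+ - total (δ {n})) total-A) (cancel (fromℕ d) (total (δ {n})))) ⟩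
    fromℕ d * G A B ∎)
    where
    opaque
      unfolding _+_
      cancel : ∀ a b → a + b + - b ≡ a
      cancel = solve-∀ ℚ-ring

module _ {n d} (x : Fin n → ℕ) (x-injective : ∀ {i j} → x i ≡ x j → i ≡ j)
         (total-x : total (λ i → ℤ.+ x i) ≡ fromℕ d + total (δ {n})) where

  private
    x⁺ : Fin n → ℤ
    x⁺ i = ℤ.+ x i

  s-norm : ⨁ (permutations d) (λ σ → s x⁺ σ * s x⁺ σ) ≡ fromℕ (d !)
  s-norm = *-cancelˡ-≢0 (1/ d !) 1/!≢0 (trans (U≡G d x⁺ x⁺ total-x) (trans
    (cong₂ _*_ (𝟙-yes (nonneg? x⁺) (λ i → ℤ.+≤+ ℕ.z≤n)) (Alt-self {A = x⁺} (x-injective ∘ ℤ.+-injective)))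
    (trans (*-identityˡ 1ℚ) (trans (sym (!*1/! d)) (*-comm (fromℕ (d !)) (1/ d !))))))
    where
    1/!≢0 : 1/ d ! ≢ 0ℚ
    1/!≢0 eq with () ← trans (sym (!*1/! d)) (trans (cong (fromℕ (d !) *_) eq) (zeroʳ (fromℕ (d !))))

  s-weighted : ∀ (F : ℕ → ℚ) →
    1/ d ! * ⨁ (permutations d) (λ σ → ⨁ (allFin d) (λ y → F (cycleLength σ y)) * (s x⁺ σ * s x⁺ σ))
    ≡ ⨁ (allFin n) (λ i → ⨁< (x i) (F ∘ suc)) + - ⨁² n (λ i i′ → ⨁< (x i) (λ k → 𝟙 (x i ℕ.≟ x i′ ℕ.+ suc k) * F (suc k)))
  s-weighted F with M , x≤M ← bounded x⁺ = begin
    1/ d ! * ⨁ (permutations d) (λ σ → ⨁ (allFin d) (λ y → F (cycleLength σ y)) * (s x⁺ σ * s x⁺ σ))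
      ≡⟨ ⨁-weighted d F x⁺ x⁺ ⟩
    ⨁< d (λ k → F (suc k) * ⨁² n (λ c c′ → U (d ℕ.∸ suc k) (x⁺ [ c ↓ suc k ]) (x⁺ [ c′ ↓ suc k ])))
      ≡⟨ ⨁<-cong d (λ k k<d → cong (F (suc k) *_) (⨁²-cong (λ c c′ → U≡G (d ℕ.∸ suc k) (x⁺ [ c ↓ suc k ]) (x⁺ [ c′ ↓ suc k ]) (total-lowered x⁺ total-x c k<d)))) ⟩
    ⨁< d (λ k → F (suc k) * ⨁² n (λ c c′ → G (x⁺ [ c ↓ suc k ]) (x⁺ [ c′ ↓ suc k ])))
      ≡⟨ ⨁<-G-extend x⁺ total-x (F ∘ suc) x⁺ (ℕ.m≤m+n d M) ⟨
    ⨁< (d ℕ.+ M) (λ k → F (suc k) * ⨁² n (λ c c′ → G (x⁺ [ c ↓ suc k ]) (x⁺ [ c′ ↓ suc k ])))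
      ≡⟨ G-distinct x x-injective (F ∘ suc) (λ i → ℕ.≤-trans (ℤ.drop‿+≤+ (x≤M i)) (ℕ.m≤n+m M d)) ⟩
    ⨁ (allFin n) (λ i → ⨁< (x i) (F ∘ suc)) + - ⨁² n (λ i i′ → ⨁< (x i) (λ k → 𝟙 (x i ℕ.≟ x i′ ℕ.+ suc k) * F (suc k))) ∎


-- The group algebra

infixl 7 _⋆_
infixr 7 _▹_

-- A copy of `_*ᴬ_` built on the opaque sum, as `_▹_` is one of `_•_`; `coeff-*ᴬ` identifies the two
-- products.
_⋆_ : ℚ[S d ] → ℚ[S d ] → ℚ[S d ]
_⋆_ {d} x y = record
  { coeff      = λ σ → ⨁ (permutations d) (λ τ → coeff x τ * coeff y (flip τ · σ))
  ; coeff-cong = λ σ σ′ σ≈ → ⨁-cong (λ τ → cong (coeff x τ *_)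
      (coeff-cong y (flip τ · σ) (flip τ · σ′) (λ i → cong (τ ⟨$⟩ˡ_) (σ≈ i))))
  }

_▹_ : Permutation′ d → ℚ[S d ] → ℚ[S d ]
τ ▹ x = record
  { coeff      = λ σ → coeff x (flip τ · σ)
  ; coeff-cong = λ σ σ′ σ≈ → coeff-cong x (flip τ · σ) (flip τ · σ′) (λ i → cong (τ ⟨$⟩ˡ_) (σ≈ i))
  }

⋆-congʳ : ∀ (x : ℚ[S d ]) {y z : ℚ[S d ]} → y ≈ᴬ z → x ⋆ y ≈ᴬ x ⋆ z
⋆-congʳ {d} x y≈z σ = ⨁-cong (λ τ → cong (coeff x τ *_) (y≈z (flip τ · σ)))

⋆-summand-cong : ∀ (x y : ℚ[S d ]) σ → PermE.Respects (λ τ → coeff x τ * coeff y (flip τ · σ))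
⋆-summand-cong x y σ {τ} {τ′} τ≈ = cong₂ _*_ (coeff-cong x τ τ′ τ≈)
  (coeff-cong y (flip τ · σ) (flip τ′ · σ) (λ i → flip-cong {σ = τ} {τ′} τ≈ (σ ⟨$⟩ʳ i)))

▹-⋆ : ∀ (τ : Permutation′ d) x y → τ ▹ (x ⋆ y) ≈ᴬ (τ ▹ x) ⋆ y
▹-⋆ {d} τ x y σ = trans
  (⨁-cong (λ ρ → cong₂ _*_
    (coeff-cong x ρ (flip τ · τ · ρ) (λ i → sym (inverseˡ τ)))
    (coeff-cong y (flip ρ · flip τ · σ) (flip (τ · ρ) · σ) (λ _ → refl))))
  (⨁-left τ (λ {ρ} {ρ′} → ⋆-summand-cong (τ ▹ x) y σ {ρ} {ρ′}))

-- Expanding the middle factor into permutations leaves products of x with translates of z. In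
-- `sandwich` this reduces an arbitrary middle factor to the case of a single τ.
⋆-▹ : ∀ (x y z : ℚ[S d ]) σ → coeff (x ⋆ (y ⋆ z)) σ ≡ ⨁ (permutations d) (λ τ → coeff y τ * coeff (x ⋆ (τ ▹ z)) σ)
⋆-▹ {d} x y z σ = trans
  (⨁-cong (λ ρ → sym ⨁-*ˡ))
  (trans ⨁-swap
    (⨁-cong (λ τ → trans
      (⨁-cong (λ ρ → trans (exchange (coeff x ρ) (coeff y τ) (coeff z (flip τ · flip ρ · σ)))
        (cong (λ w → coeff y τ * (coeff x ρ * w)) (coeff-cong z (flip τ · flip ρ · σ) (flip τ · (flip ρ · σ)) (λ _ → refl)))))
      ⨁-*ˡ)))

⋆-assoc : ∀ (x y z : ℚ[S d ]) → (x ⋆ y) ⋆ z ≈ᴬ x ⋆ (y ⋆ z)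
⋆-assoc {d} x y z σ = begin
  ⨁ (permutations d) (λ τ → coeff (x ⋆ y) τ * coeff z (flip τ · σ))
    ≡⟨ ⨁-cong (λ τ → sym ⨁-*ʳ) ⟩
  ⨁ (permutations d) (λ τ → ⨁ (permutations d) (λ ρ → coeff x ρ * coeff y (flip ρ · τ) * coeff z (flip τ · σ)))
    ≡⟨ ⨁-swap ⟩
  ⨁ (permutations d) (λ ρ → ⨁ (permutations d) (λ τ → coeff x ρ * coeff y (flip ρ · τ) * coeff z (flip τ · σ)))
    ≡⟨ ⨁-cong (λ ρ → trans (⨁-cong (λ τ → *-assoc (coeff x ρ) _ _))
         ⨁-*ˡ) ⟩
  ⨁ (permutations d) (λ ρ → coeff x ρ * coeff ((ρ ▹ y) ⋆ z) σ)
    ≡⟨ ⨁-cong (λ ρ → cong (coeff x ρ *_) (▹-⋆ ρ y z σ)) ⟨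
  ⨁ (permutations d) (λ ρ → coeff x ρ * coeff (y ⋆ z) (flip ρ · σ)) ∎

⋆-trace : ∀ (x y : ℚ[S d ]) → coeff (x ⋆ y) idₚ ≡ coeff (y ⋆ x) idₚ
⋆-trace {d} x y = trans
  (sym (⨁-flip (λ {σ} {τ} → ⋆-summand-cong x y idₚ {σ} {τ})))
  (⨁-cong (λ τ → trans (*-comm (coeff x (flip τ)) _) (cong₂ _*_
    (coeff-cong y (flip (flip τ) · idₚ) τ (λ _ → refl)) (coeff-cong x (flip τ) (flip τ · idₚ) (λ _ → refl)))))

⨁-permutations-1 : ∀ d → ⨁ (permutations d) (λ _ → 1ℚ) ≡ fromℕ (d !)
⨁-permutations-1 zero    = trans ⨁-∷ (trans (cong (1ℚ +_) ⨁-[]) (+-identityʳ 1ℚ))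
⨁-permutations-1 (suc d) = trans (⨁-attach {f = λ _ → 1ℚ} (λ _ → refl)) (trans
  (⨁-cong (λ _ → ⨁-permutations-1 d)) (trans ⨁-allFin-const (sym (fromℕ-* (suc d) (d !)))))

⨁-permutations-const : ∀ {d c} → ⨁ (permutations d) (λ _ → c) ≡ fromℕ (d !) * c
⨁-permutations-const {d} {c} = trans (⨁-cong (λ _ → sym (*-identityˡ c)))
  (trans ⨁-*ʳ (cong (_* c) (⨁-permutations-1 d)))

-- The trace of `y ↦ σ⁻¹ y x` on the group algebra. It is not normalised: a class function would be
-- multiplied by `d !`.
averaged : ℚ[S d ] → Permutation′ d → ℚ
averaged {d} x σ = ⨁ (permutations d) (λ τ → coeff x (flip τ · σ · τ))

averaged-conj : ∀ (x : ℚ[S d ]) ρ σ → averaged x (ρ · σ · flip ρ) ≡ averaged x σ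
averaged-conj {d} x ρ σ = trans
  (⨁-cong (λ τ → coeff-cong x (flip τ · (ρ · σ · flip ρ) · τ) (flip (flip ρ · τ) · σ · (flip ρ · τ)) (λ _ → refl)))
  (⨁-left (flip ρ) {λ τ → coeff x (flip τ · σ · τ)} (λ {τ} {τ′} τ≈ → coeff-cong x (flip τ · σ · τ) (flip τ′ · σ · τ′)
    (λ i → trans (flip-cong {σ = τ} {τ′} τ≈ _) (cong (λ j → τ′ ⟨$⟩ˡ (σ ⟨$⟩ʳ j)) (τ≈ i)))))

averaged-cong : ∀ (x : ℚ[S d ]) {σ σ′} → σ ≈ₚ σ′ → averaged x σ ≡ averaged x σ′
averaged-cong {d} x {σ} {σ′} σ≈ = ⨁-cong (λ τ → coeff-cong x (flip τ · σ · τ) (flip τ · σ′ · τ) (λ i → cong (τ ⟨$⟩ˡ_) (σ≈ (τ ⟨$⟩ʳ i))))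

-- A class function does not see the averaging: conjugating the summation variable restores the
-- unaveraged pairing, once for each of the `d !` permutations τ.
⨁-averaged : ∀ (x : ℚ[S d ]) {f : Permutation′ d → ℚ} → (∀ σ τ → σ ≈ₚ τ → f σ ≡ f τ) → (∀ ρ σ → f (ρ · σ · flip ρ) ≡ f σ) →
             ⨁ (permutations d) (λ σ → averaged x σ * f σ) ≡ fromℕ (d !) * ⨁ (permutations d) (λ σ → coeff x σ * f σ)
⨁-averaged {d} x {f} f-cong f-class = begin
  ⨁ (permutations d) (λ σ → averaged x σ * f σ)
    ≡⟨ ⨁-cong (λ σ → sym ⨁-*ʳ) ⟩
  ⨁ (permutations d) (λ σ → ⨁ (permutations d) (λ τ → coeff x (flip τ · σ · τ) * f σ))
    ≡⟨ ⨁-swap ⟩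
  ⨁ (permutations d) (λ τ → ⨁ (permutations d) (λ σ → coeff x (flip τ · σ · τ) * f σ))
    ≡⟨ ⨁-cong (λ τ → ⨁-conj τ {λ σ → coeff x (flip τ · σ · τ) * f σ} (λ {σ} {σ′} σ≈ → cong₂ _*_
         (coeff-cong x (flip τ · σ · τ) (flip τ · σ′ · τ) (λ i → cong (τ ⟨$⟩ˡ_) (σ≈ (τ ⟨$⟩ʳ i)))) (f-cong σ σ′ σ≈))) ⟨
  ⨁ (permutations d) (λ τ → ⨁ (permutations d) (λ σ → coeff x (flip τ · (τ · σ · flip τ) · τ) * f (τ · σ · flip τ)))
    ≡⟨ ⨁-cong (λ τ → ⨁-cong (λ σ → cong₂ _*_
         (coeff-cong x (flip τ · (τ · σ · flip τ) · τ) σ (λ i → trans (inverseˡ τ) (cong (σ ⟨$⟩ʳ_) (inverseˡ τ)))) (f-class τ σ))) ⟩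
  ⨁ (permutations d) (λ τ → ⨁ (permutations d) (λ σ → coeff x σ * f σ))
    ≡⟨ ⨁-permutations-const ⟩
  fromℕ (d !) * ⨁ (permutations d) (λ σ → coeff x σ * f σ) ∎

-- The products ρ π and π ρ are conjugate, so x y and y x have the same sum over each class. The
-- translation of τ by `flip ρ` performs this conjugation.
averaged-⋆ : ∀ (x y : ℚ[S d ]) σ → averaged (x ⋆ y) σ ≡ averaged (y ⋆ x) σ
averaged-⋆ {d} x y σ = begin
  ⨁ (permutations d) (λ τ → ⨁ (permutations d) (λ ρ → coeff x ρ * coeff y (flip ρ · flip τ · σ · τ)))
    ≡⟨ ⨁-swap ⟩
  ⨁ (permutations d) (λ ρ → ⨁ (permutations d) (λ τ → coeff x ρ * coeff y (flip ρ · flip τ · σ · τ)))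
    ≡⟨ ⨁-cong (λ ρ → ⨁-right (flip ρ) {λ τ → coeff x ρ * coeff y (flip ρ · flip τ · σ · τ)} (λ {τ} {τ′} τ≈ →
         cong (coeff x ρ *_) (coeff-cong y (flip ρ · flip τ · σ · τ) (flip ρ · flip τ′ · σ · τ′)
           (λ i → cong (ρ ⟨$⟩ˡ_) (trans (flip-cong {σ = τ} {τ′} τ≈ _) (cong (λ j → τ′ ⟨$⟩ˡ (σ ⟨$⟩ʳ j)) (τ≈ i))))))) ⟨
  ⨁ (permutations d) (λ ρ → ⨁ (permutations d) (λ τ → coeff x ρ * coeff y (flip ρ · flip (τ · flip ρ) · σ · (τ · flip ρ))))
    ≡⟨ ⨁-cong (λ ρ → ⨁-cong (λ τ → cong (coeff x ρ *_)
         (coeff-cong y (flip ρ · flip (τ · flip ρ) · σ · (τ · flip ρ)) ((flip τ · σ · τ) · flip ρ) (λ i → inverseˡ ρ)))) ⟩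
  ⨁ (permutations d) (λ ρ → ⨁ (permutations d) (λ τ → coeff x ρ * coeff y ((flip τ · σ · τ) · flip ρ)))
    ≡⟨ ⨁-swap ⟩
  ⨁ (permutations d) (λ τ → ⨁ (permutations d) (λ ρ → coeff x ρ * coeff y ((flip τ · σ · τ) · flip ρ)))
    ≡⟨ ⨁-cong (λ τ → convert (flip τ · σ · τ)) ⟩
  ⨁ (permutations d) (λ τ → coeff (y ⋆ x) (flip τ · σ · τ)) ∎
  where
  convert : ∀ g → ⨁ (permutations d) (λ ρ → coeff x ρ * coeff y (g · flip ρ)) ≡ coeff (y ⋆ x) g
  convert g = begin
    ⨁ (permutations d) (λ ρ → coeff x ρ * coeff y (g · flip ρ))
      ≡⟨ ⨁-flip {f = λ ρ → coeff x ρ * coeff y (g · flip ρ)} (λ {ρ} {ρ′} ρ≈ → cong₂ _*_ (coeff-cong x ρ ρ′ ρ≈)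
           (coeff-cong y (g · flip ρ) (g · flip ρ′) (λ i → cong (g ⟨$⟩ʳ_) (flip-cong {σ = ρ} {ρ′} ρ≈ i)))) ⟨
    ⨁ (permutations d) (λ ρ → coeff x (flip ρ) * coeff y (g · flip (flip ρ)))
      ≡⟨ ⨁-cong (λ ρ → trans (*-comm (coeff x (flip ρ)) _) (cong₂ _*_ (coeff-cong y (g · flip (flip ρ)) (g · ρ) (λ _ → refl))
           (coeff-cong x (flip ρ) (flip (g · ρ) · g) (λ i → cong (ρ ⟨$⟩ˡ_) (sym (inverseˡ g)))))) ⟩
    ⨁ (permutations d) (λ ρ → coeff y (g · ρ) * coeff x (flip (g · ρ) · g))
      ≡⟨ ⨁-left g (λ {σ} {τ} → ⋆-summand-cong y x g {σ} {τ}) ⟩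
    coeff (y ⋆ x) g ∎

-- Young symmetrizers

⨁-lookup : ∀ {I : Set} (xs : List I) (φ : I → ℚ) → ⨁ (allFin (length xs)) (φ ∘ lookup xs) ≡ ⨁ xs φ
⨁-lookup []       φ = trans ⨁-[] (sym ⨁-[])
⨁-lookup (x ∷ xs) φ = trans ⨁-allFin-suc (trans (cong (φ x +_) (⨁-lookup xs φ)) (sym ⨁-∷))

head≥lookup : ∀ {x xs} → Linked ℕ._≥_ (x ∷ xs) → ∀ i → lookup xs i ℕ.≤ x
head≥lookup {xs = y ∷ ys} (y≤x ∷ linked) zero    = y≤x
head≥lookup {xs = y ∷ ys} (y≤x ∷ linked) (suc i) = ℕ.≤-trans (head≥lookup linked i) y≤x

lookup-antitone : ∀ {xs} → Linked ℕ._≥_ xs → ∀ {i j} → i Fin.≤ j → lookup xs j ℕ.≤ lookup xs i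
lookup-antitone {x ∷ xs} linked     {zero}  {zero}  _   = ℕ.≤-refl
lookup-antitone {x ∷ xs} linked     {zero}  {suc j} _   = head≥lookup linked j
lookup-antitone {x ∷ y ∷ ys} (_ ∷ linked) {suc i} {suc j} i≤j = lookup-antitone linked (ℕ.≤-pred i≤j)

module _ {d} {μ : Partition d} where

  private
    _~_ : Cell μ → Cell μ → Set
    ξ ~ η = row ξ ≡ row η × column ξ ≡ column η

  ~⇒≡ : ∀ {ξ η : Cell μ} → row ξ ≡ row η → column ξ ≡ column η → ξ ≡ η
  ~⇒≡ {cell i j} {cell i′ j′} p q with refl ← Fin.toℕ-injective p with refl ← Fin.toℕ-injective q = refl

  ⨁-cells : ∀ (φ : Cell μ → ℚ) → ⨁ (cells μ) φ ≡ ⨁ (allFin (length (parts μ))) (λ i → ⨁ (allFin (lookup (parts μ) i)) (φ ∘ cell i))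
  ⨁-cells φ = trans ⨁-concatMap
    (⨁-cong (λ i → ⨁-map (cell i) (allFin (lookup (parts μ) i)) φ))

  Cell-enumeration : Enumeration (Cell μ)
  Cell-enumeration = record
    { elements = cells μ ; _~_ = _~_ ; _~?_ = λ ξ η → (row ξ ℕ.≟ row η) ×-dec (column ξ ℕ.≟ column η)
    ; ~-sym = λ (p , q) → sym p , sym q ; once = once }
    where
    once : ∀ η → ⨁ (cells μ) (λ ξ → 𝟙 ((row ξ ℕ.≟ row η) ×-dec (column ξ ℕ.≟ column η))) ≡ 1ℚ
    once (cell i₀ j₀) = trans (⨁-cells _) (trans (⨁-cong (λ i → trans
      (⨁-cong (λ j → trans (𝟙-× (toℕ i ℕ.≟ toℕ i₀) (toℕ j ℕ.≟ toℕ j₀))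
        (cong (_* 𝟙 (toℕ j ℕ.≟ toℕ j₀)) (𝟙-⇔ (toℕ i ℕ.≟ toℕ i₀) (i Fin.≟ i₀) Fin.toℕ-injective (cong toℕ)))))
      ⨁-*ˡ))
      (trans (⨁-pick-Fin (λ i → ⨁ (allFin (lookup (parts μ) i)) (λ j → 𝟙 (toℕ j ℕ.≟ toℕ j₀))) i₀)
        (trans (⨁-cong (λ j → 𝟙-⇔ (toℕ j ℕ.≟ toℕ j₀) (j Fin.≟ j₀) Fin.toℕ-injective (cong toℕ)))
          (FinE.once j₀))))

  sum-parts : ⨁ (allFin (length (parts μ))) (λ i → fromℕ (lookup (parts μ) i)) ≡ fromℕ d
  sum-parts = trans (⨁-lookup (parts μ) fromℕ) (trans (sym (sum-⨁ (parts μ))) (cong fromℕ (proj₂ (proj₂ (isPartition μ)))))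

  shifted : Fin (length (parts μ)) → ℕ
  shifted i = lookup (parts μ) i ℕ.+ toℕ (opposite i)

  shifted-decreasing : ∀ {i j} → i Fin.< j → shifted j ℕ.< shifted i
  shifted-decreasing {i} {j} i<j = ℕ.+-mono-≤-< (lookup-antitone (proj₁ (proj₂ (isPartition μ))) (ℕ.<⇒≤ i<j))
    (subst₂ ℕ._<_ (sym (Fin.opposite-prop j)) (sym (Fin.opposite-prop i)) (ℕ.∸-monoʳ-< (ℕ.s≤s i<j) (Fin.toℕ<n j)))

  shifted-injective : ∀ {i j} → shifted i ≡ shifted j → i ≡ j
  shifted-injective {i} {j} eq with Fin.<-cmp i j
  ... | tri< lt _ _ = contradiction (sym eq) (ℕ.<⇒≢ (shifted-decreasing lt))
  ... | tri≈ _ i≡j _ = i≡j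
  ... | tri> _ _ gt = contradiction eq (ℕ.<⇒≢ (shifted-decreasing gt))

  total-shifted : total (λ i → ℤ.+ shifted i) ≡ fromℕ d + total (δ {length (parts μ)})
  total-shifted = trans (⨁-cong (λ i → fromℕ-+ (lookup (parts μ) i) (toℕ (opposite i))))
    (trans ⨁-+ (cong (_+ total (δ {length (parts μ)})) sum-parts))

module Young {d} {μ : Partition d} (t : Tableau μ) where

  private
    h = length (parts μ)

  at : Fin d → Cell μ
  at = Inverse.to t

  rowAt colAt : Fin d → ℕ
  rowAt x = row (at x)
  colAt x = column (at x)

  rowColour : Fin d → Fin h
  rowColour x = Cell.rowIndex (at x)

  rowAt-colour : ∀ x → rowAt x ≡ toℕ (rowColour x)
  rowAt-colour x with at x
  ... | cell i j = refl

  at-injective : ∀ {x y} → rowAt x ≡ rowAt y → colAt x ≡ colAt y → x ≡ y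
  at-injective {x} {y} p q = trans (sym (Inverse.strictlyInverseʳ t x)) (trans (cong (Inverse.from t) (~⇒≡ p q)) (Inverse.strictlyInverseʳ t y))

  down-closed : ∀ y {k} → k ℕ.< rowAt y → ∃[ x ] (rowAt x ≡ k × colAt x ≡ colAt y)
  down-closed y {k} k<row with at y
  ... | cell i j = Inverse.from t ξ , trans (cong row to-from) (Fin.toℕ-fromℕ< k<h) , trans (cong column to-from) (Fin.toℕ-fromℕ< j<)
    where
    k<h : k ℕ.< h
    k<h = ℕ.<-trans k<row (Fin.toℕ<n i)
    j< : toℕ j ℕ.< lookup (parts μ) (Fin.fromℕ< k<h)
    j< = ℕ.<-≤-trans (Fin.toℕ<n j) (lookup-antitone (proj₁ (proj₂ (isPartition μ))) {Fin.fromℕ< k<h} {i}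
           (subst (ℕ._≤ toℕ i) (sym (Fin.toℕ-fromℕ< k<h)) (ℕ.<⇒≤ k<row)))
    ξ = cell (Fin.fromℕ< k<h) (Fin.fromℕ< j<)
    to-from : at (Inverse.from t ξ) ≡ ξ
    to-from = Inverse.strictlyInverseˡ t ξ

  open Sorting rowAt colAt at-injective down-closed public

  -- The conditionals of the symmetrizers are replaced by indicator factors, so that coefficients
  -- can be rearranged by the ring laws.
  rows cols : ℚ[S d ]
  rows = record { coeff = λ σ → 𝟙 (preserves? t row σ)
                ; coeff-cong = λ σ τ σ≈ → 𝟙-⇔ (preserves? t row σ) (preserves? t row τ)
                    (λ p x → trans (cong rowAt (sym (σ≈ x))) (p x)) (λ p x → trans (cong rowAt (σ≈ x)) (p x)) }
  cols = record { coeff = λ σ → 𝟙 (preserves? t column σ) * sgn σ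
                ; coeff-cong = λ σ τ σ≈ → cong₂ _*_ (𝟙-⇔ (preserves? t column σ) (preserves? t column τ)
                    (λ p x → trans (cong colAt (sym (σ≈ x))) (p x)) (λ p x → trans (cong colAt (σ≈ x)) (p x))) (sgn-cong {σ = σ} {τ} σ≈) }

  young : ℚ[S d ]
  young = rows ⋆ cols

  opaque
    unfolding _+_ ⨁ sgn

    young≈youngSymmetrizer : young ≈ᴬ youngSymmetrizer t
    young≈youngSymmetrizer σ = ∑-cong (permutations d) (λ τ → cong (coeff (rowSymmetrizer t) τ *_) (cols≡ (flip τ · σ)))
      where
      cols≡ : ∀ σ → coeff cols σ ≡ coeff (columnAntisymmetrizer t) σ
      cols≡ σ with does (preserves? t column σ)
      ... | true  = *-identityˡ (sign σ)
      ... | false = zeroˡ (sign σ)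

  module _ (f : Cell μ → ℕ) where

    preserves-flip : ∀ σ → Preserves t f σ → Preserves t f (flip σ)
    preserves-flip σ p x = trans (sym (p (σ ⟨$⟩ˡ x))) (cong (f ∘ at) (inverseʳ σ))

    preserves-·ˡ : ∀ σ τ → Preserves t f σ → 𝟙 (preserves? t f (σ · τ)) ≡ 𝟙 (preserves? t f τ)
    preserves-·ˡ σ τ p = 𝟙-⇔ (preserves? t f (σ · τ)) (preserves? t f τ)
      (λ q x → trans (sym (p (τ ⟨$⟩ʳ x))) (q x)) (λ q x → trans (p (τ ⟨$⟩ʳ x)) (q x))

    preserves-·ʳ : ∀ σ τ → Preserves t f τ → 𝟙 (preserves? t f (σ · τ)) ≡ 𝟙 (preserves? t f σ)
    preserves-·ʳ σ τ p = 𝟙-⇔ (preserves? t f (σ · τ)) (preserves? t f σ)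
      (λ q x → trans (cong (λ y → f (at (σ ⟨$⟩ʳ y))) (sym (inverseʳ τ))) (trans (q (τ ⟨$⟩ˡ x)) (trans (sym (p (τ ⟨$⟩ˡ x))) (cong (f ∘ at) (inverseʳ τ)))))
      (λ q x → trans (q (τ ⟨$⟩ʳ x)) (p x))

    preserves-flip-𝟙 : ∀ σ → 𝟙 (preserves? t f (flip σ)) ≡ 𝟙 (preserves? t f σ)
    preserves-flip-𝟙 σ = 𝟙-⇔ (preserves? t f (flip σ)) (preserves? t f σ) (preserves-flip (flip σ)) (preserves-flip σ)

    swap-preserves : ∀ {x y} → f (at x) ≡ f (at y) → Preserves t f (swap x y)
    swap-preserves {x} {y} = swap-elim x y (f ∘ at)

  rows-·ʳ : ∀ {σ} → Preserves t row σ → ∀ g → coeff rows (g · σ) ≡ coeff rows g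
  rows-·ʳ {σ} p g = preserves-·ʳ row g σ p

  cols-·ˡ : ∀ {σ} → Preserves t column σ → ∀ g → coeff cols (σ · g) ≡ sgn σ * coeff cols g
  cols-·ˡ {σ} p g = trans (cong₂ _*_ (preserves-·ˡ column σ g p) (sgn-· σ g)) (exchange (𝟙 (preserves? t column g)) (sgn σ) (sgn g))

  cols-·ʳ : ∀ {σ} → Preserves t column σ → ∀ g → coeff cols (g · σ) ≡ sgn σ * coeff cols g
  cols-·ʳ {σ} p g = trans (cong₂ _*_ (preserves-·ʳ column g σ p) (sgn-· g σ)) (commute (𝟙 (preserves? t column g)) (sgn g) (sgn σ))
    where
    opaque
      unfolding _+_
      commute : ∀ a b c → a * (b * c) ≡ c * (a * b)
      commute = solve-∀ ℚ-ring

  rows-flip : ∀ σ → coeff rows (flip σ) ≡ coeff rows σ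
  rows-flip = preserves-flip-𝟙 row

  cols-flip : ∀ σ → coeff cols (flip σ) ≡ coeff cols σ
  cols-flip σ = cong₂ _*_ (preserves-flip-𝟙 column σ) (sgn-flip σ)

  young-·ʳ : ∀ {σ} → Preserves t column σ → ∀ g → coeff young (g · σ) ≡ sgn σ * coeff young g
  young-·ʳ {σ} p g = trans (⨁-cong (λ τ → trans
      (cong (coeff rows τ *_) (trans (coeff-cong cols (flip τ · g · σ) ((flip τ · g) · σ) (λ _ → refl)) (cols-·ʳ {σ} p (flip τ · g))))
      (exchange (coeff rows τ) (sgn σ) (coeff cols (flip τ · g)))))
    ⨁-*ˡ

  -- A factor p of `1 = p q`, with p preserving rows and q columns, preserves both and hence fixes
  -- every cell.
  young-id : coeff young idₚ ≡ 1ℚ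
  young-id = begin
    ⨁ (permutations d) (λ τ → coeff rows τ * coeff cols (flip τ · idₚ))
      ≡⟨ ⨁-cong (λ τ → trans (cong (coeff rows τ *_) (trans (coeff-cong cols (flip τ · idₚ) (flip τ) (λ _ → refl)) (cols-flip τ)))
           (trans (sym (*-assoc (coeff rows τ) (𝟙 (preserves? t column τ)) (sgn τ))) (cong (_* sgn τ) (trans
             (sym (𝟙-× (preserves? t row τ) (preserves? t column τ)))
             (𝟙-⇔ (preserves? t row τ ×-dec preserves? t column τ) (τ ≈ₚ? idₚ) (λ (p , q) x → at-injective (p x) (q x))
               (λ eq → (λ x → cong rowAt (eq x)) , (λ x → cong colAt (eq x)))))))) ⟩
    ⨁ (permutations d) (λ τ → 𝟙 (τ ≈ₚ? idₚ) * sgn τ)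
      ≡⟨ PermE.⨁-pick (λ {σ} {τ} → sgn-cong {σ = σ} {τ}) idₚ ⟩
    sgn (idₚ {d})
      ≡⟨ sgn-id {d} ⟩
    1ℚ ∎

  ⨁-rowAt : ∀ (σ : Permutation′ d) → ⨁ (allFin d) (λ x → fromℕ (rowAt (σ ⟨$⟩ʳ x))) ≡ ⨁ (allFin d) (λ x → fromℕ (rowAt x))
  ⨁-rowAt σ = ⨁-permute σ (fromℕ ∘ rowAt)

  -- Von Neumann's lemma.
  rows⋆▹cols : ∀ τ → ∃[ k ] (∀ σ → coeff (rows ⋆ (τ ▹ cols)) σ ≡ k * coeff young σ)
  rows⋆▹cols τ with collision⊎sortedBelow (λ x → rowAt (τ ⟨$⟩ʳ x))
  -- Two points of one column are sent by τ into one row. Their transposition u is a column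
  -- permutation and its conjugate v by τ a row permutation; `rows` absorbs v with sign 1 and `cols`
  -- absorbs u with sign -1, so the product is its own negative.
  ... | inj₁ (x , y , x≢y , col≡ , row≡) = 0ℚ , λ σ → trans (p≡-p⇒p≡0 (begin
    ⨁ (permutations d) (λ ρ → coeff rows ρ * coeff cols (flip τ · flip ρ · σ))
      ≡⟨ ⨁-right v (λ {ρ} {ρ′} → ⋆-summand-cong rows (τ ▹ cols) σ {ρ} {ρ′}) ⟨
    ⨁ (permutations d) (λ ρ → coeff rows (ρ · v) * coeff cols (flip τ · flip (ρ · v) · σ))
      ≡⟨ ⨁-cong (λ ρ → trans
           (cong₂ _*_ (rows-·ʳ {v} v-rows ρ) (trans
             (coeff-cong cols (flip τ · flip (ρ · v) · σ) (u · flip τ · flip ρ · σ) (λ z → trans (inverseˡ τ) (flip-swap x y _)))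
             (trans (cols-·ˡ {u} u-cols (flip τ · flip ρ · σ)) (cong (_* coeff cols (flip τ · flip ρ · σ)) (sgn-swap x≢y)))))
           (negate (coeff rows ρ) (coeff cols (flip τ · flip ρ · σ)))) ⟩
    ⨁ (permutations d) (λ ρ → - (coeff rows ρ * coeff cols (flip τ · flip ρ · σ)))
      ≡⟨ ⨁-neg ⟩
    - ⨁ (permutations d) (λ ρ → coeff rows ρ * coeff cols (flip τ · flip ρ · σ)) ∎)) (sym (zeroˡ (coeff young σ)))
    where
    u = swap x y
    v = τ · u · flip τ
    u-cols : Preserves t column u
    u-cols = swap-preserves column col≡
    v-rows : Preserves t row v
    v-rows z = trans (swap-elim x y (λ w → rowAt (τ ⟨$⟩ʳ w)) row≡ (τ ⟨$⟩ˡ z)) (cong rowAt (inverseʳ τ))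
    opaque
      unfolding _+_
      negate : ∀ a b → a * (- 1ℚ * b) ≡ - (a * b)
      negate = solve-∀ ℚ-ring
  -- Here τ is v q with v a row and q a column permutation, and each is absorbed on its side. That v
  -- preserves rows holds because the inequalities `q≤` compare two functions with the same sum over
  -- all points, so they are equalities.
  ... | inj₂ (q , q-cols , q≤) = sgn (flip q) , λ σ → begin
    ⨁ (permutations d) (λ ρ → coeff rows ρ * coeff cols (flip τ · flip ρ · σ))
      ≡⟨ ⨁-right (flip v) (λ {ρ} {ρ′} → ⋆-summand-cong rows (τ ▹ cols) σ {ρ} {ρ′}) ⟨
    ⨁ (permutations d) (λ ρ → coeff rows (ρ · flip v) * coeff cols (flip τ · flip (ρ · flip v) · σ))
      ≡⟨ ⨁-cong (λ ρ → trans
           (cong₂ _*_ (rows-·ʳ {flip v} (preserves-flip row v v-rows) ρ) (trans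
             (coeff-cong cols (flip τ · flip (ρ · flip v) · σ) (flip q · flip ρ · σ) (λ z → inverseˡ τ))
             (cols-·ˡ {flip q} (preserves-flip column q q-cols) (flip ρ · σ))))
           (exchange (coeff rows ρ) (sgn (flip q)) (coeff cols (flip ρ · σ)))) ⟩
    ⨁ (permutations d) (λ ρ → sgn (flip q) * (coeff rows ρ * coeff cols (flip ρ · σ)))
      ≡⟨ ⨁-*ˡ ⟩
    sgn (flip q) * coeff young σ ∎
    where
    v = τ · flip q
    row≡ : ∀ x → rowAt (q ⟨$⟩ʳ x) ≡ rowAt (τ ⟨$⟩ʳ x)
    row≡ x = fromℕ-injective (⨁-≤-≡ (λ x → fromℕ (rowAt (q ⟨$⟩ʳ x))) (λ x → fromℕ (rowAt (τ ⟨$⟩ʳ x)))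
      (λ x → fromℕ-mono-≤ (q≤ x)) (trans (⨁-rowAt τ) (sym (⨁-rowAt q))) x)
    v-rows : Preserves t row v
    v-rows x = trans (sym (row≡ (q ⟨$⟩ˡ x))) (cong rowAt (inverseʳ q))

  sandwich : ∀ x → ∃[ k ] (∀ σ → coeff (rows ⋆ (x ⋆ cols)) σ ≡ k * coeff young σ)
  sandwich x = ⨁ (permutations d) (λ τ → coeff x τ * proj₁ (rows⋆▹cols τ)) , λ σ → trans (⋆-▹ rows x cols σ) (trans
    (⨁-cong (λ τ → trans (cong (coeff x τ *_) (proj₂ (rows⋆▹cols τ) σ)) (sym (*-assoc (coeff x τ) (proj₁ (rows⋆▹cols τ)) (coeff young σ)))))
    ⨁-*ʳ)

  -- The scalar in the square of `young`; classically it is `d !` divided by the dimension of the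
  -- module.
  κ : ℚ
  κ = proj₁ (sandwich (cols ⋆ rows))

  young-⋆ : ∀ x σ → coeff (young ⋆ (x ⋆ cols)) σ ≡ coeff (rows ⋆ ((cols ⋆ x) ⋆ cols)) σ
  young-⋆ x σ = trans (⋆-assoc rows cols (x ⋆ cols) σ) (⋆-congʳ rows {cols ⋆ (x ⋆ cols)} {(cols ⋆ x) ⋆ cols} (λ ρ → sym (⋆-assoc cols x cols ρ)) σ)

  young² : ∀ σ → coeff (young ⋆ young) σ ≡ κ * coeff young σ
  young² σ = trans (young-⋆ rows σ) (proj₂ (sandwich (cols ⋆ rows)) σ)

  φ : Permutation′ d → ℚ
  φ τ = proj₁ (sandwich (cols ⋆ (τ ▹ rows)))

  young⋆▹young : ∀ τ σ → coeff (young ⋆ (τ ▹ young)) σ ≡ φ τ * coeff young σ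
  young⋆▹young τ σ = trans (⋆-congʳ young {τ ▹ young} {(τ ▹ rows) ⋆ cols} (▹-⋆ τ rows cols) σ) (trans (young-⋆ (τ ▹ rows) σ) (proj₂ (sandwich (cols ⋆ (τ ▹ rows))) σ))

  ψ : Permutation′ d → ℚ
  ψ = averaged young

  -- Inversion reverses products and leaves `rows` and `cols` invariant, so it takes `rows ⋆ cols`
  -- to `cols ⋆ rows`. By `averaged-⋆` the two have the same class sums.
  ψ-flip : ∀ σ → ψ (flip σ) ≡ ψ σ
  ψ-flip σ = trans (⨁-cong (λ τ → trans
    (coeff-cong young (flip τ · flip σ · τ) (flip (flip τ · σ · τ)) (λ _ → refl)) (young-flip (flip τ · σ · τ))))
    (averaged-⋆ cols rows σ)
    where
    young-flip : ∀ g → coeff young (flip g) ≡ coeff (cols ⋆ rows) g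
    young-flip g = trans (⨁-cong (λ ρ → trans (*-comm (coeff rows ρ) _) (cong₂ _*_
        (trans (sym (cols-flip (flip ρ · flip g))) (coeff-cong cols (flip (flip ρ · flip g)) (g · ρ) (λ _ → refl)))
        (trans (sym (rows-flip ρ)) (coeff-cong rows (flip ρ) (flip (g · ρ) · g) (λ i → cong (ρ ⟨$⟩ˡ_) (sym (inverseˡ g))))))))
      (⨁-left g (λ {σ} {τ} → ⋆-summand-cong cols rows g {σ} {τ}))

  -- Both sides are the coefficient of the identity in the cube of `young`: expanding the middle
  -- factor produces φ, and using `young²` twice produces κ twice.
  ⨁-φ : ⨁ (permutations d) (λ τ → coeff young τ * φ τ) ≡ κ * κ
  ⨁-φ = begin
    ⨁ (permutations d) (λ τ → coeff young τ * φ τ)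
      ≡⟨ ⨁-cong (λ τ → cong (coeff young τ *_) (trans (young⋆▹young τ idₚ) (trans (cong (φ τ *_) young-id) (*-identityʳ (φ τ))))) ⟨
    ⨁ (permutations d) (λ τ → coeff young τ * coeff (young ⋆ (τ ▹ young)) idₚ)
      ≡⟨ ⋆-▹ young young young idₚ ⟨
    coeff (young ⋆ (young ⋆ young)) idₚ
      ≡⟨ ⨁-cong (λ τ → trans (cong (coeff young τ *_) (young² (flip τ · idₚ))) (exchange (coeff young τ) κ (coeff young (flip τ · idₚ)))) ⟩
    ⨁ (permutations d) (λ τ → κ * (coeff young τ * coeff young (flip τ · idₚ)))
      ≡⟨ ⨁-*ˡ ⟩
    κ * coeff (young ⋆ young) idₚ
      ≡⟨ cong (κ *_) (trans (young² idₚ) (trans (cong (κ *_) young-id) (*-identityʳ κ))) ⟩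
    κ * κ ∎

  ψ-norm : ⨁ (permutations d) (λ σ → ψ σ * ψ σ) ≡ fromℕ (d !) * (κ * κ)
  ψ-norm = begin
    ⨁ (permutations d) (λ σ → ψ σ * ψ σ)
      ≡⟨ ⨁-averaged young (λ σ τ σ≈ → averaged-cong young {σ} {τ} σ≈) (averaged-conj young) ⟩
    fromℕ (d !) * ⨁ (permutations d) (λ σ → coeff young σ * ψ σ)
      ≡⟨ cong (fromℕ (d !) *_) (trans (⨁-cong (λ σ → trans (cong (coeff young σ *_) (sym (ψ-flip σ))) (sym ⨁-*ˡ)))
           ⨁-swap) ⟩
    fromℕ (d !) * ⨁ (permutations d) (λ τ → ⨁ (permutations d) (λ σ → coeff young σ * coeff young (flip τ · flip σ · τ)))
      -- The inner sum is the coefficient at τ of `young ⋆ (τ ▹ young)`.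
      ≡⟨ cong (fromℕ (d !) *_) (trans (⨁-cong (λ τ → trans (young⋆▹young τ τ) (*-comm (φ τ) (coeff young τ)))) ⨁-φ) ⟩
    fromℕ (d !) * (κ * κ) ∎

  -- For κ = 0, `ψ-norm` would make ψ vanish. But each of the `d !` summands of `ψ idₚ` is the
  -- coefficient of the identity in `young`, which is 1.
  κ≢0 : κ ≢ 0ℚ
  κ≢0 κ≡0 = !≢0 d (begin
    fromℕ (d !)        ≡⟨ *-identityʳ (fromℕ (d !)) ⟨
    fromℕ (d !) * 1ℚ   ≡⟨ ⨁-permutations-const ⟨
    ⨁ (permutations d) (λ _ → 1ℚ)
                       ≡⟨ ⨁-cong (λ τ → trans (coeff-cong young (flip τ · idₚ · τ) idₚ (λ i → inverseˡ τ)) young-id) ⟨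
    ψ idₚ              ≡⟨ p*p≡0⇒p≡0 (ψ idₚ) (PermE.⨁≡0⇒≡0 {f = λ σ → ψ σ * ψ σ}
                            (λ {σ} {τ} σ≈ → cong₂ _*_ (averaged-cong young {σ} {τ} σ≈) (averaged-cong young {σ} {τ} σ≈))
                            (λ σ → p*p≥0 (ψ σ)) (trans ψ-norm (trans (cong (λ k → fromℕ (d !) * (k * k)) κ≡0) (trans (cong (fromℕ (d !) *_) (zeroʳ 0ℚ)) (zeroʳ (fromℕ (d !)))))) idₚ) ⟩
    0ℚ                 ∎)


-- Comparison of the Young symmetrizer with the Frobenius formula

ι : Fin n → ℚ
ι i = fromℕ (toℕ i)

fromℤ-e : ∀ (i j : Fin n) → fromℤ (e i j) ≡ 𝟙 (i Fin.≟ j)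
fromℤ-e i j with toSum (i Fin.≟ j)
... | inj₁ refl = trans (cong fromℤ (e-same i)) (sym (𝟙-yes (i Fin.≟ i) refl))
... | inj₂ i≢j  = trans (cong fromℤ (e-other i≢j)) (sym (𝟙-no (i Fin.≟ j) i≢j))

-- A linear statistic in place of the dominance order. A nonzero term of the alternant bounds it
-- above by its value at the row colouring, sorting bounds it below, and equality pins the colouring
-- down.
weight : (Fin d → Fin n) → ℚ
weight {d} f = ⨁ (allFin d) (ι ∘ f)

weight-cnt : ∀ (f : Fin d → Fin n) → weight f ≡ ⨁ (allFin n) (λ i → ι i * fromℤ (cnt f i))
weight-cnt {d} {n} f = sym (begin
  ⨁ (allFin n) (λ i → ι i * fromℤ (cnt f i))
    ≡⟨ ⨁-cong (λ i → trans (cong (ι i *_) (trans (cnt-⨁ f i) (⨁-cong (λ x → trans (fromℤ-e (f x) i) (𝟙-⇔ (f x Fin.≟ i) (i Fin.≟ f x) sym sym)))))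
         (sym ⨁-*ˡ)) ⟩
  ⨁ (allFin n) (λ i → ⨁ (allFin d) (λ x → ι i * 𝟙 (i Fin.≟ f x)))
    ≡⟨ ⨁-swap ⟩
  ⨁ (allFin d) (λ x → ⨁ (allFin n) (λ i → ι i * 𝟙 (i Fin.≟ f x)))
    ≡⟨ ⨁-cong (λ x → trans (⨁-cong (λ i → *-comm (ι i) (𝟙 (i Fin.≟ f x)))) (⨁-pick-Fin ι (f x))) ⟩
  weight f ∎)

opaque
  unfolding _+_

  0≤p+p⇒0≤p : ∀ p → 0ℚ ℚ.≤ p + p → 0ℚ ℚ.≤ p
  0≤p+p⇒0≤p p 0≤2p with ℚ.≤-total 0ℚ p
  ... | inj₁ 0≤p = 0≤p
  ... | inj₂ p≤0 = ℚ.≤-reflexive (2*-cancel (trans (+-identityʳ 0ℚ) (ℚ.≤-antisym 0≤2p (ℚ.+-mono-≤ p≤0 p≤0))))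

-- Σ i (w i - i) = - ½ Σ (i - w i)².
⨁-rearrangement : ∀ (w : Permutation′ n) → 0ℚ ℚ.≤ ⨁ (allFin n) (λ i → ι i * (ι i + - ι (w ⟨$⟩ʳ i)))
⨁-rearrangement {n} w = 0≤p+p⇒0≤p _ (subst (0ℚ ℚ.≤_) (sym squares) (⨁-nonneg (λ i → p*p≥0 (ι i + - ι (w ⟨$⟩ʳ i)))))
  where
  p = ⨁ (allFin n) (λ i → ι i * (ι i + - ι (w ⟨$⟩ʳ i)))
  r = ⨁ (allFin n) (λ i → ι i * ι i)
  opaque
    unfolding _+_
    square : ∀ a b → (a + - b) * (a + - b) ≡ (a * (a + - b) + a * (a + - b)) + (b * b + - (a * a))
    square = solve-∀ ℚ-ring
  squares : p + p ≡ ⨁ (allFin n) (λ i → (ι i + - ι (w ⟨$⟩ʳ i)) * (ι i + - ι (w ⟨$⟩ʳ i)))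
  squares = sym (begin
    ⨁ (allFin n) (λ i → (ι i + - ι (w ⟨$⟩ʳ i)) * (ι i + - ι (w ⟨$⟩ʳ i)))
      ≡⟨ ⨁-cong (λ i → square (ι i) (ι (w ⟨$⟩ʳ i))) ⟩
    ⨁ (allFin n) (λ i → (ι i * (ι i + - ι (w ⟨$⟩ʳ i)) + ι i * (ι i + - ι (w ⟨$⟩ʳ i))) + (ι (w ⟨$⟩ʳ i) * ι (w ⟨$⟩ʳ i) + - (ι i * ι i)))
      ≡⟨ trans ⨁-+ (cong₂ _+_ ⨁-+ (trans ⨁-+ (cong₂ _+_ (⨁-permute w (λ i → ι i * ι i)) ⨁-neg))) ⟩
    p + p + (r + - r)
      ≡⟨ trans (cong (p + p +_) (-‿inverseʳ r)) (+-identityʳ (p + p)) ⟩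
    p + p ∎)

module YoungFrobenius {d} {μ : Partition d} (t : Tableau μ) where

  open Young t

  private
    m = length (parts μ)

    x⁺ : Fin m → ℤ
    x⁺ i = ℤ.+ shifted {μ = μ} i

  cnt-rowColour : ∀ i → cnt rowColour i ≡ ℤ.+ lookup (parts μ) i
  cnt-rowColour i = fromℤ-injective (begin
    fromℤ (cnt rowColour i)
      ≡⟨ trans (cnt-⨁ rowColour i) (⨁-cong (λ x → fromℤ-e (rowColour x) i)) ⟩
    ⨁ (allFin d) (λ x → 𝟙 (rowColour x Fin.≟ i))
      ≡⟨ ⨁-reindex (Fin-enumeration d) Cell-enumeration at (Inverse.from t)
           (λ x ξ (p , q) → trans (sym (Inverse.strictlyInverseʳ t x)) (cong (Inverse.from t) (~⇒≡ p q)))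
           (λ x ξ eq → let at-x≡ξ = trans (cong at eq) (Inverse.strictlyInverseˡ t ξ) in cong row at-x≡ξ , cong column at-x≡ξ)
           {λ ξ → 𝟙 (Cell.rowIndex ξ Fin.≟ i)} (λ (p , q) → cong (λ (ξ : Cell μ) → 𝟙 (Cell.rowIndex ξ Fin.≟ i)) (~⇒≡ p q)) ⟩
    ⨁ (cells μ) (λ ξ → 𝟙 (Cell.rowIndex ξ Fin.≟ i))
      ≡⟨ ⨁-cells _ ⟩
    ⨁ (allFin m) (λ i′ → ⨁ (allFin (lookup (parts μ) i′)) (λ _ → 𝟙 (i′ Fin.≟ i)))
      ≡⟨ ⨁-cong (λ i′ → trans ⨁-allFin-const (*-comm _ (𝟙 (i′ Fin.≟ i)))) ⟩
    ⨁ (allFin m) (λ i′ → 𝟙 (i′ Fin.≟ i) * fromℕ (lookup (parts μ) i′))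
      ≡⟨ ⨁-pick-Fin (λ i′ → fromℕ (lookup (parts μ) i′)) i ⟩
    fromℕ (lookup (parts μ) i) ∎)

  -- The hypothesis gives `cnt f i = λ_i + δ_i - δ_(w i)`. As δ_i is n - 1 - i, n being the number
  -- of rows, the weights of f and of the row colouring differ by the sum of i (w i - i), which the
  -- rearrangement inequality makes at most 0.
  weight-≤ : ∀ (f : Fin d → Fin m) (w : Permutation′ m) → (λ i → x⁺ i ℤ.- cnt f i) ≗ δ ∘ (w ⟨$⟩ʳ_) → weight f ℚ.≤ weight rowColour
  weight-≤ f w eq = ≤-from-sum (⨁-rearrangement w) (begin
    weight f + ⨁ (allFin m) (λ i → ι i * (ι i + - ι (w ⟨$⟩ʳ i)))
      ≡⟨ trans (cong (_+ ⨁ (allFin m) (λ i → ι i * (ι i + - ι (w ⟨$⟩ʳ i)))) (weight-cnt f)) (sym ⨁-+) ⟩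
    ⨁ (allFin m) (λ i → ι i * fromℤ (cnt f i) + ι i * (ι i + - ι (w ⟨$⟩ʳ i)))
      ≡⟨ ⨁-cong pointwise ⟩
    ⨁ (allFin m) (λ i → ι i * fromℤ (cnt rowColour i))
      ≡⟨ weight-cnt rowColour ⟨
    weight rowColour ∎)
    where
    opaque
      unfolding _+_
      ≤-from-sum : ∀ {x y z} → 0ℚ ℚ.≤ y → x + y ≡ z → x ℚ.≤ z
      ≤-from-sum {x} {y} {z} 0≤y eq = subst₂ ℚ._≤_ (+-identityʳ x) eq (ℚ.+-monoʳ-≤ x 0≤y)
      combine : ∀ a c l x y u v k → l ≡ c + v + - u → x + u + 1ℚ ≡ k → y + v + 1ℚ ≡ k → a * c + a * (x + - y) ≡ a * l
      combine a c l x y u v k refl p q = trans (lemma₁ a c x y u) (trans (cong (λ z → a * (c + (z + (- y + - u + - 1ℚ)))) (trans p (sym q))) (lemma₂ a c y u v))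
        where
        lemma₁ : ∀ a c x y u → a * c + a * (x + - y) ≡ a * (c + ((x + u + 1ℚ) + (- y + - u + - 1ℚ)))
        lemma₁ = solve-∀ ℚ-ring
        lemma₂ : ∀ a c y u v → a * (c + ((y + v + 1ℚ) + (- y + - u + - 1ℚ))) ≡ a * (c + v + - u)
        lemma₂ = solve-∀ ℚ-ring
      rearrange : ∀ {l c u v} → l + u ≡ c + v → l ≡ c + v + - u
      rearrange {l} {c} {u} {v} eq = trans (lemma l u) (cong (_+ - u) eq)
        where
        lemma : ∀ l u → l ≡ l + u + - u
        lemma = solve-∀ ℚ-ring
    pointwise : ∀ i → ι i * fromℤ (cnt f i) + ι i * (ι i + - ι (w ⟨$⟩ʳ i)) ≡ ι i * fromℤ (cnt rowColour i)
    pointwise i = combine (ι i) (fromℤ (cnt f i)) (fromℤ (cnt rowColour i)) (ι i) (ι (w ⟨$⟩ʳ i)) (fromℤ (δ i)) (fromℤ (δ (w ⟨$⟩ʳ i))) (fromℕ m)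
      (rearrange (trans (sym (fromℤ-+ (cnt rowColour i) (δ i))) (trans (cong fromℤ (begin
        cnt rowColour i ℤ.+ δ i                    ≡⟨ cong (λ z → z ℤ.+ δ i) (cnt-rowColour i) ⟩
        ℤ.+ lookup (parts μ) i ℤ.+ δ i             ≡⟨ ℤ.pos-+ (lookup (parts μ) i) (toℕ (opposite i)) ⟨
        x⁺ i                                       ≡⟨ cancel (x⁺ i) (cnt f i) ⟩
        cnt f i ℤ.+ (x⁺ i ℤ.- cnt f i)             ≡⟨ cong (λ z → cnt f i ℤ.+ z) (eq i) ⟩
        cnt f i ℤ.+ δ (w ⟨$⟩ʳ i)                   ∎)) (fromℤ-+ (cnt f i) (δ (w ⟨$⟩ʳ i))))))
      (δ-complement i) (δ-complement (w ⟨$⟩ʳ i))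
      where
      cancel : ∀ x y → x ≡ y ℤ.+ (x ℤ.- y)
      cancel = ℤ-solve

  -- The contribution of the colouring f to the pairing of `young` with s, apart from the factor
  -- `D x⁺ f`.
  V : (Fin d → Fin m) → ℚ
  V f = ⨁ (permutations d) (λ σ → coeff young σ * 𝟙 (fixed? σ f))

  V-cong : ColourE.Respects V
  V-cong {f} {g} f≗ = ⨁-cong (λ σ → cong (coeff young σ *_) (𝟙-fixed-cong {σ = σ} {σ} {f} {g} (λ _ → refl) f≗))

  -- The transposition of the two points stabilises f and is a column permutation. Translating the
  -- sum by it preserves the condition on σ and changes the sign of `young`.
  V-collision : ∀ f → Collision (toℕ ∘ f) → V f ≡ 0ℚ
  V-collision f (x , y , x≢y , col≡ , fx≡fy) = p≡-p⇒p≡0 (begin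
    V f
      ≡⟨ ⨁-right u {λ σ → coeff young σ * 𝟙 (fixed? σ f)} (λ {σ} {τ} σ≈ → cong₂ _*_ (coeff-cong young σ τ σ≈) (𝟙-fixed-cong {σ = σ} {τ} {f} σ≈ (λ _ → refl))) ⟨
    ⨁ (permutations d) (λ σ → coeff young (σ · u) * 𝟙 (fixed? (σ · u) f))
      ≡⟨ ⨁-cong (λ σ → trans (cong₂ _*_
           (trans (young-·ʳ {u} (swap-preserves column col≡) σ) (cong (_* coeff young σ) (sgn-swap x≢y))) (𝟙-⇔ (fixed? (σ · u) f) (fixed? σ f)
             (λ p z → trans (cong (λ z → f (σ ⟨$⟩ʳ z)) (sym (swap-involutive x y z))) (trans (p (u ⟨$⟩ʳ z)) (fu≡f z)))
             (λ p z → trans (p (u ⟨$⟩ʳ z)) (fu≡f z)))) (negate (coeff young σ) (𝟙 (fixed? σ f)))) ⟩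
    ⨁ (permutations d) (λ σ → - (coeff young σ * 𝟙 (fixed? σ f)))
      ≡⟨ ⨁-neg ⟩
    - V f ∎)
    where
    u = swap x y
    fu≡f : ∀ z → f (u ⟨$⟩ʳ z) ≡ f z
    fu≡f = swap-elim x y f (Fin.toℕ-injective fx≡fy)
    opaque
      unfolding _+_
      negate : ∀ a b → - 1ℚ * a * b ≡ - (a * b)
      negate = solve-∀ ℚ-ring

  sorted? : ∀ f q → Dec (Preserves t column q × f ≗ rowColour ∘ (q ⟨$⟩ʳ_))
  sorted? f q = preserves? t column q ×-dec (f ≗ᶜ? rowColour ∘ (q ⟨$⟩ʳ_))

  -- Only the permutations of the row colouring within the columns contribute.
  D*V : ∀ f → D x⁺ f * V f ≡ ⨁ (permutations d) (λ q → 𝟙 (sorted? f q)) * V f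
  D*V f with collision⊎sortedBelow (toℕ ∘ f)
  ... | inj₁ collision = trans (cong (D x⁺ f *_) (V-collision f collision)) (trans (zeroʳ (D x⁺ f))
    (sym (trans (cong (⨁ (permutations d) (λ q → 𝟙 (sorted? f q)) *_) (V-collision f collision)) (zeroʳ _))))
  ... | inj₂ (q , q-cols , q≤) with f ≗ᶜ? rowColour ∘ (q ⟨$⟩ʳ_)
  -- Subtracting the row lengths from the exponents leaves δ, so `D x⁺ f` is 1. The count on the
  -- right is 1 too, as a point is determined by its row and column and so q is unique.
  ...   | yes f≗ = cong (_* V f) (trans D≡1 (sym (trans (⨁-cong (λ q′ → 𝟙-⇔ (sorted? f q′) (q′ ≈ₚ? q)
            (λ (q′-cols , f≗′) x → at-injective (row≡ q′ f≗′ x) (trans (q′-cols x) (sym (q-cols x))))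
            (λ q′≈q → (λ x → trans (cong colAt (q′≈q x)) (q-cols x)) , (λ x → trans (f≗ x) (cong rowColour (sym (q′≈q x)))))))
            (PermE.once q))))
    where
    row≡ : ∀ q′ → f ≗ rowColour ∘ (q′ ⟨$⟩ʳ_) → ∀ x → rowAt (q′ ⟨$⟩ʳ x) ≡ rowAt (q ⟨$⟩ʳ x)
    row≡ q′ f≗′ x = trans (rowAt-colour (q′ ⟨$⟩ʳ x)) (trans (cong toℕ (trans (sym (f≗′ x)) (f≗ x))) (sym (rowAt-colour (q ⟨$⟩ʳ x))))
    D≡1 : D x⁺ f ≡ 1ℚ
    D≡1 = trans (Alt-cong {A′ = δ} {B = δ} (λ i → begin
        x⁺ i ℤ.- cnt f i                             ≡⟨ cong (λ z → x⁺ i ℤ.- z) (trans (cnt-cong f≗ i) (trans (cnt-permute q rowColour i) (cnt-rowColour i))) ⟩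
        x⁺ i ℤ.- ℤ.+ lookup (parts μ) i              ≡⟨ cong (λ z → z ℤ.- ℤ.+ lookup (parts μ) i) (ℤ.pos-+ (lookup (parts μ) i) (toℕ (opposite i))) ⟩
        ℤ.+ lookup (parts μ) i ℤ.+ δ i ℤ.- ℤ.+ lookup (parts μ) i  ≡⟨ cancel (ℤ.+ lookup (parts μ) i) (δ i) ⟩
        δ i                                          ∎) (λ _ → refl)) (Alt-self {A = δ {m}} δ-injective)
      where
      cancel : ∀ x y → x ℤ.+ y ℤ.- x ≡ y
      cancel = ℤ-solve
  -- A nonzero term of the alternant would make the weight of f at most that of the row colouring,
  -- while sorting gives `rowColour ∘ q ≤ f` at every point; equality would follow. The same
  -- argument empties the count on the right.
  ...   | no f≗̸ = cong (_* V f) (trans (Alt-zero {A = λ i → x⁺ i ℤ.- cnt f i} {δ} (λ w eq → f≗̸ (f≗ (weight-≤ f w eq))))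
            (sym (⨁-zero (λ q′ → 𝟙-no (sorted? f q′) (λ (_ , f≗′) → f≗̸ (f≗ (ℚ.≤-reflexive
              (trans (⨁-cong (cong ι ∘ f≗′)) (⨁-permute q′ (ι ∘ rowColour))))))))))
    where
    f≗ : weight f ℚ.≤ weight rowColour → f ≗ rowColour ∘ (q ⟨$⟩ʳ_)
    f≗ weight≤ x = Fin.toℕ-injective (sym (fromℕ-injective (⨁-≤-≡ (λ x → ι (rowColour (q ⟨$⟩ʳ x))) (ι ∘ f) q≤f
      (trans (ℚ.≤-antisym weight≤ (subst (ℚ._≤ weight f) (⨁-permute q (ι ∘ rowColour)) (⨁-mono-≤ q≤f))) (sym (⨁-permute q (ι ∘ rowColour)))) x)))
      where
      q≤f : ∀ x → ι (rowColour (q ⟨$⟩ʳ x)) ℚ.≤ ι (f x)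
      q≤f x = fromℕ-mono-≤ (subst (ℕ._≤ toℕ (f x)) (rowAt-colour (q ⟨$⟩ʳ x)) (q≤ x))

  -- The stabiliser of `rowColour ∘ q` is the row group conjugated by q. Translating by q turns `V`
  -- into a coefficient of `young ⋆ rows` and produces the sign that completes `cols`; the sum is
  -- the coefficient of the identity in `cols ⋆ (young ⋆ rows)`, cyclically that of the square of
  -- `young`.
  ⨁-V : ⨁ (permutations d) (λ q → 𝟙 (preserves? t column q) * V (rowColour ∘ (q ⟨$⟩ʳ_))) ≡ κ
  ⨁-V = begin
    ⨁ (permutations d) (λ q → 𝟙 (preserves? t column q) * V (rowColour ∘ (q ⟨$⟩ʳ_)))
      ≡⟨ ⨁-cong (λ q → trans (𝟙-cong (preserves? t column q) (step q)) (sym (*-assoc (𝟙 (preserves? t column q)) (sgn q) _))) ⟩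
    ⨁ (permutations d) (λ q → coeff cols q * coeff (young ⋆ rows) (flip q))
      ≡⟨ ⨁-cong (λ q → cong (coeff cols q *_) (coeff-cong (young ⋆ rows) (flip q) (flip q · idₚ) (λ _ → refl))) ⟩
    coeff (cols ⋆ (young ⋆ rows)) idₚ
      ≡⟨ ⋆-trace cols (young ⋆ rows) ⟩
    coeff ((young ⋆ rows) ⋆ cols) idₚ
      ≡⟨ ⋆-assoc young rows cols idₚ ⟩
    coeff (young ⋆ young) idₚ
      ≡⟨ trans (young² idₚ) (trans (cong (κ *_) young-id) (*-identityʳ κ)) ⟩
    κ ∎
    where
    opaque
      unfolding _+_
      regroup : ∀ p q r → p * q * r ≡ p * (q * r)
      regroup = solve-∀ ℚ-ring
    fixed-rows : ∀ q σ → 𝟙 (fixed? σ (rowColour ∘ (q ⟨$⟩ʳ_))) ≡ coeff rows (q · σ · flip q)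
    fixed-rows q σ = 𝟙-⇔ (fixed? σ (rowColour ∘ (q ⟨$⟩ʳ_))) (preserves? t row (q · σ · flip q))
      (λ p x → trans (rowAt-colour (q ⟨$⟩ʳ (σ ⟨$⟩ʳ (q ⟨$⟩ˡ x)))) (trans (cong toℕ (trans (p (q ⟨$⟩ˡ x)) (cong rowColour (inverseʳ q)))) (sym (rowAt-colour x))))
      (λ p x → Fin.toℕ-injective (trans (sym (rowAt-colour (q ⟨$⟩ʳ (σ ⟨$⟩ʳ x)))) (trans
        (trans (cong (λ y → rowAt (q ⟨$⟩ʳ (σ ⟨$⟩ʳ y))) (sym (inverseˡ q))) (p (q ⟨$⟩ʳ x))) (rowAt-colour (q ⟨$⟩ʳ x)))))
    step : ∀ q → Preserves t column q → V (rowColour ∘ (q ⟨$⟩ʳ_)) ≡ sgn q * coeff (young ⋆ rows) (flip q)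
    step q q-cols = begin
      V (rowColour ∘ (q ⟨$⟩ʳ_))
        ≡⟨ ⨁-cong (λ σ → cong (coeff young σ *_) (fixed-rows q σ)) ⟩
      ⨁ (permutations d) (λ σ → coeff young σ * coeff rows (q · σ · flip q))
        ≡⟨ ⨁-right q {λ σ → coeff young σ * coeff rows (q · σ · flip q)} (λ {σ} {τ} σ≈ → cong₂ _*_ (coeff-cong young σ τ σ≈)
             (coeff-cong rows (q · σ · flip q) (q · τ · flip q) (λ x → cong (q ⟨$⟩ʳ_) (σ≈ (q ⟨$⟩ˡ x))))) ⟨
      ⨁ (permutations d) (λ σ → coeff young (σ · q) * coeff rows (q · (σ · q) · flip q))
        ≡⟨ ⨁-cong (λ σ → trans (cong₂ _*_ (young-·ʳ {q} q-cols σ) (trans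
             (coeff-cong rows (q · (σ · q) · flip q) (q · σ) (λ x → cong (λ y → q ⟨$⟩ʳ (σ ⟨$⟩ʳ y)) (inverseʳ q)))
             (trans (sym (rows-flip (q · σ))) (coeff-cong rows (flip (q · σ)) (flip σ · flip q) (λ _ → refl)))))
             (regroup (sgn q) (coeff young σ) (coeff rows (flip σ · flip q)))) ⟩
      ⨁ (permutations d) (λ σ → sgn q * (coeff young σ * coeff rows (flip σ · flip q)))
        ≡⟨ ⨁-*ˡ ⟩
      sgn q * coeff (young ⋆ rows) (flip q) ∎

  ⨁-young-s : ⨁ (permutations d) (λ σ → coeff young σ * s x⁺ σ) ≡ κ
  ⨁-young-s = begin
    ⨁ (permutations d) (λ σ → coeff young σ * s x⁺ σ)
      ≡⟨ trans (⨁-cong (λ σ → sym ⨁-*ˡ)) ⨁-swap ⟩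
    ⨁ (colourings d m) (λ f → ⨁ (permutations d) (λ σ → coeff young σ * (𝟙 (fixed? σ f) * D x⁺ f)))
      ≡⟨ ⨁-cong (λ f → trans (trans (⨁-cong (λ σ → sym (*-assoc (coeff young σ) (𝟙 (fixed? σ f)) (D x⁺ f))))
           ⨁-*ʳ) (trans (*-comm (V f) (D x⁺ f)) (trans (D*V f) (sym ⨁-*ʳ)))) ⟩
    ⨁ (colourings d m) (λ f → ⨁ (permutations d) (λ q → 𝟙 (sorted? f q) * V f))
      ≡⟨ ⨁-swap ⟩
    ⨁ (permutations d) (λ q → ⨁ (colourings d m) (λ f → 𝟙 (sorted? f q) * V f))
      ≡⟨ ⨁-cong (λ q → trans (⨁-cong (λ f → trans
           (cong (_* V f) (𝟙-× (preserves? t column q) (f ≗ᶜ? rowColour ∘ (q ⟨$⟩ʳ_)))) (*-assoc (𝟙 (preserves? t column q)) _ (V f))))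
           (trans ⨁-*ˡ
             (cong (𝟙 (preserves? t column q) *_) (ColourE.⨁-pick (λ {f} {g} → V-cong {f} {g}) (rowColour ∘ (q ⟨$⟩ʳ_)))))) ⟩
    ⨁ (permutations d) (λ q → 𝟙 (preserves? t column q) * V (rowColour ∘ (q ⟨$⟩ʳ_)))
      ≡⟨ ⨁-V ⟩
    κ ∎

  ψ≡κ*s : ∀ σ → ψ σ ≡ κ * s x⁺ σ
  ψ≡κ*s σ = q-p≡0⇒q≡p (p*p≡0⇒p≡0 (ψ σ + - (κ * s x⁺ σ)) (PermE.⨁≡0⇒≡0 {f = λ σ → (ψ σ + - (κ * s x⁺ σ)) * (ψ σ + - (κ * s x⁺ σ))}
    (λ {σ} {τ} σ≈ → cong (λ z → z * z) (cong₂ (λ a b → a + - (κ * b)) (averaged-cong young {σ} {τ} σ≈) (s-cong {A = x⁺} {σ = σ} {τ} (λ _ → refl) σ≈)))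
    (λ σ → p*p≥0 (ψ σ + - (κ * s x⁺ σ))) (begin
      ⨁ (permutations d) (λ σ → (ψ σ + - (κ * s x⁺ σ)) * (ψ σ + - (κ * s x⁺ σ)))
        ≡⟨ ⨁-cong (λ σ → expand (ψ σ) κ (s x⁺ σ)) ⟩
      ⨁ (permutations d) (λ σ → ψ σ * ψ σ + (- (κ + κ) * (ψ σ * s x⁺ σ) + κ * κ * (s x⁺ σ * s x⁺ σ)))
        ≡⟨ trans ⨁-+ (cong₂ _+_ ψ-norm (trans ⨁-+ (cong₂ _+_
             (trans ⨁-*ˡ (cong (- (κ + κ) *_) (trans
               (⨁-averaged young (λ σ τ → s-cong {A = x⁺} {σ = σ} {τ} (λ _ → refl)) (s-conj x⁺)) (cong (fromℕ (d !) *_) ⨁-young-s))))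
             (trans ⨁-*ˡ (cong (κ * κ *_) (s-norm (shifted {μ = μ}) (shifted-injective {μ = μ}) (total-shifted {μ = μ}))))))) ⟩
      fromℕ (d !) * (κ * κ) + (- (κ + κ) * (fromℕ (d !) * κ) + κ * κ * fromℕ (d !))
        ≡⟨ vanish (fromℕ (d !)) κ ⟩
      0ℚ ∎) σ))
    where
    opaque
      unfolding _+_
      expand : ∀ p k q → (p + - (k * q)) * (p + - (k * q)) ≡ p * p + (- (k + k) * (p * q) + k * k * (q * q))
      expand = solve-∀ ℚ-ring
      vanish : ∀ N k → N * (k * k) + (- (k + k) * (N * k) + k * k * N) ≡ 0ℚ
      vanish = solve-∀ ℚ-ring
      q-p≡0⇒q≡p : ∀ {p q} → q + - p ≡ 0ℚ → q ≡ p
      q-p≡0⇒q≡p eq = sym (q-p≡0⇒p≡q eq)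

-- The trace on the ideal of the Young symmetrizer

opaque
  unfolding _+_ ⨁

  coeff-*ᴬ : ∀ {d} (x y : ℚ[S d ]) σ → coeff (x *ᴬ y) σ ≡ coeff (x ⋆ y) σ
  coeff-*ᴬ x y σ = refl

  coeff-linearCombination : ∀ {d n} (a : Fin n → ℚ) (b : Fin n → ℚ[S d ]) σ →
                            coeff (linearCombination a b) σ ≡ ⨁ (allFin n) (λ k → a k * coeff (b k) σ)
  coeff-linearCombination a b σ = refl

single : ∀ {d} → Permutation′ d → ℚ[S d ]
single τ = record
  { coeff      = λ σ → 𝟙 (σ ≈ₚ? τ)
  ; coeff-cong = λ σ σ′ σ≈ → 𝟙-⇔ (σ ≈ₚ? τ) (σ′ ≈ₚ? τ) (λ p i → trans (sym (σ≈ i)) (p i)) (λ p i → trans (σ≈ i) (p i)) }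

single-⋆ : ∀ {d} (τ : Permutation′ d) x → single τ ⋆ x ≈ᴬ τ ▹ x
single-⋆ τ x σ = PermE.⨁-pick {f = λ ρ → coeff x (flip ρ · σ)} (λ {ρ} {ρ′} ρ≈ → coeff-cong x (flip ρ · σ) (flip ρ′ · σ)
  (λ i → flip-cong {σ = ρ} {ρ′} ρ≈ (σ ⟨$⟩ʳ i))) τ

module _ {d} {lam : Partition d} {χ : Partition d → ℚ} (isχ : IsIrreducibleCharacter lam χ) where

  open IsIrreducibleCharacter isχ
  open Young tableau
  open YoungFrobenius tableau using (ψ≡κ*s)

  private
    I = allFin dimension

    ⋆-young : ∀ a σ → coeff (a *ᴬ youngSymmetrizer tableau) σ ≡ coeff (a ⋆ young) σ
    ⋆-young a σ = trans (coeff-*ᴬ a (youngSymmetrizer tableau) σ) (sym (⋆-congʳ a {young} {youngSymmetrizer tableau} young≈youngSymmetrizer σ))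

    spanned : ∀ τ → ∃[ α ] (τ ▹ young) ≈ᴬ linearCombination α basis
    spanned τ = spanning (τ ▹ young) (single τ , λ σ → sym (trans (⋆-young (single τ) σ) (single-⋆ τ young σ)))

    α : Permutation′ d → Fin dimension → ℚ
    α τ = proj₁ (spanned τ)

    α-basis : ∀ τ σ → coeff young (flip τ · σ) ≡ ⨁ I (λ l → α τ l * coeff (basis l) σ)
    α-basis τ σ = trans (proj₂ (spanned τ) σ) (coeff-linearCombination (α τ) basis σ)

    basis⋆young : ∀ k σ → coeff (basis k ⋆ young) σ ≡ κ * coeff (basis k) σ
    basis⋆young k σ with a , basis≈ ← contained k = begin
      coeff (basis k ⋆ young) σ             ≡⟨ ⨁-cong (λ τ → cong (_* coeff young (flip τ · σ)) (trans (basis≈ τ) (⋆-young a τ))) ⟩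
      coeff ((a ⋆ young) ⋆ young) σ         ≡⟨ ⋆-assoc a young young σ ⟩
      coeff (a ⋆ (young ⋆ young)) σ         ≡⟨ ⨁-cong (λ τ → trans (cong (coeff a τ *_) (young² (flip τ · σ))) (exchange (coeff a τ) κ (coeff young (flip τ · σ)))) ⟩
      ⨁ (permutations d) (λ τ → κ * (coeff a τ * coeff young (flip τ · σ)))
                                            ≡⟨ ⨁-*ˡ ⟩
      κ * coeff (a ⋆ young) σ               ≡⟨ cong (κ *_) (trans (basis≈ σ) (⋆-young a σ)) ⟨
      κ * coeff (basis k) σ                 ∎

    pairing : Fin dimension → Fin dimension → ℚ
    pairing k l = ⨁ (permutations d) (λ τ → coeff (basis k) τ * α τ l)

    -- Right multiplication by young is multiplication by κ on the ideal, so the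
    -- functions τ ↦ α τ l form, up to κ, the basis dual to the given one.
    dual : ∀ k l → pairing k l ≡ 𝟙 (l Fin.≟ k) * κ
    dual k l = sym (q-p≡0⇒p≡q (independent (λ l → pairing k l + - (𝟙 (l Fin.≟ k) * κ)) (λ σ → trans (coeff-linearCombination _ basis σ) (vanish σ)) l))
      where
      opaque
        unfolding _+_
        expand : ∀ p q k b → (p + - (q * k)) * b ≡ p * b + - (k * (q * b))
        expand = solve-∀ ℚ-ring
      vanish : ∀ σ → ⨁ I (λ l → (pairing k l + - (𝟙 (l Fin.≟ k) * κ)) * coeff (basis l) σ) ≡ 0ℚ
      vanish σ = begin
        ⨁ I (λ l → (pairing k l + - (𝟙 (l Fin.≟ k) * κ)) * coeff (basis l) σ)
          ≡⟨ ⨁-cong (λ l → expand (pairing k l) (𝟙 (l Fin.≟ k)) κ (coeff (basis l) σ)) ⟩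
        ⨁ I (λ l → pairing k l * coeff (basis l) σ + - (κ * (𝟙 (l Fin.≟ k) * coeff (basis l) σ)))
          ≡⟨ trans ⨁-+ (cong₂ _+_
               (trans (⨁-cong (λ l → sym ⨁-*ʳ)) ⨁-swap)
               (trans ⨁-neg (cong -_ (trans ⨁-*ˡ (cong (κ *_) (⨁-pick-Fin (λ l → coeff (basis l) σ) k)))))) ⟩
        ⨁ (permutations d) (λ τ → ⨁ I (λ l → coeff (basis k) τ * α τ l * coeff (basis l) σ)) + - (κ * coeff (basis k) σ)
          ≡⟨ cong (_+ - (κ * coeff (basis k) σ)) (trans (⨁-cong (λ τ → trans (⨁-cong (λ l → *-assoc (coeff (basis k) τ) (α τ l) (coeff (basis l) σ)))
               (trans ⨁-*ˡ (cong (coeff (basis k) τ *_) (sym (α-basis τ σ)))))) (basis⋆young k σ)) ⟩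
        κ * coeff (basis k) σ + - (κ * coeff (basis k) σ)
          ≡⟨ -‿inverseʳ (κ * coeff (basis k) σ) ⟩
        0ℚ ∎

    -- Pairing the expansion of `σ • basis k` with the function `τ ↦ α τ k` isolates the diagonal
    -- entry, up to the factor κ of `dual`.
    diagonal : ∀ σ k → κ * matrix σ k k ≡ ⨁ (permutations d) (λ τ → α τ k * coeff (basis k) (flip σ · τ))
    diagonal σ k = begin
      κ * matrix σ k k
        ≡⟨ cong (κ *_) (⨁-pick-Fin (λ l → matrix σ l k) k) ⟨
      κ * ⨁ I (λ l → 𝟙 (l Fin.≟ k) * matrix σ l k)
        ≡⟨ trans (⨁-cong (λ l → trans (cong (matrix σ l k *_) (trans (dual l k) (cong (_* κ) (𝟙-⇔ (k Fin.≟ l) (l Fin.≟ k) sym sym))))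
             (regroup (matrix σ l k) (𝟙 (l Fin.≟ k)) κ))) ⨁-*ˡ ⟨
      ⨁ I (λ l → matrix σ l k * pairing l k)
        ≡⟨ trans (⨁-cong (λ l → sym ⨁-*ˡ)) ⨁-swap ⟩
      ⨁ (permutations d) (λ τ → ⨁ I (λ l → matrix σ l k * (coeff (basis l) τ * α τ k)))
        ≡⟨ ⨁-cong (λ τ → trans (trans (⨁-cong (λ l → sym (*-assoc (matrix σ l k) (coeff (basis l) τ) (α τ k)))) ⨁-*ʳ)
             (trans (cong (_* α τ k) (sym (trans (action σ k τ) (coeff-linearCombination _ basis τ)))) (*-comm _ (α τ k)))) ⟩
      ⨁ (permutations d) (λ τ → α τ k * coeff (basis k) (flip σ · τ)) ∎
      where
      opaque
        unfolding _+_
        regroup : ∀ p q r → p * (q * r) ≡ r * (q * p)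
        regroup = solve-∀ ℚ-ring

  -- Summed over k, the expressions of `diagonal` reassemble the expansion of `τ ▹ young` in the
  -- basis, evaluated at σ⁻¹ τ. The basis disappears, and κ times the trace is ψ at σ⁻¹.
  character≡s : ∀ σ ν → HasCycleType σ ν → χ ν ≡ s (λ i → ℤ.+ shifted {μ = lam} i) σ
  character≡s σ ν σ∈ν = *-cancelˡ-≢0 κ κ≢0 (begin
    κ * χ ν
      ≡⟨ cong (κ *_) (trans (trace σ ν σ∈ν) (sym (⨁≡∑ I (λ k → matrix σ k k)))) ⟩
    κ * ⨁ I (λ k → matrix σ k k)
      ≡⟨ ⨁-*ˡ ⟨
    ⨁ I (λ k → κ * matrix σ k k)
      ≡⟨ trans (⨁-cong (diagonal σ)) ⨁-swap ⟩
    ⨁ (permutations d) (λ τ → ⨁ I (λ k → α τ k * coeff (basis k) (flip σ · τ)))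
      ≡⟨ ⨁-cong (λ τ → trans (coeff-cong young (flip τ · flip σ · τ) (flip τ · (flip σ · τ)) (λ _ → refl)) (α-basis τ (flip σ · τ))) ⟨
    ψ (flip σ)
      ≡⟨ trans (ψ-flip σ) (ψ≡κ*s σ) ⟩
    κ * s (λ i → ℤ.+ shifted {μ = lam} i) σ ∎)

-- Hook lengths

-- Kept as a sum because this is the form in which `s-weighted` subtracts the exchange terms; at
-- most one k contributes.
gap : (ℕ → ℚ) → ℕ → ℕ → ℚ
gap F x y = ⨁< x (λ k → 𝟙 (x ℕ.≟ y ℕ.+ suc k) * F k)

gap-≤ : ∀ F {x y} → x ℕ.≤ y → gap F x y ≡ 0ℚ
gap-≤ F {x} {y} x≤y = ⨁-zero (λ k → trans (cong (_* F (toℕ k)) (𝟙-no (x ℕ.≟ y ℕ.+ suc (toℕ k))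
  (λ eq → ℕ.<⇒≱ (ℕ.m<m+n y {suc (toℕ k)} (ℕ.s≤s ℕ.z≤n)) (subst (ℕ._≤ y) eq x≤y)))) (zeroˡ (F (toℕ k))))

gap-< : ∀ F {x y} → y ℕ.< x → gap F x y ≡ F (x ℕ.∸ suc y)
gap-< F {x} {y} y<x = trans (⨁-cong (λ i → cong (_* F (toℕ i)) (𝟙-⇔ (x ℕ.≟ y ℕ.+ suc (toℕ i)) (i Fin.≟ Fin.fromℕ< g<x)
    (λ eq → Fin.toℕ-injective (trans (sym (ℕ.m+n∸m≡n (suc y) (toℕ i))) (trans (cong (ℕ._∸ suc y) (trans (sym (ℕ.+-suc y (toℕ i))) (sym eq))) (sym (Fin.toℕ-fromℕ< g<x)))))
    (λ eq → trans (sym (ℕ.m+[n∸m]≡n y<x)) (trans (sym (ℕ.+-suc y (x ℕ.∸ suc y))) (cong (λ k → y ℕ.+ suc k) (trans (sym (Fin.toℕ-fromℕ< g<x)) (cong toℕ (sym eq)))))))))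
  (trans (⨁-pick-Fin (F ∘ toℕ) (Fin.fromℕ< g<x)) (cong F (Fin.toℕ-fromℕ< g<x)))
  where
  g<x : x ℕ.∸ suc y ℕ.< x
  g<x = ℕ.∸-monoʳ-< (ℕ.s≤s ℕ.z≤n) y<x

leg : List ℕ → ℕ → ℕ
leg xs j = length (filter (j ℕ.<?_) xs)

leg-small : ∀ {x xs j} → Linked ℕ._≥_ (x ∷ xs) → x ℕ.≤ j → leg xs j ≡ 0
leg-small {xs = []} _ _ = refl
leg-small {xs = y ∷ ys} {j} (y≤x ∷ linked) x≤j = trans (cong length (List.filter-reject (j ℕ.<?_) (ℕ.≤⇒≯ (ℕ.≤-trans y≤x x≤j))))
  (leg-small linked (ℕ.≤-trans y≤x x≤j))

legAt : ∀ (xs : List ℕ) → Fin (length xs) → ℕ → ℕ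
legAt (x ∷ xs) zero    j = leg xs j
legAt (x ∷ xs) (suc i) j = legAt xs i j

-- The numbers `shifted` for a bare list, so that an induction can drop the first row.
β : ∀ (xs : List ℕ) → Fin (length xs) → ℕ
β xs i = lookup xs i ℕ.+ toℕ (opposite i)

β-zero : ∀ x xs → β (x ∷ xs) zero ≡ x ℕ.+ length xs
β-zero x xs = cong (λ k → x ℕ.+ k) (Fin.opposite-prop (zero {length xs}))

β-suc : ∀ x xs i → β (x ∷ xs) (suc i) ≡ β xs i
β-suc x xs i = cong (λ k → lookup xs i ℕ.+ k) (trans (Fin.opposite-prop (suc i)) (sym (Fin.opposite-prop i)))

β-< : ∀ {x xs} → Linked ℕ._≥_ (x ∷ xs) → ∀ i → β xs i ℕ.< x ℕ.+ length xs
β-< linked i = ℕ.+-mono-≤-< (head≥lookup linked i) (Fin.toℕ<n (opposite i))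

-- The hook lengths of the first row and the differences x + l - β i fill up an
-- interval: removing the second row shifts both.
row-hooks : ∀ {x xs} → Linked ℕ._≥_ (x ∷ xs) → ∀ F →
  ⨁< x (λ j → F (x ℕ.∸ suc j ℕ.+ leg xs j)) + ⨁ (allFin (length xs)) (λ i → F (x ℕ.+ length xs ℕ.∸ suc (β xs i)))
  ≡ ⨁< (x ℕ.+ length xs) F
row-hooks {x} {[]} _ F = trans (cong₂ _+_ (trans (⨁<-cong x (λ j _ → cong F (ℕ.+-identityʳ (x ℕ.∸ suc j)))) (sym (⨁<-reverse x F))) ⨁-[])
  (trans (+-identityʳ (⨁< x F)) (cong (λ m → ⨁< m F) (sym (ℕ.+-identityʳ x))))
row-hooks {x} {y ∷ ys} (y≤x ∷ linked) F = begin
  ⨁< x (λ j → F (x ℕ.∸ suc j ℕ.+ leg (y ∷ ys) j)) + ⨁ (allFin (suc l)) (λ i → F (x ℕ.+ suc l ℕ.∸ suc (β (y ∷ ys) i)))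
    ≡⟨ cong₂ _+_ (trans (cong (λ m → ⨁< m (λ j → F (x ℕ.∸ suc j ℕ.+ leg (y ∷ ys) j))) x≡) (⨁<-split y r (λ j → F (x ℕ.∸ suc j ℕ.+ leg (y ∷ ys) j)))) ⨁-allFin-suc ⟩
  ⨁< y (λ j → F (x ℕ.∸ suc j ℕ.+ leg (y ∷ ys) j)) + ⨁< r (λ j → F (x ℕ.∸ suc (y ℕ.+ j) ℕ.+ leg (y ∷ ys) (y ℕ.+ j)))
    + (F (x ℕ.+ suc l ℕ.∸ suc (β (y ∷ ys) zero)) + ⨁ (allFin l) (λ i → F (x ℕ.+ suc l ℕ.∸ suc (β (y ∷ ys) (suc i)))))
    ≡⟨ cong₂ _+_ (cong₂ _+_ (⨁<-cong y (λ j j<y → cong F (left j<y))) (trans (⨁<-cong r (λ j _ → cong F (right j))) (sym (⨁<-reverse r F))))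
                 (cong₂ _+_ (cong F first) (⨁-cong (λ i → cong F (rest i)))) ⟩
  ⨁< y (λ j → F′ (y ℕ.∸ suc j ℕ.+ leg ys j)) + ⨁< r F + (F r + ⨁ (allFin l) (λ i → F′ (y ℕ.+ l ℕ.∸ suc (β ys i))))
    ≡⟨ regroup (⨁< y (λ j → F′ (y ℕ.∸ suc j ℕ.+ leg ys j))) (⨁< r F) (F r) (⨁ (allFin l) (λ i → F′ (y ℕ.+ l ℕ.∸ suc (β ys i)))) ⟩
  ⨁< r F + (F r + (⨁< y (λ j → F′ (y ℕ.∸ suc j ℕ.+ leg ys j)) + ⨁ (allFin l) (λ i → F′ (y ℕ.+ l ℕ.∸ suc (β ys i)))))
    ≡⟨ cong (λ z → ⨁< r F + (F r + z)) (row-hooks linked F′) ⟩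
  ⨁< r F + (F r + ⨁< (y ℕ.+ l) F′)
    ≡⟨ cong (⨁< r F +_) (trans (⨁<-suc (y ℕ.+ l) (λ k → F (r ℕ.+ k))) (cong₂ _+_ (cong F (ℕ.+-identityʳ r)) (⨁<-cong (y ℕ.+ l) (λ k _ → cong F (swap-suc r k))))) ⟨
  ⨁< r F + ⨁< (suc (y ℕ.+ l)) (λ k → F (r ℕ.+ k))
    ≡⟨ ⨁<-split r (suc (y ℕ.+ l)) F ⟨
  ⨁< (r ℕ.+ suc (y ℕ.+ l)) F
    ≡⟨ cong (λ m → ⨁< m F) (trans (regroup-ℕ r y l) (cong (ℕ._+ suc l) (sym x≡))) ⟩
  ⨁< (x ℕ.+ suc l) F ∎
  where
  l = length ys
  r = x ℕ.∸ y
  -- The last r columns have no leg and fill the values below r, and the second row gives the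
  -- difference r. The other values are those of a first row of length y, raised by r for the extra
  -- cells and by 1 for the deleted row.
  F′ : ℕ → ℚ
  F′ k = F (k ℕ.+ suc r)
  x≡ : x ≡ y ℕ.+ r
  x≡ = sym (ℕ.m+[n∸m]≡n y≤x)
  open +-*-Solver using (solve; _:=_; con; _:+_)
  swap-suc : ∀ r k → r ℕ.+ suc k ≡ k ℕ.+ suc r
  swap-suc = solve 2 (λ r k → r :+ (con 1 :+ k) := k :+ (con 1 :+ r)) refl
  regroup-ℕ : ∀ r y l → r ℕ.+ suc (y ℕ.+ l) ≡ y ℕ.+ r ℕ.+ suc l
  regroup-ℕ = solve 3 (λ r y l → r :+ (con 1 :+ (y :+ l)) := y :+ r :+ (con 1 :+ l)) refl
  opaque
    unfolding _+_
    regroup : ∀ a b c d → a + b + (c + d) ≡ b + (c + (a + d))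
    regroup = solve-∀ ℚ-ring
  monus : ∀ {m a} b → m ℕ.< a → a ℕ.+ b ℕ.∸ suc m ≡ a ℕ.∸ suc m ℕ.+ b
  monus {m} {a} b m<a = ℕ.+-∸-comm b m<a
  left : ∀ {j} → j ℕ.< y → x ℕ.∸ suc j ℕ.+ leg (y ∷ ys) j ≡ y ℕ.∸ suc j ℕ.+ leg ys j ℕ.+ suc r
  left {j} j<y = trans (cong₂ ℕ._+_ (trans (cong (ℕ._∸ suc j) x≡) (monus r j<y)) (cong length (List.filter-accept (j ℕ.<?_) {xs = ys} j<y)))
    (solve 3 (λ a r b → a :+ r :+ (con 1 :+ b) := a :+ b :+ (con 1 :+ r)) refl (y ℕ.∸ suc j) r (leg ys j))
  right : ∀ j → x ℕ.∸ suc (y ℕ.+ j) ℕ.+ leg (y ∷ ys) (y ℕ.+ j) ≡ r ℕ.∸ suc j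
  right j = trans (cong₂ ℕ._+_ (trans (cong₂ ℕ._∸_ x≡ (sym (ℕ.+-suc y j))) (ℕ.[m+n]∸[m+o]≡n∸o y r (suc j)))
    (leg-small {y} {y ∷ ys} (ℕ.≤-refl ∷ linked) (ℕ.m≤m+n y j))) (ℕ.+-identityʳ (r ℕ.∸ suc j))
  first : x ℕ.+ suc l ℕ.∸ suc (β (y ∷ ys) zero) ≡ r
  first = trans (cong₂ ℕ._∸_ (trans (cong (ℕ._+ suc l) x≡) (solve 3 (λ y r l → y :+ r :+ (con 1 :+ l) := con 1 :+ (y :+ l) :+ r) refl y r l)) (cong suc (β-zero y ys)))
    (ℕ.m+n∸m≡n (suc (y ℕ.+ l)) r)
  rest : ∀ i → x ℕ.+ suc l ℕ.∸ suc (β (y ∷ ys) (suc i)) ≡ y ℕ.+ l ℕ.∸ suc (β ys i) ℕ.+ suc r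
  rest i = trans (cong₂ ℕ._∸_ (trans (cong (ℕ._+ suc l) x≡) (solve 3 (λ y r l → y :+ r :+ (con 1 :+ l) := y :+ l :+ (con 1 :+ r)) refl y r l)) (cong suc (β-suc y ys i)))
    (monus (suc r) (β-< linked i))

Linked-tail : ∀ {x xs} → Linked ℕ._≥_ (x ∷ xs) → Linked ℕ._≥_ xs
Linked-tail [-]          = []
Linked-tail (_ ∷ linked) = linked

-- The numbers β decrease down the rows, so a gap is nonzero only towards a later row. `row-hooks`
-- absorbs the gaps of the first row, the gaps from later rows to it are 0, and the rest is the
-- statement for the tail.
all-hooks : ∀ {xs} → Linked ℕ._≥_ xs → ∀ F →
  ⨁ (allFin (length xs)) (λ i → ⨁< (lookup xs i) (λ j → F (lookup xs i ℕ.∸ suc j ℕ.+ legAt xs i j)))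
  + ⨁² (length xs) (λ i i′ → gap F (β xs i) (β xs i′))
  ≡ ⨁ (allFin (length xs)) (λ i → ⨁< (β xs i) F)
all-hooks {[]} _ F = trans (cong₂ _+_ ⨁-[] ⨁-[]) (trans (+-identityʳ 0ℚ) (sym ⨁-[]))
all-hooks {x ∷ xs} linked F = begin
  ⨁ (allFin (suc l)) (λ i → ⨁< (lookup (x ∷ xs) i) (λ j → F (lookup (x ∷ xs) i ℕ.∸ suc j ℕ.+ legAt (x ∷ xs) i j)))
  + ⨁² (suc l) (λ i i′ → gap F (β (x ∷ xs) i) (β (x ∷ xs) i′))
    ≡⟨ cong₂ _+_ ⨁-allFin-suc (trans ⨁-allFin-suc (cong₂ _+_ first-gaps (⨁-cong other-gaps))) ⟩
  R₀ + R + (g₀ + g)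
    ≡⟨ regroup R₀ R g₀ g ⟩
  (R₀ + g₀) + (R + g)
    ≡⟨ cong₂ _+_ (row-hooks linked F) (all-hooks (Linked-tail linked) F) ⟩
  ⨁< (x ℕ.+ l) F + ⨁ (allFin l) (λ i → ⨁< (β xs i) F)
    ≡⟨ trans ⨁-allFin-suc (cong₂ _+_ (cong (λ m → ⨁< m F) (β-zero x xs)) (⨁-cong (λ i → cong (λ m → ⨁< m F) (β-suc x xs i)))) ⟨
  ⨁ (allFin (suc l)) (λ i → ⨁< (β (x ∷ xs) i) F) ∎
  where
  l = length xs
  R₀ = ⨁< x (λ j → F (x ℕ.∸ suc j ℕ.+ leg xs j))
  R  = ⨁ (allFin l) (λ i → ⨁< (lookup xs i) (λ j → F (lookup xs i ℕ.∸ suc j ℕ.+ legAt xs i j)))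
  g₀ = ⨁ (allFin l) (λ i → F (x ℕ.+ l ℕ.∸ suc (β xs i)))
  g  = ⨁² l (λ i i′ → gap F (β xs i) (β xs i′))
  opaque
    unfolding _+_
    regroup : ∀ a b c d → a + b + (c + d) ≡ (a + c) + (b + d)
    regroup = solve-∀ ℚ-ring
  first-gaps : ⨁ (allFin (suc l)) (λ i′ → gap F (β (x ∷ xs) zero) (β (x ∷ xs) i′)) ≡ g₀
  first-gaps = trans ⨁-allFin-suc (trans (cong₂ _+_ (gap-≤ F {β (x ∷ xs) zero} ℕ.≤-refl)
    (⨁-cong (λ i → trans (cong₂ (gap F) (β-zero x xs) (β-suc x xs i)) (gap-< F (β-< linked i))))) (+-identityˡ g₀))
  other-gaps : ∀ i → ⨁ (allFin (suc l)) (λ i′ → gap F (β (x ∷ xs) (suc i)) (β (x ∷ xs) i′)) ≡ ⨁ (allFin l) (λ i′ → gap F (β xs i) (β xs i′))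
  other-gaps i = trans ⨁-allFin-suc (trans (cong₂ _+_
    (trans (cong₂ (gap F) (β-suc x xs i) (β-zero x xs)) (gap-≤ F (ℕ.<⇒≤ (β-< linked i))))
    (⨁-cong (λ i′ → cong₂ (gap F) (β-suc x xs i) (β-suc x xs i′)))) (+-identityˡ _))

⨁<-from : ∀ {j m} → j ℕ.≤ m → ⨁< m (λ k → 𝟙 (j ℕ.≤? k)) ≡ fromℕ (m ℕ.∸ j)
⨁<-from {j} {m} j≤m = begin
  ⨁< m (λ k → 𝟙 (j ℕ.≤? k))
    ≡⟨ trans (cong (λ m → ⨁< m (λ k → 𝟙 (j ℕ.≤? k))) (sym (ℕ.m+[n∸m]≡n j≤m))) (⨁<-split j (m ℕ.∸ j) (λ k → 𝟙 (j ℕ.≤? k))) ⟩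
  ⨁< j (λ k → 𝟙 (j ℕ.≤? k)) + ⨁< (m ℕ.∸ j) (λ k → 𝟙 (j ℕ.≤? j ℕ.+ k))
    ≡⟨ cong₂ _+_ (trans (⨁<-cong j (λ k k<j → 𝟙-no (j ℕ.≤? k) (ℕ.<⇒≱ k<j))) (⨁-zero (λ _ → refl)))
         (trans (⨁<-cong (m ℕ.∸ j) (λ k _ → 𝟙-yes (j ℕ.≤? j ℕ.+ k) (ℕ.m≤m+n j k))) (trans ⨁-allFin-const (*-identityʳ _))) ⟩
  0ℚ + fromℕ (m ℕ.∸ j)
    ≡⟨ +-identityˡ _ ⟩
  fromℕ (m ℕ.∸ j) ∎

⨁<-at : ∀ j m → ⨁< m (λ k → 𝟙 (k ℕ.≟ j)) ≡ 𝟙 (j ℕ.<? m)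
⨁<-at j m with toSum (j ℕ.<? m)
... | inj₁ j<m = trans (⨁-cong (λ i → 𝟙-⇔ (toℕ i ℕ.≟ j) (i Fin.≟ Fin.fromℕ< j<m)
    (λ eq → Fin.toℕ-injective (trans eq (sym (Fin.toℕ-fromℕ< j<m)))) (λ eq → trans (cong toℕ eq) (Fin.toℕ-fromℕ< j<m))))
  (trans (FinE.once (Fin.fromℕ< j<m)) (sym (𝟙-yes (j ℕ.<? m) j<m)))
... | inj₂ j≮m = trans (⨁-zero (λ i → 𝟙-no (toℕ i ℕ.≟ j) (λ eq → j≮m (subst (ℕ._< m) eq (Fin.toℕ<n i))))) (sym (𝟙-no (j ℕ.<? m) j≮m))

⨁-legAt : ∀ xs i j → ⨁ (allFin (length xs)) (λ i′ → 𝟙 (toℕ i ℕ.<? toℕ i′) * 𝟙 (j ℕ.<? lookup xs i′)) ≡ fromℕ (legAt xs i j)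
⨁-legAt (x ∷ xs) zero j = trans ⨁-allFin-suc (trans (cong₂ _+_
  (trans (cong (_* 𝟙 (j ℕ.<? x)) (𝟙-no (0 ℕ.<? 0) (ℕ.n≮n 0))) (zeroˡ (𝟙 (j ℕ.<? x))))
  (trans (⨁-cong (λ i′ → trans (cong (_* 𝟙 (j ℕ.<? lookup xs i′)) (𝟙-yes (0 ℕ.<? suc (toℕ i′)) (ℕ.s≤s ℕ.z≤n))) (*-identityˡ _)))
    (trans (⨁-lookup xs (λ y → 𝟙 (j ℕ.<? y))) (sym (⨁-𝟙 (j ℕ.<?_) xs)))))
  (+-identityˡ _))
⨁-legAt (x ∷ xs) (suc i) j = trans ⨁-allFin-suc (trans (cong₂ _+_
  (trans (cong (_* 𝟙 (j ℕ.<? x)) (𝟙-no (suc (toℕ i) ℕ.<? 0) ℕ.n≮0)) (zeroˡ (𝟙 (j ℕ.<? x))))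
  (trans (⨁-cong (λ i′ → cong (_* 𝟙 (j ℕ.<? lookup xs i′)) (𝟙-⇔ (suc (toℕ i) ℕ.<? suc (toℕ i′)) (toℕ i ℕ.<? toℕ i′) ℕ.≤-pred ℕ.s≤s)))
    (⨁-legAt xs i j)))
  (+-identityˡ _))

module _ {d} (μ : Partition d) where

  private
    xs = parts μ

  private
    inHook? : ∀ (η : Cell μ) i (j : Fin (lookup xs i)) → Dec (η InHookOf cell i j)
    inHook? η i j = η inHookOf? cell i j

  hookLength≡ : ∀ i (j : Fin (lookup xs i)) → hookLength μ (cell i j) ≡ suc (lookup xs i ℕ.∸ suc (toℕ j) ℕ.+ legAt xs i (toℕ j))
  hookLength≡ i j = fromℕ-injective (begin
    fromℕ (hookLength μ (cell i j))
      ≡⟨ trans (⨁-𝟙 (λ η → inHook? η i j) (cells μ)) (⨁-cells _) ⟩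
    ⨁ (allFin (length xs)) (λ i′ → ⨁ (allFin (lookup xs i′)) (λ j′ → 𝟙 (inHook? (cell i′ j′) i j)))
      ≡⟨ ⨁-cong (λ i′ → trans (⨁-cong (disjoint i′)) (trans ⨁-+
           (cong₂ _+_ ⨁-*ˡ (trans ⨁-*ˡ
             (cong (𝟙 (toℕ i ℕ.<? toℕ i′) *_) (⨁<-at (toℕ j) (lookup xs i′))))))) ⟩
    ⨁ (allFin (length xs)) (λ i′ → 𝟙 (i′ Fin.≟ i) * ⨁< (lookup xs i′) (λ k → 𝟙 (toℕ j ℕ.≤? k)) + 𝟙 (toℕ i ℕ.<? toℕ i′) * 𝟙 (toℕ j ℕ.<? lookup xs i′))
      ≡⟨ trans ⨁-+ (cong₂ _+_ (trans (⨁-pick-Fin (λ i′ → ⨁< (lookup xs i′) (λ k → 𝟙 (toℕ j ℕ.≤? k))) i) (⨁<-from (ℕ.<⇒≤ (Fin.toℕ<n j))))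
           (⨁-legAt xs i (toℕ j))) ⟩
    fromℕ (lookup xs i ℕ.∸ toℕ j) + fromℕ (legAt xs i (toℕ j))
      ≡⟨ trans (cong (λ k → fromℕ (k ℕ.+ legAt xs i (toℕ j))) (sym (ℕ.+-∸-assoc 1 (Fin.toℕ<n j)))) (fromℕ-+ (lookup xs i ℕ.∸ toℕ j) (legAt xs i (toℕ j))) ⟨
    fromℕ (suc (lookup xs i ℕ.∸ suc (toℕ j) ℕ.+ legAt xs i (toℕ j))) ∎)
    where
    disjoint : ∀ i′ (j′ : Fin (lookup xs i′)) → 𝟙 (inHook? (cell i′ j′) i j)
               ≡ 𝟙 (i′ Fin.≟ i) * 𝟙 (toℕ j ℕ.≤? toℕ j′) + 𝟙 (toℕ i ℕ.<? toℕ i′) * 𝟙 (toℕ j′ ℕ.≟ toℕ j)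
    disjoint i′ j′ with toSum (i′ Fin.≟ i)
    ... | inj₁ refl rewrite 𝟙-yes (i Fin.≟ i) refl | 𝟙-no (toℕ i ℕ.<? toℕ i) (ℕ.n≮n (toℕ i)) = trans
      (𝟙-⇔ (inHook? (cell i j′) i j) (toℕ j ℕ.≤? toℕ j′) (λ { (inj₁ (_ , p)) → p ; (inj₂ (_ , i<i)) → contradiction i<i (ℕ.n≮n (toℕ i)) }) (λ p → inj₁ (refl , p)))
      (sym (trans (cong₂ _+_ (*-identityˡ _) (zeroˡ _)) (+-identityʳ _)))
    ... | inj₂ i′≢i rewrite 𝟙-no (i′ Fin.≟ i) i′≢i = trans
      (trans (𝟙-⇔ (inHook? (cell i′ j′) i j) ((toℕ i ℕ.<? toℕ i′) ×-dec (toℕ j′ ℕ.≟ toℕ j))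
        (λ { (inj₁ (p , _)) → contradiction (Fin.toℕ-injective p) i′≢i ; (inj₂ (p , q)) → q , p }) (λ (p , q) → inj₂ (q , p)))
        (𝟙-× (toℕ i ℕ.<? toℕ i′) (toℕ j′ ℕ.≟ toℕ j)))
      (sym (trans (cong (_+ 𝟙 (toℕ i ℕ.<? toℕ i′) * 𝟙 (toℕ j′ ℕ.≟ toℕ j)) (zeroˡ (𝟙 (toℕ j ℕ.≤? toℕ j′)))) (+-identityˡ _)))

  ⨁-hooks : ∀ (F : ℕ → ℚ) →
    ⨁ (allFin (length xs)) (λ i → ⨁< (shifted {μ = μ} i) (F ∘ suc)) + - ⨁² (length xs) (λ i i′ → gap (F ∘ suc) (shifted {μ = μ} i) (shifted {μ = μ} i′))
    ≡ ⨁ (cells μ) (λ ξ → F (hookLength μ ξ))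
  ⨁-hooks F = trans (cong (_+ - g) (sym (all-hooks {xs} (proj₁ (proj₂ (isPartition μ))) (F ∘ suc)))) (trans (cancel _ g)
    (sym (trans (⨁-cells _) (⨁-cong (λ i → ⨁-cong (λ j → cong F (hookLength≡ i j)))))))
    where
    g = ⨁² (length xs) (λ i i′ → gap (F ∘ suc) (β xs i) (β xs i′))
    opaque
      unfolding _+_
      cancel : ∀ a b → a + b + - b ≡ a
      cancel = solve-∀ ℚ-ring

-- Compositions and cycle types

infix 4 _≟ᴸ_

_≟ᴸ_ : (xs ys : List ℕ) → Dec (xs ≡ ys)
_≟ᴸ_ = List.≡-dec ℕ._≟_

count-compositions : ℕ → List ℕ → ℚ
count-compositions d ys = ⨁ (compositions d) (λ c → 𝟙 (c ≟ᴸ ys))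

-- `inc` stands for `incrementHead`, which is local to `compositions`: the lemmas speak of any
-- function with its two equations, and unification supplies it.
module _ (inc : List ℕ → List ℕ) (inc-[] : inc [] ≡ []) (inc-∷ : ∀ x xs → inc (x ∷ xs) ≡ suc x ∷ xs) where

  private
    extend : ∀ cs ys → ⨁ (concatMap (λ c → (1 ∷ c) ∷ inc c ∷ []) cs) (λ c → 𝟙 (c ≟ᴸ ys))
                       ≡ ⨁ cs (λ c → 𝟙 (1 ∷ c ≟ᴸ ys)) + ⨁ cs (λ c → 𝟙 (inc c ≟ᴸ ys))
    extend cs ys = trans ⨁-concatMap (trans
      (⨁-cong (λ c → trans ⨁-∷ (cong (𝟙 (1 ∷ c ≟ᴸ ys) +_) (trans ⨁-∷ (trans (cong (𝟙 (inc c ≟ᴸ ys) +_) ⨁-[]) (+-identityʳ _))))))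
      ⨁-+)

    inc≢0∷ : ∀ c {ys} → inc c ≢ 0 ∷ ys
    inc≢0∷ []       eq with () ← trans (sym inc-[]) eq
    inc≢0∷ (x ∷ xs) eq with () ← trans (sym (inc-∷ x xs)) eq

    inc≡suc : ∀ c {y ys} → inc c ≡ suc y ∷ ys → c ≡ y ∷ ys
    inc≡suc []       eq with () ← trans (sym inc-[]) eq
    inc≡suc (x ∷ xs) eq with refl ← trans (sym (inc-∷ x xs)) eq = refl

  extend-0 : ∀ cs ys → ⨁ (concatMap (λ c → (1 ∷ c) ∷ inc c ∷ []) cs) (λ c → 𝟙 (c ≟ᴸ 0 ∷ ys)) ≡ 0ℚ
  extend-0 cs ys = trans (extend cs (0 ∷ ys)) (trans (cong₂ _+_ (⨁-zero (λ c → 𝟙-no (1 ∷ c ≟ᴸ 0 ∷ ys) (λ ())))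
    (⨁-zero (λ c → 𝟙-no (inc c ≟ᴸ 0 ∷ ys) (inc≢0∷ c)))) (+-identityʳ 0ℚ))

  extend-1 : ∀ cs ys → ⨁ (concatMap (λ c → (1 ∷ c) ∷ inc c ∷ []) cs) (λ c → 𝟙 (c ≟ᴸ 1 ∷ ys))
                       ≡ ⨁ cs (λ c → 𝟙 (c ≟ᴸ ys)) + ⨁ cs (λ c → 𝟙 (c ≟ᴸ 0 ∷ ys))
  extend-1 cs ys = trans (extend cs (1 ∷ ys)) (cong₂ _+_
    (⨁-cong (λ c → 𝟙-⇔ (1 ∷ c ≟ᴸ 1 ∷ ys) (c ≟ᴸ ys) List.∷-injectiveʳ (cong (1 ∷_))))
    (⨁-cong (λ c → 𝟙-⇔ (inc c ≟ᴸ 1 ∷ ys) (c ≟ᴸ 0 ∷ ys) (inc≡suc c) (λ { refl → inc-∷ 0 ys }))))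

  extend-2+ : ∀ cs y ys → ⨁ (concatMap (λ c → (1 ∷ c) ∷ inc c ∷ []) cs) (λ c → 𝟙 (c ≟ᴸ suc (suc y) ∷ ys)) ≡ ⨁ cs (λ c → 𝟙 (c ≟ᴸ suc y ∷ ys))
  extend-2+ cs y ys = trans (extend cs (suc (suc y) ∷ ys)) (trans (cong₂ _+_
    (⨁-zero (λ c → 𝟙-no (1 ∷ c ≟ᴸ suc (suc y) ∷ ys) (λ ())))
    (⨁-cong (λ c → 𝟙-⇔ (inc c ≟ᴸ suc (suc y) ∷ ys) (c ≟ᴸ suc y ∷ ys) (inc≡suc c) (λ { refl → inc-∷ (suc y) ys }))))
    (+-identityˡ _))

-- Incrementing the head of `0 ∷ ys` would produce a second copy of `1 ∷ ys`; this is the extra term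
-- of `extend-1`.
compositions-0∷ : ∀ d ys → count-compositions d (0 ∷ ys) ≡ 0ℚ
compositions-0∷ zero          ys = trans ⨁-∷ (trans (cong₂ _+_ (𝟙-no ([] ≟ᴸ 0 ∷ ys) (λ ())) ⨁-[]) (+-identityʳ 0ℚ))
compositions-0∷ (suc zero)    ys = trans ⨁-∷ (trans (cong₂ _+_ (𝟙-no ((1 ∷ []) ≟ᴸ 0 ∷ ys) (λ ())) ⨁-[]) (+-identityʳ 0ℚ))
compositions-0∷ (suc (suc d)) ys = extend-0 _ refl (λ _ _ → refl) (compositions (suc d)) ys

compositions-once : ∀ d ys → All (0 ℕ.<_) ys → sum ys ≡ d → count-compositions d ys ≡ 1ℚ
compositions-once zero          []             _         _  = trans ⨁-∷ (trans (cong₂ _+_ (𝟙-yes ([] ≟ᴸ []) refl) ⨁-[]) (+-identityʳ 1ℚ))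
compositions-once zero          (zero ∷ ys)    (() ∷ _)  _
compositions-once zero          (suc y ∷ ys)   _         ()
compositions-once (suc zero)    (zero ∷ ys)    (() ∷ _)  _
compositions-once (suc zero)    (1 ∷ [])       _         _  = trans ⨁-∷ (trans (cong₂ _+_ (𝟙-yes ((1 ∷ []) ≟ᴸ (1 ∷ [])) refl) ⨁-[]) (+-identityʳ 1ℚ))
compositions-once (suc zero)    (1 ∷ zero ∷ ys) (_ ∷ () ∷ _) _
compositions-once (suc zero)    (suc (suc y) ∷ ys) _     ()
compositions-once (suc (suc d)) (1 ∷ ys)       (_ ∷ pos) eq = trans (extend-1 _ refl (λ _ _ → refl) (compositions (suc d)) ys)
  (trans (cong₂ _+_ (compositions-once (suc d) ys pos (ℕ.suc-injective eq)) (compositions-0∷ (suc d) ys)) (+-identityʳ 1ℚ))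
compositions-once (suc (suc d)) (suc (suc y) ∷ ys) (_ ∷ pos) eq = trans (extend-2+ _ refl (λ _ _ → refl) (compositions (suc d)) y ys)
  (compositions-once (suc d) (suc y ∷ ys) (ℕ.s≤s ℕ.z≤n ∷ pos) (ℕ.suc-injective eq))

⨁-mapMaybe : ∀ {I J : Set} (g : I → Maybe.Maybe J) xs φ → ⨁ (mapMaybe g xs) φ ≡ ⨁ xs (λ x → Maybe.maybe φ 0ℚ (g x))
⨁-mapMaybe g []       φ = trans ⨁-[] (sym ⨁-[])
⨁-mapMaybe g (x ∷ xs) φ = trans (step (g x)) (sym ⨁-∷)
  where
  step : ∀ y → ⨁ (Maybe.maybe′ _∷_ id y (mapMaybe g xs)) φ ≡ Maybe.maybe φ 0ℚ y + ⨁ xs (λ x → Maybe.maybe φ 0ℚ (g x))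
  step (Maybe.just y) = trans ⨁-∷ (cong (φ y +_) (⨁-mapMaybe g xs φ))
  step Maybe.nothing  = trans (⨁-mapMaybe g xs φ) (sym (+-identityˡ _))

𝐏-once : ∀ d xs → IsPartition d xs → ⨁ (𝐏 d) (λ μ → 𝟙 (xs ≟ᴸ parts μ)) ≡ 1ℚ
𝐏-once d xs xs-part@(pos , _ , sum≡) = trans (⨁-mapMaybe _ (compositions d) _) (trans
  (⨁-cong (λ c → step c (isPartition? d c))) (compositions-once d xs pos sum≡))
  where
  step : ∀ c (p? : Dec (IsPartition d c)) →
         Maybe.maybe (λ μ → 𝟙 (xs ≟ᴸ parts μ)) 0ℚ (Maybe.map (mkPartition c) (dec⇒maybe p?)) ≡ 𝟙 (c ≟ᴸ xs)
  step c (yes p) = 𝟙-⇔ (xs ≟ᴸ c) (c ≟ᴸ xs) sym sym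
  step c (no ¬p) = sym (𝟙-no (c ≟ᴸ xs) (λ { refl → ¬p xs-part }))

-- Integer powers and the sum over classes

1/-* : ∀ m a .{{_ : ℕ.NonZero m}} .{{_ : ℕ.NonZero a}} .{{_ : ℕ.NonZero (m ℕ.* a)}} → ℤ.+ 1 / a ≡ fromℕ m * (ℤ.+ 1 / (m ℕ.* a))
1/-* m a = *-cancelˡ-≢0 (fromℕ (m ℕ.* a)) (λ eq → ℕ.≢-nonZero⁻¹ (m ℕ.* a) (fromℕ-injective {m ℕ.* a} {0} eq)) (begin
  fromℕ (m ℕ.* a) * (ℤ.+ 1 / a)                   ≡⟨ cong (_* (ℤ.+ 1 / a)) (fromℕ-* m a) ⟩
  fromℕ m * fromℕ a * (ℤ.+ 1 / a)                 ≡⟨ *-assoc (fromℕ m) (fromℕ a) _ ⟩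
  fromℕ m * (fromℕ a * (ℤ.+ 1 / a))               ≡⟨ cong (fromℕ m *_) (trans (*-inverse-/ a) (sym (*-inverse-/ (m ℕ.* a)))) ⟩
  fromℕ m * (fromℕ (m ℕ.* a) * (ℤ.+ 1 / (m ℕ.* a))) ≡⟨ exchange (fromℕ m) (fromℕ (m ℕ.* a)) (ℤ.+ 1 / (m ℕ.* a)) ⟩
  fromℕ (m ℕ.* a) * (fromℕ m * (ℤ.+ 1 / (m ℕ.* a))) ∎)

-- Positivity of m matters at p = 0, where m = 0 would give 1 on the left and 0 on the right. It
-- holds for cycle lengths.
^ℤ-pred : ∀ {m} p → 0 ℕ.< m → m ^ℤ p ≡ fromℕ m * m ^ℤ (p ℤ.- 1ℤ)
^ℤ-pred {suc m} (ℤ.+ zero)  _ = 1/-* (suc m) 1 {{_}} {{_}} {{ℕ.m^n≢0 (suc m) 1}}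
^ℤ-pred {suc m} (ℤ.+ suc k) _ = fromℕ-* (suc m) (suc m ℕ.^ k)
^ℤ-pred {suc m} -[1+ k ]    _ rewrite ℕ.+-identityʳ k =
  1/-* (suc m) (suc m ℕ.^ suc k) {{_}} {{ℕ.m^n≢0 (suc m) (suc k)}} {{ℕ.m^n≢0 (suc m) (suc (suc k))}}

⨁-cong-All : ∀ {I : Set} {Q : I → Set} {xs} {f g : I → ℚ} → All Q xs → (∀ {x} → Q x → f x ≡ g x) → ⨁ xs f ≡ ⨁ xs g
⨁-cong-All []         eq = trans ⨁-[] (sym ⨁-[])
⨁-cong-All (Qx ∷ Qxs) eq = trans ⨁-∷ (trans (cong₂ _+_ (eq Qx) (⨁-cong-All Qxs eq)) (sym ⨁-∷))

S-cycleType : ∀ {d} p (σ : Permutation′ d) →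
              ⨁ (cycleType σ) (_^ℤ p) ≡ ⨁ (allFin d) (λ x → cycleLength σ x ^ℤ (p ℤ.- 1ℤ))
S-cycleType p σ = trans (⨁-cong-All (proj₁ (cycleType-isPartition σ)) (^ℤ-pred p)) (⨁-cycleType σ (_^ℤ (p ℤ.- 1ℤ)))

module _ (d : ℕ) (p : ℤ) (lam : Partition d) (χ : Partition d → ℚ) (isχ : IsIrreducibleCharacter lam χ) where

  private
    F : ℕ → ℚ
    F m = m ^ℤ (p ℤ.- 1ℤ)

    x⁺ : Fin (length (parts lam)) → ℤ
    x⁺ i = ℤ.+ shifted {μ = lam} i

    term : Permutation′ d → ℚ
    term σ = ⨁ (allFin d) (λ y → F (cycleLength σ y)) * (s x⁺ σ * s x⁺ σ)

  class-sum : ∀ μ → ⨁ (parts μ) (_^ℤ p) * fromℕ (z μ) * (χ μ * χ μ) ≡ ⨁ (permutations d) (λ σ → 𝟙 (hasCycleType? σ μ) * term σ)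
  class-sum μ = begin
    ⨁ (parts μ) (_^ℤ p) * fromℕ (z μ) * (χ μ * χ μ)
      ≡⟨ cong (λ w → ⨁ (parts μ) (_^ℤ p) * w * (χ μ * χ μ)) (⨁-𝟙 (λ σ → hasCycleType? σ μ) (permutations d)) ⟩
    ⨁ (parts μ) (_^ℤ p) * ⨁ (permutations d) (λ σ → 𝟙 (hasCycleType? σ μ)) * (χ μ * χ μ)
      ≡⟨ trans (commute (⨁ (parts μ) (_^ℤ p)) _ (χ μ * χ μ)) (sym ⨁-*ʳ) ⟩
    ⨁ (permutations d) (λ σ → 𝟙 (hasCycleType? σ μ) * (⨁ (parts μ) (_^ℤ p) * (χ μ * χ μ)))
      ≡⟨ ⨁-cong (λ σ → 𝟙-cong (hasCycleType? σ μ) (λ σ∈μ → cong₂ _*_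
           (trans (cong (λ xs → ⨁ xs (_^ℤ p)) (sym σ∈μ)) (S-cycleType p σ))
           (cong₂ _*_ (character≡s isχ σ μ σ∈μ) (character≡s isχ σ μ σ∈μ)))) ⟩
    ⨁ (permutations d) (λ σ → 𝟙 (hasCycleType? σ μ) * term σ) ∎
    where
    opaque
      unfolding _+_
      commute : ∀ a b c → a * b * c ≡ b * (a * c)
      commute = solve-∀ ℚ-ring

  hook-formula : 1/ d ! * ⨁ (𝐏 d) (λ μ → ⨁ (parts μ) (_^ℤ p) * fromℕ (z μ) * (χ μ * χ μ)) ≡ ⨁ (cells lam) (λ ξ → F (hookLength lam ξ))
  hook-formula = begin
    1/ d ! * ⨁ (𝐏 d) (λ μ → ⨁ (parts μ) (_^ℤ p) * fromℕ (z μ) * (χ μ * χ μ))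
      ≡⟨ cong (1/ d ! *_) (trans (⨁-cong class-sum) ⨁-swap) ⟩
    1/ d ! * ⨁ (permutations d) (λ σ → ⨁ (𝐏 d) (λ μ → 𝟙 (hasCycleType? σ μ) * term σ))
      ≡⟨ cong (1/ d ! *_) (⨁-cong (λ σ → trans ⨁-*ʳ
           (trans (cong (_* term σ) (𝐏-once d (cycleType σ) (cycleType-isPartition σ))) (*-identityˡ (term σ))))) ⟩
    1/ d ! * ⨁ (permutations d) term
      ≡⟨ s-weighted (shifted {μ = lam}) (shifted-injective {μ = lam}) (total-shifted {μ = lam}) F ⟩
    _
      ≡⟨ ⨁-hooks lam F ⟩
    ⨁ (cells lam) (λ ξ → F (hookLength lam ξ)) ∎

opaque
  unfolding _+_ ⨁

  -- In this block the opaque operations and `⨁` unfold to those of the definitions, so that the two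
  -- statements agree by computation.
  hook-formula′ : ∀ d p (lam : Partition d) (χ : Partition d → ℚ) → IsIrreducibleCharacter lam χ →
    1/ d ! ℚ.* ∑ (𝐏 d) (λ μ → S p μ ℚ.* fromℕ (z μ) ℚ.* (χ μ ℚ.* χ μ)) ≡ T p lam
  hook-formula′ = hook-formula

corollary13p2 : ∀ (d : ℕ) → 1 ℕ.≤ d → ∀ (p : ℤ) (lam : Partition d) (χ : Partition d → ℚ) →
    IsIrreducibleCharacter lam χ →
    1/ d ! ℚ.* ∑ (𝐏 d) (λ μ → S p μ ℚ.* fromℕ (z μ) ℚ.* (χ μ ℚ.* χ μ)) ≡ T p lam
corollary13p2 d _ p lam χ isχ = hook-formula′ d p lam χ isχ
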